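{- Let $N$ be an even-plane matroid. Then every claw-free, $N$-free matroid $M$ satisfies $\chi(M)\le f(\omega(M))$, where $f(k)=(k+2)2^{k+1}+k(\dim(N)+4)$.
   Context: A matroid is a pair $M=(E,G)$ where $G$ is the set of nonzero vectors of a finite-dimensional $\mathbb F_2$-vector space $V(G)=G\cup\{0\}\cong\mathbb F_2^n$ and $E\subseteq G$; $n=\dim(M)$. Isomorphism: a linear isomorphism of ambient spaces mapping ground sets onto each other. A flat of $G$ is a set $F\subseteq G$ with $F\cup\{0\}$ a subspace; its dimension is that of the subspace; planes are $3$-dimensional flats. $M|F=(E\cap F,F)$; $M$ is $N$-free if no $M|F$ is isomorphic to $N$. A claw is $(B,G)$ with $\dim G=3$, $B$ a basis; claw-free means claw-free as an induced restriction. $M$ is even-plane if $|E\cap P|$ is even for every plane $P$ of $G$. $\omega(M)$ is the largest dimension of a flat contained in $E$ ($0$ if $E=\varnothing$); $M^c=(G\setminus E,G)$; $\chi(M)=\dim(M)-\omega(M^c)$. -}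

module Defs where

open import Data.Bool using (Bool; true; false; _xor_; _∧_; _∨_; not; if_then_else_)
open import Data.Nat using (ℕ; zero; suc; _+_; _*_; _^_; _≤_)
open import Data.Nat.Divisibility using (_∣_)
open import Data.Vec using (Vec; []; _∷_; zipWith; replicate)
open import Data.List using (List; []; _∷_; map; _++_)
open import Data.Nat.ListAction using (sum)
open import Data.Product using (Σ; _×_)
open import Relation.Binary.PropositionalEquality using (_≡_; _≢_)
open import Relation.Nullary using (¬_)

-- Vectors of F₂ⁿ are Vec Bool n (true = 1).  The zero vector:
0v : (n : ℕ) → Vec Bool n
0v n = replicate n false

_⊕_ : ∀ {n} → Vec Bool n → Vec Bool n → Vec Bool n
_⊕_ = zipWith _xor_

nonzero? : ∀ {n} → Vec Bool n → Bool
nonzero? [] = false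
nonzero? (b ∷ bs) = b ∨ nonzero? bs

-- A matroid (E, G) with G = F₂ⁿ ∖ {0}; the ground set E ⊆ G is given by its
-- (decidable) indicator function.  The value at the zero vector is ignored
-- everywhere (it is never queried).
record Matroid (n : ℕ) : Set where
  constructor mkMatroid
  field
    E : Vec Bool n → Bool

open Matroid public

-- dim(M) is the index n.

compl : ∀ {n} → Matroid n → Matroid n
compl M = mkMatroid (λ x → not (E M x))

-- Linear map F₂ᵏ → F₂ⁿ given by the images of the standard basis vectors
lin : ∀ {k n} → Vec (Vec Bool n) k → Vec Bool k → Vec Bool n
lin {n = n} [] [] = 0v n
lin {n = n} (c ∷ cs) (b ∷ bs) = (if b then c else 0v n) ⊕ lin cs bs

Injective : ∀ {k n} → Vec (Vec Bool n) k → Set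
Injective {k} cs = ∀ (x y : Vec Bool k) → lin cs x ≡ lin cs y → x ≡ y

-- Embeds N M : some flat F of G(M) has M|F ≅ N, i.e. there is an injective
-- linear map φ : V(N) → V(M) (with image F ∪ {0}) such that for every
-- nonzero x, φ x ∈ E(M) ⟺ x ∈ E(N).
Embeds : ∀ {d n} → Matroid d → Matroid n → Set
Embeds {d} {n} N M =
  Σ (Vec (Vec Bool n) d) λ φ →
    Injective φ × (∀ (x : Vec Bool d) → x ≢ 0v d → E M (lin φ x) ≡ E N x)

Free : ∀ {d n} → Matroid d → Matroid n → Set
Free N M = ¬ Embeds N M

claw : Matroid 3
claw = mkMatroid isBasisVec
  where
  isBasisVec : Vec Bool 3 → Bool
  isBasisVec (true  ∷ false ∷ false ∷ []) = true
  isBasisVec (false ∷ true  ∷ false ∷ []) = true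
  isBasisVec (false ∷ false ∷ true  ∷ []) = true
  isBasisVec _ = false

ClawFree : ∀ {n} → Matroid n → Set
ClawFree M = Free claw M

allVecs : (k : ℕ) → List (Vec Bool k)
allVecs zero = [] ∷ []
allVecs (suc k) = map (true ∷_) (allVecs k) ++ map (false ∷_) (allVecs k)

planeCount : ∀ {n} → Matroid n → Vec (Vec Bool n) 3 → ℕ
planeCount M φ =
  sum (map (λ x → if nonzero? x ∧ E M (lin φ x) then 1 else 0) (allVecs 3))

-- Even-plane: every plane (3-dim flat = image of an injective linear map
-- F₂³ → F₂ⁿ minus 0) meets E in an even number of elements.
EvenPlane : ∀ {n} → Matroid n → Set
EvenPlane {n} M = ∀ (φ : Vec (Vec Bool n) 3) → Injective φ → 2 ∣ planeCount M φ

HasFlat : ∀ {n} → Matroid n → ℕ → Set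
HasFlat {n} M k =
  Σ (Vec (Vec Bool n) k) λ φ →
    Injective φ × (∀ (x : Vec Bool k) → x ≢ 0v k → E M (lin φ x) ≡ true)

-- IsOmega M w : w = ω(M), the largest dimension of a flat contained in E
-- (k = 0 always qualifies, so ω(∅) = 0).
IsOmega : ∀ {n} → Matroid n → ℕ → Set
IsOmega M w = HasFlat M w × (∀ k → HasFlat M k → k ≤ w)

f : ℕ → ℕ → ℕ
f dimN k = (k + 2) * 2 ^ (k + 1) + k * (dimN + 4)

{-# OPTIONS --safe #-}

-- Let W be a maximum flat avoiding E and Q = V(G) / W, of dimension χ(M).  By maximality E meets every coset a ≠ 0 of W
-- in a nonempty set F a, and three points of one coset never form a claw, so F a is affine, with a direction D a ≤ W.
-- Claws in two cosets show that on a line {a, b, c} of Q the directions are all equal; or two are equal and contain the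
-- third; or two are equal and of index 2 in the third; or they are three distinct index-2 subgroups forming a pencil.
--
-- Let V ≤ Q be spanned by the points whose D is smallest, and U a complement of V.  For a in U and a point v with smallest
-- D one has D a = D (a + v) ⊇ D v, so every clique over U can be enlarged by v; hence ω drops on U and, by induction on ω,
-- it suffices to bound dim V by (k + 3) 2ᵏ + dim N + 4 for k = ω(M).  On V either all D contain a common subgroup with index
-- at most 2, so that D c is given by a vector u c modulo it, or all D have index at most 2 in a common subgroup, so that
-- D c is the kernel of a linear form on it.  If these labels take two distinct nonzero values, then V is spanned by a
-- flat on which they vanish, which carries a clique, and a flat on which they are linear and injective, which carries a
-- clique in the first case and, claw-freeness making E a quadratic form there, every even-plane matroid in the second.
-- Otherwise a linear section of V → Q meets the complement of E in a triangle-free set T that meets every flat of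
-- dimension k + 1.  A triangle-free set of density α has density at most α - α² in some hyperplane, since its Fourier
-- coefficients satisfy Σ F³ = 0, so at most 2ᵏ⁺¹ hyperplanes can be cut out before dimension k + 1 is reached.

module Submission where

open import Defs
open import Algebra.Bundles using (CommutativeRing)
open import Data.Bool using (Bool; true; false; _xor_; _∧_; _∨_; not; if_then_else_)
import Data.Bool.Properties as Boolₚ
open import Data.Empty using (⊥; ⊥-elim)
open import Data.Fin using (Fin; splitAt; _↑ˡ_; _↑ʳ_)
import Data.Fin.Properties as Finₚ
open import Data.Integer using (ℤ; +_; -[1+_]; +≤+; +<+) renaming (_+_ to _+ℤ_; _*_ to _*ℤ_; -_ to -ℤ_; _≤_ to _≤ℤ_; _<_ to _<ℤ_)
import Data.Integer.Properties as ℤₚ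
open import Data.Integer.Solver using () renaming (module +-*-Solver to ℤ-Solver)
open import Data.Nat using (ℕ; zero; suc; _+_; _*_; _^_; _∸_; _≤_; _<_; z≤n; s≤s)
open import Data.Nat.Divisibility using (_∣_; divides)
import Data.Nat.Properties as ℕₚ
open import Data.Nat.Solver using () renaming (module +-*-Solver to ℕ-Solver)
open import Data.Product using (Σ; ∃; _×_; _,_; proj₁; proj₂)
open import Data.Sum using (_⊎_; inj₁; inj₂)
open import Data.Vec using (Vec; []; _∷_; lookup; map; zipWith; _++_)
import Data.Vec.Properties as Vecₚ
open import Data.Vec.Relation.Unary.All using (All)
import Data.Vec.Relation.Unary.All as All
open import Function using (_∘_; case_of_)
import Relation.Binary.Reflection as Reflection
open import Relation.Binary.PropositionalEquality
open import Relation.Nullary using (¬_; Dec; yes; no)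
open import Relation.Nullary.Decidable using (_×-dec_; ¬?; map′; True; toWitness)

-- Maximality of W is used twice. Adding one vector to W shows that no fibre is empty. Trading W for
-- a hyperplane of it together with two further vectors shows that no linear form separates the
-- three fibres of a line (`inseparable`), and so every line of Q carries points x over a and y over
-- b with x ⊕ y in the fibre over a ⊕ b. This is what makes up for the absence of a linear choice of
-- points in the fibres: such a choice exists only modulo a subgroup that contains the directions
-- (`section`), and the remaining ambiguity must be small to be of use. Hence the passage to V. The
-- line types allow nested directions of unbounded index, whereas on V the sizes of any two
-- directions differ by a factor of at most two. The function f collects the losses of the
-- induction: f(k) - f(k - 1) = (k + 3) 2ᵏ + dim N + 4. This increment dominates both bounds that
-- are reached for dim V, namely 2ᵏ⁺¹ + k from triangle-free sets and k + dim N from the two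
-- spanning flats.

V : ℕ → Set
V = Vec Bool

_≟ᵥ_ : ∀ {n} (x y : V n) → Dec (x ≡ y)
_≟ᵥ_ = Vecₚ.≡-dec Boolₚ._≟_

true≢false : true ≢ false
true≢false ()

-- Vectors over F₂ and linear combinations

⊕-assoc : ∀ {n} (x y z : V n) → (x ⊕ y) ⊕ z ≡ x ⊕ (y ⊕ z)
⊕-assoc [] [] [] = refl
⊕-assoc (a ∷ x) (b ∷ y) (c ∷ z) = cong₂ _∷_ (Boolₚ.xor-assoc a b c) (⊕-assoc x y z)

⊕-comm : ∀ {n} (x y : V n) → x ⊕ y ≡ y ⊕ x
⊕-comm [] [] = refl
⊕-comm (a ∷ x) (b ∷ y) = cong₂ _∷_ (Boolₚ.xor-comm a b) (⊕-comm x y)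

⊕-idˡ : ∀ {n} (x : V n) → 0v n ⊕ x ≡ x
⊕-idˡ [] = refl
⊕-idˡ (a ∷ x) = cong (a ∷_) (⊕-idˡ x)

⊕-idʳ : ∀ {n} (x : V n) → x ⊕ 0v n ≡ x
⊕-idʳ x = trans (⊕-comm x _) (⊕-idˡ x)

⊕-self : ∀ {n} (x : V n) → x ⊕ x ≡ 0v n
⊕-self [] = refl
⊕-self (a ∷ x) = cong₂ _∷_ (Boolₚ.xor-same a) (⊕-self x)

⊕-interchange : ∀ {n} (a b c d : V n) → (a ⊕ b) ⊕ (c ⊕ d) ≡ (a ⊕ c) ⊕ (b ⊕ d)
⊕-interchange a b c d = trans (⊕-assoc a b (c ⊕ d)) (trans (cong (a ⊕_)
  (trans (sym (⊕-assoc b c d)) (trans (cong (_⊕ d) (⊕-comm b c)) (⊕-assoc c b d))))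
  (sym (⊕-assoc a c (b ⊕ d))))

_when_ : ∀ {n} → V n → Bool → V n
_when_ {n} c b = if b then c else 0v n

when-xor : ∀ {n} (c : V n) a b → c when (a xor b) ≡ (c when a) ⊕ (c when b)
when-xor c true true = sym (⊕-self c)
when-xor c true false = sym (⊕-idʳ c)
when-xor c false b = sym (⊕-idˡ _)

lin-⊕ : ∀ {k n} (cs : Vec (V n) k) (x y : V k) → lin cs (x ⊕ y) ≡ lin cs x ⊕ lin cs y
lin-⊕ [] [] [] = sym (⊕-idˡ _)
lin-⊕ (c ∷ cs) (a ∷ x) (b ∷ y) =
  trans (cong₂ _⊕_ (when-xor c a b) (lin-⊕ cs x y)) (⊕-interchange _ _ _ _)

lin-0 : ∀ {k n} (cs : Vec (V n) k) → lin cs (0v k) ≡ 0v n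
lin-0 [] = refl
lin-0 (c ∷ cs) = trans (⊕-idˡ _) (lin-0 cs)

lin-0∷ : ∀ {k n} (c : V n) (cs : Vec (V n) k) v → lin (c ∷ cs) (false ∷ v) ≡ lin cs v
lin-0∷ c cs v = ⊕-idˡ _

lin-1∷0 : ∀ {k n} (c : V n) (cs : Vec (V n) k) → lin (c ∷ cs) (true ∷ 0v k) ≡ c
lin-1∷0 c cs = trans (cong (c ⊕_) (lin-0 cs)) (⊕-idʳ c)

-- Identities of vectors are decided by comparing the coefficient vectors of both sides.
module VecSolver (n : ℕ) where

  infixl 7 _:⊕_
  data Expr (k : ℕ) : Set where
    var : Fin k → Expr k
    :0 : Expr k
    _:⊕_ : Expr k → Expr k → Expr k

  ⟦_⟧ : ∀ {k} → Expr k → Vec (V n) k → V n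
  ⟦ var i ⟧ ρ = lookup ρ i
  ⟦ :0 ⟧ ρ = 0v n
  ⟦ e :⊕ e′ ⟧ ρ = ⟦ e ⟧ ρ ⊕ ⟦ e′ ⟧ ρ

  unit : ∀ {k} → Fin k → V k
  unit Fin.zero = true ∷ 0v _
  unit (Fin.suc i) = false ∷ unit i

  coefficients : ∀ {k} → Expr k → V k
  coefficients (var i) = unit i
  coefficients :0 = 0v _
  coefficients (e :⊕ e′) = coefficients e ⊕ coefficients e′

  ⟦_⇓⟧ : ∀ {k} → Expr k → Vec (V n) k → V n
  ⟦ e ⇓⟧ ρ = lin ρ (coefficients e)

  unit-correct : ∀ {k} (i : Fin k) (ρ : Vec (V n) k) → lin ρ (unit i) ≡ lookup ρ i
  unit-correct Fin.zero (c ∷ cs) = lin-1∷0 c cs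
  unit-correct (Fin.suc i) (c ∷ cs) = trans (lin-0∷ c cs (unit i)) (unit-correct i cs)

  correct : ∀ {k} (e : Expr k) (ρ : Vec (V n) k) → ⟦ e ⇓⟧ ρ ≡ ⟦ e ⟧ ρ
  correct (var i) ρ = unit-correct i ρ
  correct :0 ρ = lin-0 ρ
  correct (e :⊕ e′) ρ =
    trans (lin-⊕ ρ (coefficients e) (coefficients e′)) (cong₂ _⊕_ (correct e ρ) (correct e′ ρ))

  open Reflection (setoid (V n)) var ⟦_⟧ ⟦_⇓⟧ correct public using (solve; _⊜_)

module _ {n : ℕ} where
  open VecSolver n public using (_⊜_; _:⊕_; :0) renaming (solve to solveᵥ)

⊕-cancelˡ : ∀ {n} (x y : V n) → x ⊕ (x ⊕ y) ≡ y
⊕-cancelˡ = solveᵥ 2 (λ x y → x :⊕ (x :⊕ y) ⊜ y) refl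

⊕-cancelʳ : ∀ {n} (x y : V n) → (x ⊕ y) ⊕ y ≡ x
⊕-cancelʳ = solveᵥ 2 (λ x y → (x :⊕ y) :⊕ y ⊜ x) refl

⊕≡0⇒≡ : ∀ {n} {x y : V n} → x ⊕ y ≡ 0v n → x ≡ y
⊕≡0⇒≡ {x = x} {y} p = trans (sym (⊕-cancelʳ x y)) (trans (cong (_⊕ y) p) (⊕-idˡ y))

nonzero?-0 : ∀ n → nonzero? (0v n) ≡ false
nonzero?-0 zero = refl
nonzero?-0 (suc n) = nonzero?-0 n

nonzero?⇒≢0 : ∀ {n} (x : V n) → nonzero? x ≡ true → x ≢ 0v n
nonzero?⇒≢0 {n} x p refl = true≢false (trans (sym p) (nonzero?-0 n))

≢0⇒nonzero? : ∀ {n} (x : V n) → x ≢ 0v n → nonzero? x ≡ true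
≢0⇒nonzero? [] p = ⊥-elim (p refl)
≢0⇒nonzero? (true ∷ x) p = refl
≢0⇒nonzero? (false ∷ x) p = ≢0⇒nonzero? x (λ q → p (cong (false ∷_) q))

lin-map : ∀ {j k n} (cs : Vec (V n) k) (ds : Vec (V k) j) v → lin (map (lin cs) ds) v ≡ lin cs (lin ds v)
lin-map cs [] [] = sym (lin-0 cs)
lin-map cs (d ∷ ds) (true ∷ v) = trans (cong (lin cs d ⊕_) (lin-map cs ds v)) (sym (lin-⊕ cs d (lin ds v)))
lin-map cs (d ∷ ds) (false ∷ v) = trans (lin-0∷ (lin cs d) (map (lin cs) ds) v) (trans (lin-map cs ds v) (cong (lin cs) (sym (lin-0∷ d ds v))))

lin-++ : ∀ {j k n} (cs : Vec (V n) j) (ds : Vec (V n) k) u v → lin (cs ++ ds) (u ++ v) ≡ lin cs u ⊕ lin ds v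
lin-++ [] ds [] v = sym (⊕-idˡ _)
lin-++ (c ∷ cs) ds (b ∷ u) v = trans (cong (_ ⊕_) (lin-++ cs ds u v)) (sym (⊕-assoc _ _ _))

basis : ∀ n → Vec (V n) n
basis zero = []
basis (suc n) = (true ∷ 0v n) ∷ map (false ∷_) (basis n)

lin-map-∷ : ∀ {k n} (cs : Vec (V n) k) v → lin (map (false ∷_) cs) v ≡ false ∷ lin cs v
lin-map-∷ [] [] = refl
lin-map-∷ (c ∷ cs) (true ∷ v) rewrite lin-map-∷ cs v = refl
lin-map-∷ (c ∷ cs) (false ∷ v) rewrite lin-map-∷ cs v = refl

lin-basis : ∀ {n} (v : V n) → lin (basis n) v ≡ v
lin-basis [] = refl
lin-basis {suc n} (true ∷ v) rewrite lin-map-∷ (basis n) v | lin-basis v = cong (true ∷_) (⊕-idˡ v)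
lin-basis {suc n} (false ∷ v) rewrite lin-map-∷ (basis n) v | lin-basis v = cong (false ∷_) (⊕-idˡ v)

Additive : ∀ {k n} → (V k → V n) → Set
Additive g = ∀ x y → g (x ⊕ y) ≡ g x ⊕ g y

additive-0 : ∀ {k n} {g : V k → V n} → Additive g → g (0v k) ≡ 0v n
additive-0 {k} {g = g} add = trans (cong g (sym (⊕-self (0v k)))) (trans (add _ _) (⊕-self _))

additive⇒lin : ∀ {j k n} {g : V k → V n} → Additive g → (cs : Vec (V k) j) → ∀ v → lin (map g cs) v ≡ g (lin cs v)
additive⇒lin add [] [] = sym (additive-0 add)
additive⇒lin add (c ∷ cs) (true ∷ v) = trans (cong (_ ⊕_) (additive⇒lin add cs v)) (sym (add _ _))
additive⇒lin {g = g} add (c ∷ cs) (false ∷ v) =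
  trans (lin-0∷ (g c) (map g cs) v) (trans (additive⇒lin add cs v) (cong g (sym (lin-0∷ c cs v))))

-- Independence, exhaustive search and dimension

Independent : ∀ {k n} → Vec (V n) k → Set
Independent {k} {n} cs = ∀ v → v ≢ 0v k → lin cs v ≢ 0v n

Independent⇒Injective : ∀ {k n} (cs : Vec (V n) k) → Independent cs → Injective cs
Independent⇒Injective cs ind x y p with (x ⊕ y) ≟ᵥ 0v _
... | yes q = ⊕≡0⇒≡ q
... | no q = ⊥-elim (ind (x ⊕ y) q (trans (lin-⊕ cs x y) (trans (cong (_⊕ lin cs y) p) (⊕-self _))))

Injective⇒Independent : ∀ {k n} (cs : Vec (V n) k) → Injective cs → Independent cs
Injective⇒Independent cs inj v v≢0 p = v≢0 (inj v _ (trans p (sym (lin-0 cs))))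

tail-Independent : ∀ {k n} (c : V n) (cs : Vec (V n) k) → Independent (c ∷ cs) → Independent cs
tail-Independent c cs ind v v≢0 p = ind (false ∷ v) (λ { refl → v≢0 refl }) (trans (lin-0∷ c cs v) p)

-- Exhaustive search stands in for excluded middle and choice: maximal families, smallest directions
-- and witnesses of failed inclusions are all found by it.
any? : ∀ {n} {P : V n → Set} → (∀ x → Dec (P x)) → Dec (∃ P)
any? {zero} P? = map′ (λ p → [] , p) (λ { ([] , p) → p }) (P? [])
any? {suc n} P? with any? (P? ∘ (true ∷_)) | any? (P? ∘ (false ∷_))
... | yes (x , p) | _ = yes (true ∷ x , p)
... | no _ | yes (x , p) = yes (false ∷ x , p)
... | no ¬p | no ¬q = no λ { (true ∷ x , p) → ¬p (x , p) ; (false ∷ x , p) → ¬q (x , p) }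

all? : ∀ {n} {P : V n → Set} → (∀ x → Dec (P x)) → Dec (∀ x → P x)
all? P? with any? (¬? ∘ P?)
... | yes (x , ¬p) = no λ all → ¬p (all x)
... | no ¬∃ = yes λ x → case P? x of λ { (yes p) → p ; (no ¬p) → ⊥-elim (¬∃ (x , ¬p)) }

¬all⇒any¬ : ∀ {n} {P : V n → Set} → (∀ x → Dec (P x)) → ¬ (∀ x → P x) → ∃ λ x → ¬ P x
¬all⇒any¬ P? ¬all with any? (¬? ∘ P?)
... | yes r = r
... | no ¬∃ = ⊥-elim (¬all λ x → case P? x of λ { (yes p) → p ; (no ¬p) → ⊥-elim (¬∃ (x , ¬p)) })

_→-dec_ : ∀ {A B : Set} → Dec A → Dec B → Dec (A → B)
yes a →-dec yes b = yes λ _ → b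
yes a →-dec no ¬b = no λ g → ¬b (g a)
no ¬a →-dec _ = yes λ a → ⊥-elim (¬a a)

minimiser : ∀ {n} {P : V n → Set} → (∀ x → Dec (P x)) → (g : V n → ℕ) → ∃ P →
  ∃ λ a → P a × (∀ b → P b → g a ≤ g b)
minimiser {zero} P? g ([] , p) = [] , p , λ { [] _ → ℕₚ.≤-refl }
minimiser {suc n} {P} P? g (x , p) with any? (P? ∘ (true ∷_)) | any? (P? ∘ (false ∷_))
... | no ¬p | no ¬q = ⊥-elim (impossible x p)
  where
  impossible : ∀ x → P x → ⊥
  impossible (true ∷ x) p = ¬p (x , p)
  impossible (false ∷ x) p = ¬q (x , p)
... | yes ∃p | no ¬q with minimiser (P? ∘ (true ∷_)) (g ∘ (true ∷_)) ∃p
...   | a , pa , min = true ∷ a , pa , λ { (true ∷ b) → min b ; (false ∷ b) q → ⊥-elim (¬q (b , q)) }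
minimiser {suc n} {P} P? g (x , p) | no ¬p | yes ∃q with minimiser (P? ∘ (false ∷_)) (g ∘ (false ∷_)) ∃q
...   | a , pa , min = false ∷ a , pa , λ { (false ∷ b) → min b ; (true ∷ b) q → ⊥-elim (¬p (b , q)) }
minimiser {suc n} {P} P? g (x , p) | yes ∃p | yes ∃q
  with minimiser (P? ∘ (true ∷_)) (g ∘ (true ∷_)) ∃p | minimiser (P? ∘ (false ∷_)) (g ∘ (false ∷_)) ∃q
... | a , pa , mina | b , pb , minb with ℕₚ.≤-total (g (true ∷ a)) (g (false ∷ b))
...   | inj₁ le = true ∷ a , pa , λ { (true ∷ c) → mina c ; (false ∷ c) q → ℕₚ.≤-trans le (minb c q) }
...   | inj₂ le = false ∷ b , pb , λ { (false ∷ c) → minb c ; (true ∷ c) q → ℕₚ.≤-trans le (mina c q) }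

encode : ∀ {n} → V n → Fin (2 ^ n)
encode [] = Fin.zero
-- `2 ^ suc n` unfolds to `2 ^ n + (2 ^ n + 0)`, whence the empty third block.
encode {suc n} (false ∷ v) = encode v ↑ˡ (2 ^ n + 0)
encode {suc n} (true ∷ v) = 2 ^ n ↑ʳ (encode v ↑ˡ 0)

decode : ∀ n → Fin (2 ^ n) → V n
decode zero i = []
decode (suc n) i with splitAt (2 ^ n) i
... | inj₁ j = false ∷ decode n j
... | inj₂ j with splitAt (2 ^ n) j
...   | inj₁ l = true ∷ decode n l

decode-encode : ∀ {n} (v : V n) → decode n (encode v) ≡ v
decode-encode [] = refl
decode-encode {suc n} (false ∷ v) rewrite Finₚ.splitAt-↑ˡ (2 ^ n) (encode v) (2 ^ n + 0) = cong (false ∷_) (decode-encode v)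
decode-encode {suc n} (true ∷ v) rewrite Finₚ.splitAt-↑ʳ (2 ^ n) (2 ^ n + 0) (encode v ↑ˡ 0)
  | Finₚ.splitAt-↑ˡ (2 ^ n) (encode v) 0 = cong (true ∷_) (decode-encode v)

encode-decode : ∀ n (i : Fin (2 ^ n)) → encode (decode n i) ≡ i
encode-decode zero Fin.zero = refl
encode-decode (suc n) i with splitAt (2 ^ n) i in eq
... | inj₁ j = trans (cong (_↑ˡ (2 ^ n + 0)) (encode-decode n j)) (Finₚ.splitAt⁻¹-↑ˡ eq)
... | inj₂ j with splitAt (2 ^ n) j in eq′
...   | inj₁ l = trans (cong (2 ^ n ↑ʳ_) (trans (cong (_↑ˡ 0) (encode-decode n l)) (Finₚ.splitAt⁻¹-↑ˡ eq′)))
                   (Finₚ.splitAt⁻¹-↑ʳ eq)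

-- Compares the cardinalities 2ʲ and 2ᵏ. The bounds on dimension from independent and from spanning
-- families both rest on it.
injection⇒≤ : ∀ {j k} (g : V j → V k) → (∀ x y → g x ≡ g y → x ≡ y) → j ≤ k
injection⇒≤ {j} {k} g inj = ℕₚ.≮⇒≥ λ k<j → ℕₚ.<⇒≱ (ℕₚ.^-monoʳ-< 2 (s≤s (s≤s z≤n)) k<j) 2^j≤2^k
  where
  2^j≤2^k : 2 ^ j ≤ 2 ^ k
  2^j≤2^k = Finₚ.injective⇒≤ {f = encode ∘ g ∘ decode j} λ {x} {y} p →
    trans (sym (encode-decode j x)) (trans (cong encode (inj _ _
      (trans (sym (decode-encode (g (decode j x)))) (trans (cong (decode k) p) (decode-encode _)))))
      (encode-decode j y))

Spans : ∀ {k n} → Vec (V n) k → Set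
Spans {k} {n} cs = ∀ x → ∃ λ v → lin cs v ≡ x

independent⇒≤ : ∀ {k n} (cs : Vec (V n) k) → Independent cs → k ≤ n
independent⇒≤ cs ind = injection⇒≤ (lin cs) (Independent⇒Injective cs ind)

spans⇒≤ : ∀ {k n} (cs : Vec (V n) k) → Spans cs → n ≤ k
spans⇒≤ cs span = injection⇒≤ (λ x → proj₁ (span x)) λ x y p →
  trans (sym (proj₂ (span x))) (trans (cong (lin cs) p) (proj₂ (span y)))

independent? : ∀ {k n} (cs : Vec (V n) k) → Dec (Independent cs)
independent? cs = all? λ v → ¬? (v ≟ᵥ 0v _) →-dec ¬? (lin cs v ≟ᵥ 0v _)

dependent⇒∈span : ∀ {k n} (c : V n) (cs : Vec (V n) k) → Independent cs → ¬ Independent (c ∷ cs) →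
  ∃ λ v → lin cs v ≡ c
dependent⇒∈span c cs ind ¬ind
  with ¬all⇒any¬ (λ v → ¬? (v ≟ᵥ 0v _) →-dec ¬? (lin (c ∷ cs) v ≟ᵥ 0v _)) ¬ind
... | (false ∷ v) , h = ⊥-elim (h λ v≢0 p → ind v (λ { refl → v≢0 refl }) (trans (sym (lin-0∷ c cs v)) p))
... | (true ∷ v) , h with (c ⊕ lin cs v) ≟ᵥ 0v _
...   | yes p = v , sym (⊕≡0⇒≡ p)
...   | no ¬p = ⊥-elim (h λ _ → ¬p)

-- Greedy choice with a cap `b`. `P` is left arbitrary because the same search serves independent
-- families, points of smallest direction, and flats with prescribed labels.
grow : ∀ {n} (P : ∀ {k} → Vec (V n) k → Set) → (∀ {k} (cs : Vec (V n) k) → Dec (P cs)) → P [] → ∀ b →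
  (Σ (Vec (V n) b) P) ⊎ (∃ λ k → k < b × Σ (Vec (V n) k) λ cs → P cs × (∀ c → ¬ P (c ∷ cs)))
grow P P? p zero = inj₁ ([] , p)
grow P P? p (suc b) with grow P P? p b
... | inj₂ (k , k<b , r) = inj₂ (k , ℕₚ.m<n⇒m<1+n k<b , r)
... | inj₁ (cs , pcs) with any? (λ c → P? (c ∷ cs))
...   | yes (c , q) = inj₁ (c ∷ cs , q)
...   | no ¬q = inj₂ (b , ℕₚ.≤-refl , cs , pcs , λ c q → ¬q (c , q))

-- Linear functionals

dot : ∀ {n} → V n → V n → Bool
dot [] [] = false
dot (a ∷ l) (b ∷ x) = (a ∧ b) xor dot l x

xor-interchange : ∀ a b c d → (a xor b) xor (c xor d) ≡ (a xor c) xor (b xor d)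
xor-interchange = interchange
  where open import Algebra.Properties.CommutativeSemigroup
               (CommutativeRing.+-commutativeSemigroup Boolₚ.xor-∧-commutativeRing) using (interchange)

dot-⊕ : ∀ {n} (l x y : V n) → dot l (x ⊕ y) ≡ dot l x xor dot l y
dot-⊕ [] [] [] = refl
dot-⊕ (a ∷ l) (b ∷ x) (c ∷ y) rewrite dot-⊕ l x y | Boolₚ.∧-distribˡ-xor a b c =
  xor-interchange (a ∧ b) (a ∧ c) (dot l x) (dot l y)

dot-comm : ∀ {n} (l x : V n) → dot l x ≡ dot x l
dot-comm [] [] = refl
dot-comm (a ∷ l) (b ∷ x) rewrite dot-comm l x | Boolₚ.∧-comm a b = refl

dot-0ˡ : ∀ {n} (x : V n) → dot (0v n) x ≡ false
dot-0ˡ [] = refl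
dot-0ˡ (b ∷ x) = dot-0ˡ x

dot-0ʳ : ∀ {n} (x : V n) → dot x (0v n) ≡ false
dot-0ʳ x = trans (dot-comm x _) (dot-0ˡ x)

additive⇒dot : ∀ {n} (g : V n → Bool) → (∀ x y → g (x ⊕ y) ≡ g x xor g y) → ∃ λ s → ∀ v → g v ≡ dot s v
additive⇒dot {zero} g add = [] , λ { [] → trans (add [] []) (Boolₚ.xor-same (g [])) }
additive⇒dot {suc n} g add with additive⇒dot (g ∘ (false ∷_)) (λ x y → add (false ∷ x) (false ∷ y))
... | s , p = (g e ∷ s) , correct
  where
  e = true ∷ 0v n
  correct : ∀ v → g v ≡ dot (g e ∷ s) v
  correct (false ∷ v) rewrite Boolₚ.∧-zeroʳ (g e) = p v
  correct (true ∷ v) rewrite Boolₚ.∧-identityʳ (g e) =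
    trans (cong (g ∘ (true ∷_)) (sym (⊕-idˡ v))) (trans (add e (false ∷ v)) (cong (g e xor_) (p v)))

-- The predicate is type-valued because `separation` is also applied to the image of a pairing,
-- which is not given as a Boolean function.
record IsSubgroup {n} (S : V n → Set) : Set where
  constructor isSubgroup
  field
    0∈ : S (0v n)
    ⊕∈ : ∀ {x y} → S x → S y → S (x ⊕ y)

  cancelʳ : ∀ {x y} → S (x ⊕ y) → S y → S x
  cancelʳ {x} {y} p q = subst S (⊕-cancelʳ x y) (⊕∈ p q)

  cancelˡ : ∀ {x y} → S (x ⊕ y) → S x → S y
  cancelˡ {x} {y} p q = subst S (⊕-cancelˡ x y) (⊕∈ q p)

-- Induction on the coordinates. If `S` contains some `true ∷ u`, the head coefficient has to be
-- `dot l u`, and adding that vector brings everything to head `false`. Otherwise the head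
-- coordinate itself vanishes on `S`.
separation : ∀ {n} {S : V n → Set} → (∀ x → Dec (S x)) → IsSubgroup S → ∀ s → ¬ S s →
  ∃ λ l → (∀ x → S x → dot l x ≡ false) × dot l s ≡ true
separation {zero} S? sg [] s∉ = ⊥-elim (s∉ (IsSubgroup.0∈ sg))
separation {suc n} {S} S? sg (b ∷ s) s∉ = case any? (S? ∘ (true ∷_)) of λ
  { (yes (u , u∈)) → withHead u u∈ b s∉
  ; (no none) → withoutHead none b s∉ }
  where
  open IsSubgroup sg
  sg₀ : IsSubgroup (S ∘ (false ∷_))
  sg₀ = isSubgroup 0∈ ⊕∈

  withHead : ∀ u → S (true ∷ u) → ∀ b → ¬ S (b ∷ s) →
    ∃ λ l → (∀ x → S x → dot l x ≡ false) × dot l (b ∷ s) ≡ true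
  withHead u u∈ false s∉ with separation (S? ∘ (false ∷_)) sg₀ s s∉
  ... | l , kill , hit = (dot l u ∷ l) , kill′ , hit′
    where
    hit′ : (dot l u ∧ false) xor dot l s ≡ true
    hit′ rewrite Boolₚ.∧-zeroʳ (dot l u) = hit
    kill′ : ∀ x → S x → dot (dot l u ∷ l) x ≡ false
    kill′ (false ∷ x) x∈ rewrite Boolₚ.∧-zeroʳ (dot l u) = kill x x∈
    kill′ (true ∷ x) x∈ rewrite Boolₚ.∧-identityʳ (dot l u) =
      trans (sym (dot-⊕ l u x)) (kill (u ⊕ x) (⊕∈ u∈ x∈))
  withHead u u∈ true s∉ with separation (S? ∘ (false ∷_)) sg₀ (u ⊕ s) (λ p → s∉ (cancelˡ p u∈))
  ... | l , kill , hit = (dot l u ∷ l) , kill′ , hit′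
    where
    hit′ : (dot l u ∧ true) xor dot l s ≡ true
    hit′ rewrite Boolₚ.∧-identityʳ (dot l u) = trans (sym (dot-⊕ l u s)) hit
    kill′ : ∀ x → S x → dot (dot l u ∷ l) x ≡ false
    kill′ (false ∷ x) x∈ rewrite Boolₚ.∧-zeroʳ (dot l u) = kill x x∈
    kill′ (true ∷ x) x∈ rewrite Boolₚ.∧-identityʳ (dot l u) =
      trans (sym (dot-⊕ l u x)) (kill (u ⊕ x) (⊕∈ u∈ x∈))

  withoutHead : ¬ (∃ λ u → S (true ∷ u)) → ∀ b → ¬ S (b ∷ s) →
    ∃ λ l → (∀ x → S x → dot l x ≡ false) × dot l (b ∷ s) ≡ true
  withoutHead none true s∉ = (true ∷ 0v n) , kill , cong not (dot-0ˡ s)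
    where
    kill : ∀ x → S x → dot (true ∷ 0v n) x ≡ false
    kill (true ∷ x) x∈ = ⊥-elim (none (x , x∈))
    kill (false ∷ x) x∈ = dot-0ˡ x
  withoutHead none false s∉ with separation (S? ∘ (false ∷_)) sg₀ s s∉
  ... | l , kill , hit = (false ∷ l) , kill′ , hit
    where
    kill′ : ∀ x → S x → dot (false ∷ l) x ≡ false
    kill′ (true ∷ x) x∈ = ⊥-elim (none (x , x∈))
    kill′ (false ∷ x) x∈ = kill x x∈

-- Maps onto the kernel of dot l only if l ≢ 0v.
kernel : ∀ {n} → V (suc n) → V n → V (suc n)
kernel (true ∷ l) w = dot l w ∷ w
kernel {zero} (false ∷ l) w = 0v 1
kernel {suc n} (false ∷ l) (b ∷ w) = b ∷ kernel l w

kernel-additive : ∀ {n} (l : V (suc n)) → Additive (kernel l)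
kernel-additive (true ∷ l) x y = cong (_∷ (x ⊕ y)) (dot-⊕ l x y)
kernel-additive {zero} (false ∷ l) x y = refl
kernel-additive {suc n} (false ∷ l) (a ∷ x) (b ∷ y) = cong ((a xor b) ∷_) (kernel-additive l x y)

kernel-injective : ∀ {n} (l : V (suc n)) x → kernel l x ≡ 0v (suc n) → x ≡ 0v n
kernel-injective (true ∷ l) x p = cong (λ { (_ ∷ v) → v }) p
kernel-injective {zero} (false ∷ l) [] p = refl
kernel-injective {suc n} (false ∷ l) (b ∷ x) p =
  cong₂ _∷_ (cong (λ { (c ∷ _) → c }) p) (kernel-injective l x (cong (λ { (_ ∷ v) → v }) p))

dot-kernel : ∀ {n} (l : V (suc n)) x → dot l (kernel l x) ≡ false
dot-kernel (true ∷ l) x = Boolₚ.xor-same (dot l x)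
dot-kernel {zero} (false ∷ []) x = refl
dot-kernel {suc n} (false ∷ l) (b ∷ x) = dot-kernel l x

-- Decidable subsets, index two and cardinalities

Subset : ℕ → Set
Subset n = V n → Bool

infix 4 _∈_ _∉_ _⊆_

_∈_ _∉_ : ∀ {n} → V n → Subset n → Set
x ∈ A = A x ≡ true
x ∉ A = ¬ x ∈ A

_⊆_ : ∀ {n} → Subset n → Subset n → Set
A ⊆ B = ∀ {x} → x ∈ A → x ∈ B

_∈?_ : ∀ {n} (x : V n) (A : Subset n) → Dec (x ∈ A)
x ∈? A = A x Boolₚ.≟ true

∉⇒false : ∀ {b} → ¬ b ≡ true → b ≡ false
∉⇒false = Boolₚ.¬-not

false⇒∉ : ∀ {b} → b ≡ false → ¬ b ≡ true
false⇒∉ p q = true≢false (trans (sym q) p)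

⊆-or-witness : ∀ {n} (A B : Subset n) → A ⊆ B ⊎ (∃ λ x → x ∈ A × x ∉ B)
⊆-or-witness A B with any? (λ x → (x ∈? A) ×-dec ¬? (x ∈? B))
... | yes r = inj₂ r
... | no ¬r = inj₁ λ {x} p → case x ∈? B of λ { (yes q) → q ; (no ¬q) → ⊥-elim (¬r (x , p , ¬q)) }

record Subgroup {n} (A : Subset n) : Set where
  constructor subgroup
  field
    0∈ : 0v n ∈ A
    ⊕∈ : ∀ {x y} → x ∈ A → y ∈ A → (x ⊕ y) ∈ A

  isSg : IsSubgroup (_∈ A)
  isSg = isSubgroup 0∈ ⊕∈

  open IsSubgroup isSg public using (cancelˡ; cancelʳ)

infixr 6 _∩_
_∩_ : ∀ {n} → Subset n → Subset n → Subset n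
(A ∩ B) x = A x ∧ B x

∩-intro : ∀ {a b} → a ≡ true → b ≡ true → a ∧ b ≡ true
∩-intro refl refl = refl

∩-elim : ∀ {a b} → a ∧ b ≡ true → a ≡ true × b ≡ true
∩-elim {true} {true} _ = refl , refl

∨-elim : ∀ {a b} → a ∨ b ≡ true → a ≡ true ⊎ b ≡ true
∨-elim {true} _ = inj₁ refl
∨-elim {false} p = inj₂ p

∨-introˡ : ∀ {a b} → a ≡ true → a ∨ b ≡ true
∨-introˡ refl = refl

∨-introʳ : ∀ {a b} → b ≡ true → a ∨ b ≡ true
∨-introʳ {true} refl = refl
∨-introʳ {false} refl = refl

∩-left : ∀ {n} (A B : Subset n) {x} → x ∈ (A ∩ B) → x ∈ A
∩-left A B {x} p = proj₁ (∩-elim {A x} {B x} p)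

∩-right : ∀ {n} (A B : Subset n) {x} → x ∈ (A ∩ B) → x ∈ B
∩-right A B {x} p = proj₂ (∩-elim {A x} {B x} p)

∩-subgroup : ∀ {n} {A B : Subset n} → Subgroup A → Subgroup B → Subgroup (A ∩ B)
∩-subgroup {A = A} {B} a b = subgroup (∩-intro (0∈ a) (0∈ b)) λ p q →
  ∩-intro (⊕∈ a (∩-left A B p) (∩-left A B q)) (⊕∈ b (∩-right A B p) (∩-right A B q))
  where open Subgroup

-- For a subgroup `A` this is the subgroup generated by `A` and `u`, since 2u = 0 leaves only two
-- cosets.
_⊹_ : ∀ {n} → Subset n → V n → Subset n
(A ⊹ u) x = A x ∨ A (x ⊕ u)

⊹-elim : ∀ {n} (A : Subset n) u {x} → x ∈ (A ⊹ u) → x ∈ A ⊎ (x ⊕ u) ∈ A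
⊹-elim A u {x} p = ∨-elim {A x} p

⊹-subgroup : ∀ {n} {A : Subset n} u → Subgroup A → Subgroup (A ⊹ u)
⊹-subgroup {A = A} u sg = subgroup (∨-introˡ 0∈) λ {x} {y} p q → case (⊹-elim A u p , ⊹-elim A u q) of λ
  { (inj₁ p , inj₁ q) → ∨-introˡ (⊕∈ p q)
  ; (inj₁ p , inj₂ q) → ∨-introʳ (subst (_∈ A) (solveᵥ 3 (λ x y u → x :⊕ (y :⊕ u) ⊜ (x :⊕ y) :⊕ u) refl x y u) (⊕∈ p q))
  ; (inj₂ p , inj₁ q) → ∨-introʳ (subst (_∈ A) (solveᵥ 3 (λ x y u → (x :⊕ u) :⊕ y ⊜ (x :⊕ y) :⊕ u) refl x y u) (⊕∈ p q))
  ; (inj₂ p , inj₂ q) → ∨-introˡ (subst (_∈ A) (solveᵥ 3 (λ x y u → (x :⊕ u) :⊕ (y :⊕ u) ⊜ x :⊕ y) refl x y u) (⊕∈ p q)) }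
  where open Subgroup sg

⊆⊹ : ∀ {n} {A : Subset n} u → A ⊆ A ⊹ u
⊆⊹ u = ∨-introˡ

∈⊹ : ∀ {n} {A : Subset n} u → Subgroup A → u ∈ (A ⊹ u)
∈⊹ {A = A} u sg = ∨-introʳ (subst (_∈ A) (sym (⊕-self u)) (Subgroup.0∈ sg))

indicator : Bool → ℕ
indicator b = if b then 1 else 0

count : ∀ {n} → Subset n → ℕ
count {zero} A = indicator (A [])
count {suc n} A = count (A ∘ (true ∷_)) + count (A ∘ (false ∷_))

indicator-mono : ∀ {a b} → (a ≡ true → b ≡ true) → indicator a ≤ indicator b
indicator-mono {false} h = z≤n
indicator-mono {true} h rewrite h refl = s≤s z≤n

count-mono : ∀ {n} (A B : Subset n) → A ⊆ B → count A ≤ count B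
count-mono {zero} A B h = indicator-mono h
count-mono {suc n} A B h = ℕₚ.+-mono-≤ (count-mono (A ∘ (true ∷_)) (B ∘ (true ∷_)) h) (count-mono (A ∘ (false ∷_)) (B ∘ (false ∷_)) h)

count-strict : ∀ {n} (A B : Subset n) → A ⊆ B → ∀ x → x ∈ B → x ∉ A → count A < count B
count-strict {zero} A B h [] p q rewrite p | ∉⇒false q = s≤s z≤n
count-strict {suc n} A B h (true ∷ x) p q =
  ℕₚ.+-mono-<-≤ (count-strict (A ∘ (true ∷_)) (B ∘ (true ∷_)) h x p q) (count-mono (A ∘ (false ∷_)) (B ∘ (false ∷_)) h)
count-strict {suc n} A B h (false ∷ x) p q =
  ℕₚ.+-mono-≤-< (count-mono (A ∘ (true ∷_)) (B ∘ (true ∷_)) h) (count-strict (A ∘ (false ∷_)) (B ∘ (false ∷_)) h x p q)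

count-cong : ∀ {n} {A B : Subset n} → (∀ x → A x ≡ B x) → count A ≡ count B
count-cong {zero} h = cong indicator (h [])
count-cong {suc n} h = cong₂ _+_ (count-cong (h ∘ (true ∷_))) (count-cong (h ∘ (false ∷_)))

count-shift : ∀ {n} (A : Subset n) u → count (λ x → A (x ⊕ u)) ≡ count A
count-shift {zero} A [] = refl
count-shift {suc n} A (false ∷ u) = cong₂ _+_ (count-shift (A ∘ (true ∷_)) u) (count-shift (A ∘ (false ∷_)) u)
count-shift {suc n} A (true ∷ u) =
  trans (cong₂ _+_ (count-shift (A ∘ (false ∷_)) u) (count-shift (A ∘ (true ∷_)) u)) (ℕₚ.+-comm (count (A ∘ (false ∷_))) _)

count-∨ : ∀ {n} (A B : Subset n) → (∀ x → x ∈ A → x ∉ B) → count (λ x → A x ∨ B x) ≡ count A + count B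
count-∨ {zero} A B h with A [] in eqA | B [] in eqB
... | true | true = ⊥-elim (h [] eqA eqB)
... | true | false = refl
... | false | _ = refl
count-∨ {suc n} A B h = trans (cong₂ _+_ (count-∨ _ _ (h ∘ (true ∷_))) (count-∨ _ _ (h ∘ (false ∷_))))
  (interchange (count (A ∘ (true ∷_))) (count (B ∘ (true ∷_))) (count (A ∘ (false ∷_))) (count (B ∘ (false ∷_))))
  where open import Algebra.Properties.CommutativeSemigroup ℕₚ.+-commutativeSemigroup using (interchange)

⊆∧≥⇒⊇ : ∀ {n} (A B : Subset n) → A ⊆ B → count B ≤ count A → B ⊆ A
⊆∧≥⇒⊇ A B h le with ⊆-or-witness B A
... | inj₁ r = r
... | inj₂ (x , p , q) = ⊥-elim (ℕₚ.<⇒≱ (count-strict A B h x p q) le)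

smaller⇒witness : ∀ {n} (A B : Subset n) → count A < count B → ∃ λ x → x ∈ B × x ∉ A
smaller⇒witness A B lt with ⊆-or-witness B A
... | inj₁ r = ⊥-elim (ℕₚ.<⇒≱ lt (count-mono B A r))
... | inj₂ w = w

count-⊹ : ∀ {n} {A : Subset n} u → Subgroup A → u ∉ A → count (A ⊹ u) ≡ 2 * count A
count-⊹ {A = A} u sg u∉ = trans (count-∨ A _ λ x p q → u∉ (Subgroup.cancelˡ sg q p))
  (cong (λ n → count A + n) (trans (count-shift A u) (sym (ℕₚ.+-identityʳ _))))

-- For subgroups A ⊆ B this says that A has index at most two in B.
AtMostTwoCosets : ∀ {n} → Subset n → Subset n → Set
AtMostTwoCosets A B = ∀ {x y} → x ∈ B → x ∉ A → y ∈ B → y ∉ A → (x ⊕ y) ∈ A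

⊹-⊆ : ∀ {n} {A B : Subset n} u → Subgroup B → A ⊆ B → u ∈ B → A ⊹ u ⊆ B
⊹-⊆ {A = A} u sg h u∈ p with ⊹-elim A u p
... | inj₁ q = h q
... | inj₂ q = Subgroup.cancelʳ sg (h q) u∈

⊆-⊹ : ∀ {n} (A B : Subset n) u → AtMostTwoCosets A B → u ∈ B → u ∉ A → B ⊆ A ⊹ u
⊆-⊹ A B u two u∈ u∉ {x} x∈ with x ∈? A
... | yes p = ∨-introˡ p
... | no ¬p = ∨-introʳ (two x∈ ¬p u∈ u∉)

-- `A` and a single `y` outside it already generate 2 |A| elements, which fill `B`.
count≤⇒atMostTwo : ∀ {n} (A B : Subset n) → Subgroup A → Subgroup B → A ⊆ B → count B ≤ 2 * count A → AtMostTwoCosets A B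
count≤⇒atMostTwo A B a b h le {x} {y} x∈ x∉ y∈ y∉ =
  case ⊹-elim A y (⊆∧≥⇒⊇ (A ⊹ y) B (⊹-⊆ y b h y∈) (subst (count B ≤_) (sym (count-⊹ y a y∉)) le) x∈) of λ
    { (inj₁ p) → ⊥-elim (x∉ p) ; (inj₂ p) → p }

atMostTwo⇒count≤ : ∀ {n} (A B : Subset n) → Subgroup A → AtMostTwoCosets A B → count B ≤ 2 * count A
atMostTwo⇒count≤ A B a two with ⊆-or-witness B A
... | inj₁ h = ℕₚ.≤-trans (count-mono B A h) (ℕₚ.m≤m+n _ _)
... | inj₂ (u , u∈ , u∉) = ℕₚ.≤-trans (count-mono B (A ⊹ u) (⊆-⊹ A B u two u∈ u∉)) (ℕₚ.≤-reflexive (count-⊹ u a u∉))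

count-half : ∀ {n} (A B : Subset n) u → Subgroup A → Subgroup B → u ∈ B → u ∉ A → AtMostTwoCosets A B →
  count B ≡ 2 * count (B ∩ A)
count-half A B u a b u∈ u∉ two = trans (ℕₚ.≤-antisym
    (count-mono B ((B ∩ A) ⊹ u) (⊆-⊹ (B ∩ A) B u (λ x∈ x∉ y∈ y∉ → ∩-intro (⊕∈ b x∈ y∈)
      (two x∈ (λ p → x∉ (∩-intro x∈ p)) y∈ (λ p → y∉ (∩-intro y∈ p)))) u∈ (λ p → u∉ (∩-right B A p))))
    (count-mono ((B ∩ A) ⊹ u) B (⊹-⊆ u b (∩-left B A) u∈)))
  (count-⊹ u (∩-subgroup b a) (λ p → u∉ (∩-right B A p)))
  where open Subgroup

-- Direction subgroups on a line

-- What the claws with two points over one point of the line, differing by `w`, and a third point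
-- over another say about directions, once the chosen points of the cosets are subtracted.
Rule : ∀ {n} → Subset n → Subset n → Subset n → Set
Rule X Y Z = ∀ {w s} → w ∈ X → w ∉ Y → s ∈ X ⊎ s ∈ Y → s ∈ Z ⊎ (s ⊕ w) ∈ Z

record Line {n} (X Y Z : Subset n) : Set where
  constructor line
  field
    sgX : Subgroup X
    sgY : Subgroup Y
    sgZ : Subgroup Z
    XYZ : Rule X Y Z
    XZY : Rule X Z Y
    YXZ : Rule Y X Z
    ZYX : Rule Z Y X

record Pencil {n} (X Y Z : Subset n) : Set where
  field
    XY⊆Z : ∀ {x} → x ∈ X → x ∈ Y → x ∈ Z
    XZ⊆Y : ∀ {x} → x ∈ X → x ∈ Z → x ∈ Y
    YZ⊆X : ∀ {x} → x ∈ Y → x ∈ Z → x ∈ X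
    twoXY : AtMostTwoCosets Y X
    sum : ∀ {x y} → x ∈ X → x ∉ Y → y ∈ Y → y ∉ X → (x ⊕ y) ∈ Z
    countXY : count X ≡ count Y

data LineType {n} (X Y Z : Subset n) : Set where
  lower : X ⊆ Z → Z ⊆ X → Y ⊆ X → LineType X Y Z
  upper : Y ⊆ Z → Z ⊆ Y → Y ⊆ X → AtMostTwoCosets Y X → LineType X Y Z
  pencil : Pencil X Y Z → LineType X Y Z

-- Everything turns on whether `Z` contains an element `w₁` of `X` outside `Y`. If so, the two
-- outcomes of the rule for `w₁` amount to the same and force `X` and `Y` into `Z`. If not, `X ∩ Z`
-- lies in `Y`, and the rule gives `X ∩ Y` index two in `X`.
lineType : ∀ {n} {X Y Z : Subset n} → Line X Y Z → ∀ {w} → w ∈ X → w ∉ Y → LineType X Y Z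
lineType {X = X} {Y} {Z} (line sgX sgY sgZ XYZ XZY YXZ ZYX) {w} w∈X w∉Y
  with any? (λ w → (w ∈? X) ×-dec (¬? (w ∈? Y) ×-dec (w ∈? Z)))
... | yes (w₁ , w₁∈X , w₁∉Y , w₁∈Z) = lower X⊆Z Z⊆X λ y∈ → Z⊆X (Y⊆Z y∈)
  where
  X⊆Z : X ⊆ Z
  X⊆Z s∈ with XYZ w₁∈X w₁∉Y (inj₁ s∈)
  ... | inj₁ p = p
  ... | inj₂ p = Subgroup.cancelʳ sgZ p w₁∈Z
  Y⊆Z : Y ⊆ Z
  Y⊆Z s∈ with XYZ w₁∈X w₁∉Y (inj₂ s∈)
  ... | inj₁ p = p
  ... | inj₂ p = Subgroup.cancelʳ sgZ p w₁∈Z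
  Z⊆X : Z ⊆ X
  Z⊆X s∈ with ZYX w₁∈Z w₁∉Y (inj₁ s∈)
  ... | inj₁ p = p
  ... | inj₂ p = Subgroup.cancelʳ sgX p w₁∈X
... | no none = case ⊆-or-witness Y X of λ
  { (inj₁ Y⊆X) → upper (λ y∈ → XY⊆Z (Y⊆X y∈) y∈) (Z⊆Y Y⊆X) Y⊆X twoXY
  ; (inj₂ (y , y∈Y , y∉X)) → pencil (toPencil y∈Y y∉X) }
  where
  ∉Z : ∀ {x} → x ∈ X → x ∉ Y → x ∉ Z
  ∉Z x∈X x∉Y x∈Z = none (_ , x∈X , x∉Y , x∈Z)
  XZ⊆Y : ∀ {x} → x ∈ X → x ∈ Z → x ∈ Y
  XZ⊆Y {x} x∈X x∈Z with x ∈? Y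
  ... | yes p = p
  ... | no ¬p = ⊥-elim (∉Z x∈X ¬p x∈Z)
  XY⊆Z : ∀ {x} → x ∈ X → x ∈ Y → x ∈ Z
  XY⊆Z x∈X x∈Y with XYZ w∈X w∉Y (inj₁ x∈X)
  ... | inj₁ p = p
  ... | inj₂ p = ⊥-elim (∉Z (Subgroup.⊕∈ sgX x∈X w∈X) (λ q → w∉Y (Subgroup.cancelˡ sgY q x∈Y)) p)
  twoXY : AtMostTwoCosets Y X
  twoXY x∈ x∉ y∈ y∉ with XYZ y∈ y∉ (inj₁ x∈)
  ... | inj₁ p = ⊥-elim (∉Z x∈ x∉ p)
  ... | inj₂ p = XZ⊆Y (Subgroup.⊕∈ sgX x∈ y∈) p
  Z⊆Y : Y ⊆ X → Z ⊆ Y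
  Z⊆Y Y⊆X z∈ with XZY w∈X (∉Z w∈X w∉Y) (inj₂ z∈)
  ... | inj₁ p = p
  ... | inj₂ p = XZ⊆Y (Subgroup.cancelʳ sgX (Y⊆X p) w∈X) z∈

  toPencil : ∀ {y} → y ∈ Y → y ∉ X → Pencil X Y Z
  toPencil {y₀} y₀∈Y y₀∉X = record
    { XY⊆Z = XY⊆Z ; XZ⊆Y = XZ⊆Y ; YZ⊆X = YZ⊆X ; twoXY = twoXY ; sum = sum
    ; countXY = trans (count-half Y X w sgY sgX w∈X w∉Y twoXY) (trans (cong (2 *_) (count-cong λ x → Boolₚ.∧-comm (X x) (Y x)))
        (sym (count-half X Y y₀ sgX sgY y₀∈Y y₀∉X twoYX))) }
    where
    Y∉Z : ∀ {y} → y ∈ Y → y ∉ X → y ∉ Z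
    Y∉Z y∈ y∉ y∈Z with YXZ y∈ y∉ (inj₂ w∈X)
    ... | inj₁ p = ∉Z w∈X w∉Y p
    ... | inj₂ p = ∉Z w∈X w∉Y (Subgroup.cancelʳ sgZ p y∈Z)
    YZ⊆X : ∀ {x} → x ∈ Y → x ∈ Z → x ∈ X
    YZ⊆X {x} x∈Y x∈Z with x ∈? X
    ... | yes p = p
    ... | no ¬p = ⊥-elim (Y∉Z x∈Y ¬p x∈Z)
    twoYX : AtMostTwoCosets X Y
    twoYX x∈ x∉ y∈ y∉ with YXZ y∈ y∉ (inj₁ x∈)
    ... | inj₁ p = ⊥-elim (Y∉Z x∈ x∉ p)
    ... | inj₂ p = YZ⊆X (Subgroup.⊕∈ sgY x∈ y∈) p
    sum : ∀ {x y} → x ∈ X → x ∉ Y → y ∈ Y → y ∉ X → (x ⊕ y) ∈ Z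
    sum {x} {y} x∈ x∉ y∈ y∉ with XYZ x∈ x∉ (inj₂ y∈)
    ... | inj₁ p = ⊥-elim (Y∉Z y∈ y∉ p)
    ... | inj₂ p = subst (_∈ Z) (⊕-comm y x) p

-- Both `lineType` and `clawRule` start from a failed inclusion. Unless the three sets coincide, one
-- of these four inclusions fails, and a permutation of the line makes it the one between the first
-- two sets.
data Comparison {n} (A B C : Subset n) : Set where
  A⊈B : ∀ {w} → w ∈ A → w ∉ B → Comparison A B C
  B⊈A : ∀ {w} → w ∈ B → w ∉ A → Comparison A B C
  A⊈C : ∀ {w} → w ∈ A → w ∉ C → Comparison A B C
  C⊈A : ∀ {w} → w ∈ C → w ∉ A → Comparison A B C
  A≗B≗C : A ⊆ B → B ⊆ A → A ⊆ C → C ⊆ A → Comparison A B C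

compare : ∀ {n} (A B C : Subset n) → Comparison A B C
compare A B C with ⊆-or-witness A B | ⊆-or-witness B A | ⊆-or-witness A C | ⊆-or-witness C A
... | inj₂ (_ , w∈ , w∉) | _ | _ | _ = A⊈B w∈ w∉
... | inj₁ _ | inj₂ (_ , w∈ , w∉) | _ | _ = B⊈A w∈ w∉
... | inj₁ _ | inj₁ _ | inj₂ (_ , w∈ , w∉) | _ = A⊈C w∈ w∉
... | inj₁ _ | inj₁ _ | inj₁ _ | inj₂ (_ , w∈ , w∉) = C⊈A w∈ w∉
... | inj₁ a⊆b | inj₁ b⊆a | inj₁ a⊆c | inj₁ c⊆a = A≗B≗C a⊆b b⊆a a⊆c c⊆a

-- Integer sums over F₂ⁿ

total : ∀ {n} → (V n → ℤ) → ℤ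
total {zero} g = g []
total {suc n} g = total (g ∘ (true ∷_)) +ℤ total (g ∘ (false ∷_))

total-cong : ∀ {n} {g h : V n → ℤ} → (∀ x → g x ≡ h x) → total g ≡ total h
total-cong {zero} p = p []
total-cong {suc n} p = cong₂ _+ℤ_ (total-cong (p ∘ (true ∷_))) (total-cong (p ∘ (false ∷_)))

total-+ : ∀ {n} (g h : V n → ℤ) → total (λ x → g x +ℤ h x) ≡ total g +ℤ total h
total-+ {zero} g h = refl
total-+ {suc n} g h = trans (cong₂ _+ℤ_ (total-+ (g ∘ (true ∷_)) (h ∘ (true ∷_))) (total-+ (g ∘ (false ∷_)) (h ∘ (false ∷_))))
  (ℤ-solve 4 (λ a b c d → (a :+ b) :+ (c :+ d) := (a :+ c) :+ (b :+ d)) refl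
    (total (g ∘ (true ∷_))) (total (h ∘ (true ∷_))) (total (g ∘ (false ∷_))) (total (h ∘ (false ∷_))))
  where open ℤ-Solver renaming (solve to ℤ-solve)

total-*ˡ : ∀ {n} c (g : V n → ℤ) → total (λ x → c *ℤ g x) ≡ c *ℤ total g
total-*ˡ {zero} c g = refl
total-*ˡ {suc n} c g = trans (cong₂ _+ℤ_ (total-*ˡ c (g ∘ (true ∷_))) (total-*ˡ c (g ∘ (false ∷_)))) (sym (ℤₚ.*-distribˡ-+ c (total (g ∘ (true ∷_))) (total (g ∘ (false ∷_)))))

total-0 : ∀ {n} {g : V n → ℤ} → (∀ x → g x ≡ + 0) → total g ≡ + 0
total-0 {zero} p = p []
total-0 {suc n} {g} p rewrite total-0 (p ∘ (true ∷_)) | total-0 (p ∘ (false ∷_)) = refl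

total≥0 : ∀ {n} {g : V n → ℤ} → (∀ x → + 0 ≤ℤ g x) → + 0 ≤ℤ total g
total≥0 {zero} p = p []
total≥0 {suc n} p = ℤₚ.+-mono-≤ (total≥0 (p ∘ (true ∷_))) (total≥0 (p ∘ (false ∷_)))

value-0≤total : ∀ {n} (g : V n → ℤ) → (∀ x → x ≢ 0v n → + 0 ≤ℤ g x) → g (0v n) ≤ℤ total g
value-0≤total {zero} g p = ℤₚ.≤-refl
value-0≤total {suc n} g p = subst (_≤ℤ total g) (ℤₚ.+-identityˡ _)
  (ℤₚ.+-mono-≤ (total≥0 (λ x → p (true ∷ x) λ ()))
    (value-0≤total (g ∘ (false ∷_)) λ x x≢0 → p (false ∷ x) λ { refl → x≢0 refl }))

-- The Fourier transform

χ : Bool → ℤ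
χ false = + 1
χ true = -[1+ 0 ]

-- The Walsh-Hadamard transform without normalisation: all values stay integers, and the factor 2ⁿ
-- appears only on inversion.
hat : ∀ {n} → (V n → ℤ) → V n → ℤ
hat g l = total λ x → g x *ℤ χ (dot l x)

hat-+ : ∀ {n} (g h : V n → ℤ) l → hat (λ x → g x +ℤ h x) l ≡ hat g l +ℤ hat h l
hat-+ g h l = trans (total-cong λ x → ℤₚ.*-distribʳ-+ (χ (dot l x)) (g x) (h x)) (total-+ (λ x → g x *ℤ χ (dot l x)) _)

χ-not : ∀ a b → a *ℤ χ (not b) ≡ -[1+ 0 ] *ℤ (a *ℤ χ b)
χ-not a false = solve 1 (λ a → a :* con -[1+ 0 ] := con -[1+ 0 ] :* (a :* con (+ 1))) refl a
  where open ℤ-Solver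
χ-not a true = solve 1 (λ a → a :* con (+ 1) := con -[1+ 0 ] :* (a :* con -[1+ 0 ])) refl a
  where open ℤ-Solver

hat-true : ∀ {n} (g : V (suc n) → ℤ) l →
  hat g (true ∷ l) ≡ -[1+ 0 ] *ℤ hat (g ∘ (true ∷_)) l +ℤ hat (g ∘ (false ∷_)) l
hat-true g l = cong (_+ℤ hat (g ∘ (false ∷_)) l)
  (trans (total-cong λ x → χ-not (g (true ∷ x)) (dot l x)) (total-*ˡ -[1+ 0 ] (λ x → g (true ∷ x) *ℤ χ (dot l x))))

-- Fourier inversion at the origin. Together with `hat-convolve` it turns sums of powers of
-- coefficients into counts.
total-hat : ∀ {n} (g : V n → ℤ) → total (hat g) ≡ + (2 ^ n) *ℤ g (0v n)
total-hat {zero} g = ℤₚ.*-comm (g []) (+ 1)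
total-hat {suc n} g = begin
  total (λ l → hat g (true ∷ l)) +ℤ total (λ l → hat g (false ∷ l))
    ≡⟨ total-+ (λ l → hat g (true ∷ l)) (λ l → hat g (false ∷ l)) ⟨
  total (λ l → hat g (true ∷ l) +ℤ hat g (false ∷ l))
    ≡⟨ total-cong (λ l → trans (cong (_+ℤ hat g (false ∷ l)) (hat-true g l))
         (solve 2 (λ a b → (con -[1+ 0 ] :* a :+ b) :+ (a :+ b) := con (+ 2) :* b) refl
           (hat (g ∘ (true ∷_)) l) (hat (g ∘ (false ∷_)) l))) ⟩
  total (λ l → + 2 *ℤ hat (g ∘ (false ∷_)) l)
    ≡⟨ total-*ˡ (+ 2) (hat (g ∘ (false ∷_))) ⟩
  + 2 *ℤ total (hat (g ∘ (false ∷_)))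
    ≡⟨ cong (+ 2 *ℤ_) (total-hat (g ∘ (false ∷_))) ⟩
  + 2 *ℤ (+ (2 ^ n) *ℤ g (0v (suc n)))
    ≡⟨ ℤₚ.*-assoc (+ 2) (+ (2 ^ n)) (g (0v (suc n))) ⟨
  (+ 2 *ℤ + (2 ^ n)) *ℤ g (0v (suc n))
    ≡⟨ cong (_*ℤ g (0v (suc n))) (ℤₚ.pos-* 2 (2 ^ n)) ⟨
  + (2 ^ suc n) *ℤ g (0v (suc n)) ∎
  where
  open ≡-Reasoning
  open ℤ-Solver

convolve : ∀ {n} → (V n → ℤ) → (V n → ℤ) → V n → ℤ
convolve g h z = total λ x → g x *ℤ h (x ⊕ z)

hat-convolve : ∀ {n} (g h : V n → ℤ) l → hat (convolve g h) l ≡ hat g l *ℤ hat h l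
hat-convolve {zero} g h [] = solve 2 (λ a b → (a :* b) :* con (+ 1) := (a :* con (+ 1)) :* (b :* con (+ 1))) refl (g []) (h [])
  where open ℤ-Solver
hat-convolve {suc n} g h (b ∷ l) = byHead b
  where
  open ℤ-Solver
  g₁ = g ∘ (true ∷_)
  g₀ = g ∘ (false ∷_)
  h₁ = h ∘ (true ∷_)
  h₀ = h ∘ (false ∷_)
  split : ∀ a b c d → hat (λ z → convolve a b z +ℤ convolve c d z) l ≡ hat a l *ℤ hat b l +ℤ hat c l *ℤ hat d l
  split a b c d = trans (hat-+ (convolve a b) (convolve c d) l) (cong₂ _+ℤ_ (hat-convolve a b l) (hat-convolve c d l))
  byHead : ∀ b → hat (convolve g h) (b ∷ l) ≡ hat g (b ∷ l) *ℤ hat h (b ∷ l)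
  byHead false = trans (cong₂ _+ℤ_ (split g₁ h₀ g₀ h₁) (split g₁ h₁ g₀ h₀))
    (solve 4 (λ a b c d → (a :* d :+ b :* c) :+ (a :* c :+ b :* d) := (a :+ b) :* (c :+ d)) refl
      (hat g₁ l) (hat g₀ l) (hat h₁ l) (hat h₀ l))
  byHead true = trans (hat-true (convolve g h) l)
    (trans (cong₂ _+ℤ_ (cong (-[1+ 0 ] *ℤ_) (split g₁ h₀ g₀ h₁)) (split g₁ h₁ g₀ h₀))
    (trans (solve 4 (λ a b c d → con -[1+ 0 ] :* (a :* d :+ b :* c) :+ (a :* c :+ b :* d)
          := (con -[1+ 0 ] :* a :+ b) :* (con -[1+ 0 ] :* c :+ d)) refl
      (hat g₁ l) (hat g₀ l) (hat h₁ l) (hat h₀ l))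
    (sym (cong₂ _*ℤ_ (hat-true g l) (hat-true h l)))))

-- Triangle-free sets

-- The case `x ≡ y` is included and keeps `0v n` out of `T`.
TriangleFree : ∀ {n} → Subset n → Set
TriangleFree T = ∀ {x y} → x ∈ T → y ∈ T → (x ⊕ y) ∉ T

⟪_⟫ : ∀ {n} → Subset n → V n → ℤ
⟪ T ⟫ x = + indicator (T x)

total-count : ∀ {n} (T : Subset n) → total ⟪ T ⟫ ≡ + count T
total-count {zero} T = refl
total-count {suc n} T = trans (cong₂ _+ℤ_ (total-count (T ∘ (true ∷_))) (total-count (T ∘ (false ∷_)))) (sym (ℤₚ.pos-+ (count (T ∘ (true ∷_))) _))

hat-0 : ∀ {n} (g : V n → ℤ) → hat g (0v n) ≡ total g
hat-0 g = total-cong λ x → trans (cong (λ b → g x *ℤ χ b) (dot-0ˡ x)) (ℤₚ.*-identityʳ (g x))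

-- (1 + χ (dot l x)) / 2 is the indicator of the hyperplane, which `kernel l` parametrises
-- bijectively; the factor two clears the denominator.
count-kernel : ∀ {n} (T : Subset (suc n)) l → l ≢ 0v (suc n) →
  + 2 *ℤ total (⟪ T ⟫ ∘ kernel l) ≡ total ⟪ T ⟫ +ℤ hat ⟪ T ⟫ l
count-kernel T (true ∷ l) _ = begin
  + 2 *ℤ total (λ x → ⟪ T ⟫ (dot l x ∷ x))
    ≡⟨ total-*ˡ (+ 2) (λ x → ⟪ T ⟫ (dot l x ∷ x)) ⟨
  total (λ x → + 2 *ℤ ⟪ T ⟫ (dot l x ∷ x))
    ≡⟨ total-cong (λ x → pointwise (⟪ T ⟫ (true ∷ x)) (⟪ T ⟫ (false ∷ x)) (dot l x) (λ b → ⟪ T ⟫ (b ∷ x)) refl refl) ⟩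
  total (λ x → (⟪ T ⟫ (true ∷ x) +ℤ ⟪ T ⟫ (false ∷ x)) +ℤ (⟪ T ⟫ (true ∷ x) *ℤ χ (not (dot l x)) +ℤ ⟪ T ⟫ (false ∷ x) *ℤ χ (dot l x)))
    ≡⟨ total-+ (λ x → ⟪ T ⟫ (true ∷ x) +ℤ ⟪ T ⟫ (false ∷ x)) _ ⟩
  total (λ x → ⟪ T ⟫ (true ∷ x) +ℤ ⟪ T ⟫ (false ∷ x)) +ℤ total (λ x → ⟪ T ⟫ (true ∷ x) *ℤ χ (not (dot l x)) +ℤ ⟪ T ⟫ (false ∷ x) *ℤ χ (dot l x))
    ≡⟨ cong₂ _+ℤ_ (total-+ (λ x → ⟪ T ⟫ (true ∷ x)) _) (total-+ (λ x → ⟪ T ⟫ (true ∷ x) *ℤ χ (not (dot l x))) _) ⟩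
  total ⟪ T ⟫ +ℤ hat ⟪ T ⟫ (true ∷ l) ∎
  where
  open ≡-Reasoning
  open ℤ-Solver
  pointwise : ∀ a b c (g : Bool → ℤ) → g true ≡ a → g false ≡ b →
    + 2 *ℤ g c ≡ (a +ℤ b) +ℤ (a *ℤ χ (not c) +ℤ b *ℤ χ c)
  pointwise a b false g refl refl = solve 2 (λ a b → con (+ 2) :* b := (a :+ b) :+ (a :* con -[1+ 0 ] :+ b :* con (+ 1))) refl a b
  pointwise a b true g refl refl = solve 2 (λ a b → con (+ 2) :* a := (a :+ b) :+ (a :* con (+ 1) :+ b :* con -[1+ 0 ])) refl a b
count-kernel {zero} T (false ∷ []) l≢0 = ⊥-elim (l≢0 refl)
count-kernel {suc n} T (false ∷ l) l≢0 = begin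
  + 2 *ℤ (total (⟪ T ∘ (true ∷_) ⟫ ∘ kernel l) +ℤ total (⟪ T ∘ (false ∷_) ⟫ ∘ kernel l))
    ≡⟨ ℤₚ.*-distribˡ-+ (+ 2) (total (⟪ T ∘ (true ∷_) ⟫ ∘ kernel l)) _ ⟩
  + 2 *ℤ total (⟪ T ∘ (true ∷_) ⟫ ∘ kernel l) +ℤ + 2 *ℤ total (⟪ T ∘ (false ∷_) ⟫ ∘ kernel l)
    ≡⟨ cong₂ _+ℤ_ (count-kernel (T ∘ (true ∷_)) l l′≢0) (count-kernel (T ∘ (false ∷_)) l l′≢0) ⟩
  (total ⟪ T ∘ (true ∷_) ⟫ +ℤ hat ⟪ T ∘ (true ∷_) ⟫ l) +ℤ (total ⟪ T ∘ (false ∷_) ⟫ +ℤ hat ⟪ T ∘ (false ∷_) ⟫ l)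
    ≡⟨ solve 4 (λ a b c d → (a :+ b) :+ (c :+ d) := (a :+ c) :+ (b :+ d)) refl
         (total ⟪ T ∘ (true ∷_) ⟫) (hat ⟪ T ∘ (true ∷_) ⟫ l) (total ⟪ T ∘ (false ∷_) ⟫) (hat ⟪ T ∘ (false ∷_) ⟫ l) ⟩
  total ⟪ T ⟫ +ℤ hat ⟪ T ⟫ (false ∷ l) ∎
  where
  open ≡-Reasoning
  open ℤ-Solver
  l′≢0 : l ≢ 0v (suc n)
  l′≢0 refl = l≢0 refl

*≥0 : ∀ {i j} → + 0 ≤ℤ i → + 0 ≤ℤ j → + 0 ≤ℤ i *ℤ j
*≥0 {+ m} {+ n} _ _ = subst (+ 0 ≤ℤ_) (ℤₚ.pos-* m n) (+≤+ z≤n)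

+ℤ-cancelˡ-≤ : ∀ i {j k} → i +ℤ j ≤ℤ i +ℤ k → j ≤ℤ k
+ℤ-cancelˡ-≤ i {j} {k} h = subst₂ _≤ℤ_ (cancel j) (cancel k) (ℤₚ.+-monoʳ-≤ (-ℤ i) h)
  where
  open ℤ-Solver
  cancel : ∀ j → (-ℤ i) +ℤ (i +ℤ j) ≡ j
  cancel = solve 2 (λ i j → (:- i) :+ (i :+ j) := j) refl i

square≥0 : ∀ i → + 0 ≤ℤ i *ℤ i
square≥0 (+ n) = subst (+ 0 ≤ℤ_) (ℤₚ.pos-* n n) (+≤+ z≤n)
square≥0 -[1+ n ] = +≤+ z≤n

module _ {n} (T : Subset n) (free : TriangleFree T) where
  private
    t N : ℤ
    t = total ⟪ T ⟫
    N = + (2 ^ n)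
    F Φ : V n → ℤ
    F = hat ⟪ T ⟫
    -- The weight F² keeps the sign of the second factor and makes the total computable from the
    -- second and third moments.
    Φ l = (F l *ℤ F l) *ℤ (N *ℤ F l +ℤ t *ℤ t)

    -- Parseval: inversion counts the pairs of equal points of `T`.
    moment₂ : total (λ l → F l *ℤ F l) ≡ N *ℤ t
    moment₂ = trans (total-cong λ l → sym (hat-convolve ⟪ T ⟫ ⟪ T ⟫ l))
      (trans (total-hat (convolve ⟪ T ⟫ ⟪ T ⟫)) (cong (N *ℤ_) (total-cong λ x →
        trans (cong (λ y → ⟪ T ⟫ x *ℤ ⟪ T ⟫ y) (⊕-idʳ x)) (idem (T x)))))
      where
      idem : ∀ b → + indicator b *ℤ + indicator b ≡ + indicator b
      idem true = refl
      idem false = refl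

    -- By inversion this is N times the number of pairs x, z in `T` with x ⊕ z in `T`.
    moment₃ : total (λ l → (F l *ℤ F l) *ℤ F l) ≡ + 0
    moment₃ = trans (total-cong λ l → sym (trans (hat-convolve (convolve ⟪ T ⟫ ⟪ T ⟫) ⟪ T ⟫ l)
        (cong (_*ℤ F l) (hat-convolve ⟪ T ⟫ ⟪ T ⟫ l))))
      (trans (total-hat (convolve (convolve ⟪ T ⟫ ⟪ T ⟫) ⟪ T ⟫))
      (trans (cong (N *ℤ_) (total-0 λ z → trans (ℤₚ.*-comm (convolve ⟪ T ⟫ ⟪ T ⟫ z) _)
        (trans (sym (total-*ˡ (⟪ T ⟫ (z ⊕ 0v n)) (λ x → ⟪ T ⟫ x *ℤ ⟪ T ⟫ (x ⊕ z)))) (total-0 λ x → vanish x z)))) (ℤₚ.*-zeroʳ N)))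
      where
      vanish : ∀ x z → ⟪ T ⟫ (z ⊕ 0v n) *ℤ (⟪ T ⟫ x *ℤ ⟪ T ⟫ (x ⊕ z)) ≡ + 0
      vanish x z rewrite ⊕-idʳ z with T z in z∈ | T x in x∈ | T (x ⊕ z) in xz∈
      ... | true | true | true = ⊥-elim (free x∈ z∈ xz∈)
      ... | true | true | false = refl
      ... | true | false | _ = refl
      ... | false | _ | _ = refl

    totalΦ : total Φ ≡ (t *ℤ t) *ℤ (N *ℤ t)
    totalΦ = begin
      total Φ ≡⟨ total-cong (λ l → solve 3 (λ F N t → (F :* F) :* (N :* F :+ t :* t) := N :* ((F :* F) :* F) :+ (t :* t) :* (F :* F)) refl (F l) N t) ⟩
      total (λ l → N *ℤ ((F l *ℤ F l) *ℤ F l) +ℤ (t *ℤ t) *ℤ (F l *ℤ F l)) ≡⟨ total-+ (λ l → N *ℤ ((F l *ℤ F l) *ℤ F l)) _ ⟩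
      total (λ l → N *ℤ ((F l *ℤ F l) *ℤ F l)) +ℤ total (λ l → (t *ℤ t) *ℤ (F l *ℤ F l)) ≡⟨ cong₂ _+ℤ_ (total-*ˡ N (λ l → (F l *ℤ F l) *ℤ F l)) (total-*ˡ (t *ℤ t) (λ l → F l *ℤ F l)) ⟩
      N *ℤ total (λ l → (F l *ℤ F l) *ℤ F l) +ℤ (t *ℤ t) *ℤ total (λ l → F l *ℤ F l) ≡⟨ cong₂ (λ a b → N *ℤ a +ℤ (t *ℤ t) *ℤ b) moment₃ moment₂ ⟩
      N *ℤ + 0 +ℤ (t *ℤ t) *ℤ (N *ℤ t) ≡⟨ cong (_+ℤ (t *ℤ t) *ℤ (N *ℤ t)) (ℤₚ.*-zeroʳ N) ⟩
      + 0 +ℤ (t *ℤ t) *ℤ (N *ℤ t) ≡⟨ ℤₚ.+-identityˡ _ ⟩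
      (t *ℤ t) *ℤ (N *ℤ t) ∎
      where
      open ≡-Reasoning
      open ℤ-Solver

    Φ-0 : Φ (0v n) ≡ (t *ℤ t) *ℤ (N *ℤ t) +ℤ (t *ℤ t) *ℤ (t *ℤ t)
    Φ-0 rewrite hat-0 ⟪ T ⟫ = ℤₚ.*-distribˡ-+ (t *ℤ t) (N *ℤ t) (t *ℤ t)

  -- The sum of all Φ l is N t³, but Φ at the origin alone is N t³ + t⁴. If N F + t² were
  -- nonnegative at every other l, then t⁴ ≤ 0.
  negativeCoefficient : 1 ≤ count T → ∃ λ l → l ≢ 0v n × (+ (2 ^ n) *ℤ hat ⟪ T ⟫ l +ℤ total ⟪ T ⟫ *ℤ total ⟪ T ⟫) <ℤ + 0
  negativeCoefficient pos with any? (λ l → ¬? (l ≟ᵥ 0v n) ×-dec (N *ℤ F l +ℤ t *ℤ t ℤₚ.<? + 0))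
  ... | yes r = r
  ... | no none = ⊥-elim (ℤₚ.<⇒≱ t⁴>0 t⁴≤0)
    where
    Φ≥0 : ∀ l → l ≢ 0v n → + 0 ≤ℤ Φ l
    Φ≥0 l l≢0 = *≥0 (square≥0 (F l)) (ℤₚ.≮⇒≥ λ lt → none (l , l≢0 , lt))
    t⁴≤0 : (t *ℤ t) *ℤ (t *ℤ t) ≤ℤ + 0
    t⁴≤0 = +ℤ-cancelˡ-≤ ((t *ℤ t) *ℤ (N *ℤ t)) (subst₂ _≤ℤ_ Φ-0 (trans totalΦ (sym (ℤₚ.+-identityʳ _))) (value-0≤total Φ Φ≥0))
    t⁴>0 : + 0 <ℤ (t *ℤ t) *ℤ (t *ℤ t)
    t⁴>0 = subst (λ t → + 0 <ℤ (t *ℤ t) *ℤ (t *ℤ t)) (sym (total-count T)) (positive (count T) pos)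
      where
      positive : ∀ c → 1 ≤ c → + 0 <ℤ (+ c *ℤ + c) *ℤ (+ c *ℤ + c)
      positive (suc c) _ = +<+ (s≤s z≤n)

-- Eliminates the Fourier coefficient F between N F + t² < 0 and 2 t′ = t + F.
eliminate : ∀ N t t′ F → + N *ℤ F +ℤ + t *ℤ + t <ℤ + 0 → + 2 *ℤ + t′ ≡ + t +ℤ F → N * (2 * t′) + t * t ≤ N * t
eliminate N t t′ F neg eq = ℤₚ.drop‿+≤+ (subst₂ _≤ℤ_ lhs rhs (ℤₚ.<⇒≤ (ℤₚ.+-monoˡ-< (+ N *ℤ + t) neg)))
  where
  open ℤ-Solver
  lhs : (+ N *ℤ F +ℤ + t *ℤ + t) +ℤ + N *ℤ + t ≡ + (N * (2 * t′) + t * t)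
  lhs = trans (solve 3 (λ N F t → (N :* F :+ t :* t) :+ N :* t := N :* (t :+ F) :+ t :* t) refl (+ N) F (+ t))
    (trans (cong (λ z → + N *ℤ z +ℤ + t *ℤ + t) (sym eq))
    (sym (trans (ℤₚ.pos-+ (N * (2 * t′)) (t * t)) (cong₂ _+ℤ_
      (trans (ℤₚ.pos-* N (2 * t′)) (cong (+ N *ℤ_) (ℤₚ.pos-* 2 t′))) (ℤₚ.pos-* t t)))))
  rhs : + 0 +ℤ + N *ℤ + t ≡ + (N * t)
  rhs = trans (ℤₚ.+-identityˡ _) (sym (ℤₚ.pos-* N t))

-- With densities α = t / N and α′ = 2 t′ / N this is: α′ ≤ α - α² implies 1 / α′ ≥ 1 / α + 1.
density-step : ∀ M s t t′ → 1 ≤ t → 1 ≤ M → s * t ≤ 2 * M → (2 * M) * (2 * t′) + t * t ≤ (2 * M) * t → suc s * t′ ≤ M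
density-step M s (suc t₁) t′ _ M≥1@(s≤s _) st≤N h = ℕₚ.*-cancelˡ-≤ 2 (ℕₚ.*-cancelˡ-≤ (N * t) goal)
  where
  open ℕ-Solver
  t = suc t₁
  N = 2 * M
  -- (N + t) times the hypothesis, with N t² cancelled from both sides and t³ dropped on the left
  scaled : (N * (2 * t′)) * (N + t) ≤ (N * t) * N
  scaled = ℕₚ.+-cancelʳ-≤ ((t * t) * N) _ _ (begin
    (N * (2 * t′)) * (N + t) + (t * t) * N ≤⟨ ℕₚ.m≤m+n _ ((t * t) * t) ⟩
    (N * (2 * t′)) * (N + t) + (t * t) * N + (t * t) * t
      ≡⟨ solve 3 (λ N t u → u :* (N :+ t) :+ (t :* t) :* N :+ (t :* t) :* t := (u :+ t :* t) :* (N :+ t)) refl N t (N * (2 * t′)) ⟩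
    (N * (2 * t′) + t * t) * (N + t) ≤⟨ ℕₚ.*-monoˡ-≤ (N + t) h ⟩
    (N * t) * (N + t) ≡⟨ solve 2 (λ N t → (N :* t) :* (N :+ t) := (N :* t) :* N :+ (t :* t) :* N) refl N t ⟩
    (N * t) * N + (t * t) * N ∎)
    where open ℕₚ.≤-Reasoning
  goal : (N * t) * (2 * (suc s * t′)) ≤ (N * t) * (2 * M)
  goal = begin
    (N * t) * (2 * (suc s * t′))
      ≡⟨ solve 4 (λ N t s t′ → (N :* t) :* (con 2 :* ((con 1 :+ s) :* t′)) := (N :* (con 2 :* t′)) :* (s :* t :+ t)) refl N t s t′ ⟩
    (N * (2 * t′)) * (s * t + t) ≤⟨ ℕₚ.*-monoʳ-≤ (N * (2 * t′)) (ℕₚ.+-monoˡ-≤ t st≤N) ⟩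
    (N * (2 * t′)) * (N + t) ≤⟨ scaled ⟩
    (N * t) * (2 * M) ∎
    where open ℕₚ.≤-Reasoning

count-empty : ∀ n → count {n} (λ _ → false) ≡ 0
count-empty zero = refl
count-empty (suc n) rewrite count-empty n = refl

∈⇒1≤count : ∀ {n} {A : Subset n} x → x ∈ A → 1 ≤ count A
∈⇒1≤count {n} {A} x x∈ = subst (_< count A) (count-empty n) (count-strict (λ _ → false) A (λ ()) x x∈ λ ())

count≤2^ : ∀ {n} (A : Subset n) → count A ≤ 2 ^ n
count≤2^ {zero} A with A []
... | true = s≤s z≤n
... | false = z≤n
count≤2^ {suc n} A = ℕₚ.+-mono-≤ (count≤2^ (A ∘ (true ∷_)))
  (ℕₚ.≤-trans (count≤2^ (A ∘ (false ∷_))) (ℕₚ.≤-reflexive (sym (ℕₚ.+-identityʳ _))))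

-- The coefficient vector `v` may be zero; since a triangle-free `T` misses the origin, the point
-- found there belongs to the flat all the same.
MeetsFlats : ∀ {n} → Subset n → ℕ → Set
MeetsFlats {n} T k = ∀ (cs : Vec (V n) k) → Independent cs → ∃ λ v → lin cs v ∈ T

independentFamily : ∀ i k → ∃ λ (cs : Vec (V (i + k)) k) → Independent cs
independentFamily zero k = basis k , λ v v≢0 p → v≢0 (trans (sym (lin-basis v)) p)
independentFamily (suc i) k with independentFamily i k
... | cs , ind = map (false ∷_) cs , λ v v≢0 p → ind v v≢0 (cong (λ { (_ ∷ u) → u }) (trans (sym (lin-map-∷ cs v)) p))

meetsFlats⇒1≤count : ∀ i k (T : Subset (i + k)) → MeetsFlats T k → 1 ≤ count T
meetsFlats⇒1≤count i k T meets with independentFamily i k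
... | cs , ind = ∈⇒1≤count {A = T} _ (proj₂ (meets cs ind))

2^-positive : ∀ n → 1 ≤ 2 ^ n
2^-positive n = ℕₚ.m^n>0 2 n

n<2^n : ∀ n → n < 2 ^ n
n<2^n zero = s≤s z≤n
n<2^n (suc n) = ℕₚ.+-mono-≤ (2^-positive n) (ℕₚ.≤-trans (n<2^n n) (ℕₚ.≤-reflexive (sym (ℕₚ.+-identityʳ _))))

-- While T meets every k-dimensional flat, restricting to a suitable hyperplane raises s in s |T| ≤ 2ⁿ by one.
meetsFlats⇒≤ : ∀ k i s (T : Subset (i + k)) → TriangleFree T → MeetsFlats T k → s * count T ≤ 2 ^ (i + k) → s + i ≤ 2 ^ k
meetsFlats⇒≤ k zero s T free meets le = subst (_≤ 2 ^ k) (sym (ℕₚ.+-identityʳ s))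
  (ℕₚ.≤-trans (ℕₚ.≤-trans (ℕₚ.≤-reflexive (sym (ℕₚ.*-identityʳ s))) (ℕₚ.*-monoʳ-≤ s (meetsFlats⇒1≤count 0 k T meets))) le)
meetsFlats⇒≤ k (suc i) s T free meets le with negativeCoefficient T free (meetsFlats⇒1≤count (suc i) k T meets)
... | l , l≢0 , neg = subst (_≤ 2 ^ k) (sym (ℕₚ.+-suc s i)) (meetsFlats⇒≤ k i (suc s) (T ∘ kernel l) free′ meets′ sparser)
  where
  M = 2 ^ (i + k)
  free′ : TriangleFree (T ∘ kernel l)
  free′ {x} {y} x∈ y∈ xy∈ = free x∈ y∈ (subst (_∈ T) (kernel-additive l x y) xy∈)
  meets′ : MeetsFlats (T ∘ kernel l) k
  meets′ cs ind with meets (map (kernel l) cs)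
    (λ v v≢0 p → ind v v≢0 (kernel-injective l _ (trans (sym (additive⇒lin (kernel-additive l) cs v)) p)))
  ... | v , v∈ = v , subst (_∈ T) (additive⇒lin (kernel-additive l) cs v) v∈
  sparser : suc s * count (T ∘ kernel l) ≤ M
  sparser = density-step M s (count T) (count (T ∘ kernel l)) (meetsFlats⇒1≤count (suc i) k T meets) (2^-positive (i + k)) le
    (eliminate (2 * M) (count T) (count (T ∘ kernel l)) (hat ⟪ T ⟫ l)
      (subst (λ t → + (2 * M) *ℤ hat ⟪ T ⟫ l +ℤ t *ℤ t <ℤ + 0) (total-count T) neg)
      (subst₂ (λ t′ t → + 2 *ℤ t′ ≡ t +ℤ hat ⟪ T ⟫ l) (total-count (T ∘ kernel l)) (total-count T) (count-kernel T l l≢0)))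

-- The descent starts at s = 1, the trivial bound |T| ≤ 2ⁿ. Each of the n - (k + 1) cuts adds one to
-- s, which ends at no more than 2ᵏ⁺¹.
triangleFree-bound : ∀ {n} k (T : Subset n) → TriangleFree T → MeetsFlats T (suc k) → n ≤ 2 ^ suc k + k
triangleFree-bound {n} k T free meets with ℕₚ.≤-total n k
... | inj₁ n≤k = ℕₚ.≤-trans n≤k (ℕₚ.m≤n+m k (2 ^ suc k))
... | inj₂ k≤n with ℕₚ.m≤n⇒∃[o]m+o≡n k≤n
...   | zero , refl = ℕₚ.≤-trans (ℕₚ.≤-reflexive (ℕₚ.+-identityʳ k)) (ℕₚ.m≤n+m k (2 ^ suc k))
...   | suc i , refl = bound (subst (λ n → ∀ (T : Subset n) → TriangleFree T → MeetsFlats T (suc k) → suc i ≤ 2 ^ suc k)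
    (trans (ℕₚ.+-suc i k) (ℕₚ.+-comm (suc i) k)) (λ T free meets → meetsFlats⇒≤ (suc k) i 1 T free meets
      (ℕₚ.≤-trans (ℕₚ.≤-reflexive (ℕₚ.*-identityˡ (count T))) (count≤2^ T))) T free meets)
  where
  bound : suc i ≤ 2 ^ suc k → k + suc i ≤ 2 ^ suc k + k
  bound h = ℕₚ.≤-trans (ℕₚ.≤-reflexive (ℕₚ.+-comm k (suc i))) (ℕₚ.+-monoˡ-≤ k h)

-- The fibres F a ⊆ W, for a in V r ≅ V(G) / W, of a claw-free matroid over a maximum flat W avoiding the ground set.
record Config (r m : ℕ) : Set where
  field
    F : V r → Subset m
    F-0 : ∀ x → x ∉ F (0v r)
    inhabited : ∀ a → a ≢ 0v r → ∃ λ x → x ∈ F a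
    clawFree : ∀ {a b c x y z} → x ∈ F a → y ∈ F b → z ∈ F c →
      (x ⊕ y) ∉ F (a ⊕ b) → (x ⊕ z) ∉ F (a ⊕ c) → (y ⊕ z) ∉ F (b ⊕ c) → ((x ⊕ y) ⊕ z) ∉ F ((a ⊕ b) ⊕ c) →
      ¬ (a ≡ b × x ≡ y) → ¬ (a ≡ c × x ≡ z) → ¬ (b ≡ c × y ≡ z) → ⊥
    -- Otherwise the kernel of dot l could be enlarged to a flat avoiding the ground set that is bigger than W.
    inseparable : ∀ {a b c} → a ≢ 0v r → b ≢ 0v r → c ≢ 0v r → a ⊕ b ≡ c → ∀ l α β →
      (∀ x → x ∈ F a → dot l x ≡ α) → (∀ x → x ∈ F b → dot l x ≡ β) →
      (∀ x → x ∈ F c → dot l x ≡ not (α xor β)) → ⊥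

record Triple {n} (a b c : V n) : Set where
  constructor triple
  field
    a≢0 : a ≢ 0v n
    b≢0 : b ≢ 0v n
    c≢0 : c ≢ 0v n
    eq : a ⊕ b ≡ c

  a≢b : a ≢ b
  a≢b refl = c≢0 (trans (sym eq) (⊕-self a))

swap : ∀ {n} {a b c : V n} → Triple a b c → Triple b a c
swap {a = a} {b} (triple p q r e) = triple q p r (trans (⊕-comm b a) e)

rotate : ∀ {n} {a b c : V n} → Triple a b c → Triple b c a
rotate {a = a} {b} (triple p q r e) = triple q r p
  (trans (cong (b ⊕_) (sym e)) (solveᵥ 2 (λ a b → b :⊕ (a :⊕ b) ⊜ a) refl a b))

toTriple : ∀ {n} {a b : V n} → a ≢ 0v n → b ≢ 0v n → a ≢ b → Triple a b (a ⊕ b)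
toTriple p q a≢b = triple p q (λ e → a≢b (⊕≡0⇒≡ e)) refl

-- Affine fibres and their directions

module Fibres {r m : ℕ} (C : Config r m) where
  open Config C public

  ∈F⇒≢0 : ∀ {a x} → x ∈ F a → a ≢ 0v r
  ∈F⇒≢0 {x = x} x∈ refl = F-0 x x∈

  opaque
    point : V r → V m
    point a with a ≟ᵥ 0v r
    -- A filler: there is no point over zero.
    ... | yes _ = 0v m
    ... | no a≢0 = proj₁ (inhabited a a≢0)

    point∈ : ∀ {a} → a ≢ 0v r → point a ∈ F a
    point∈ {a} a≢0 with a ≟ᵥ 0v r
    ... | yes a≡0 = ⊥-elim (a≢0 a≡0)
    ... | no a≢0 = proj₂ (inhabited a a≢0)

  triple-sum : ∀ {a x y z} → x ∈ F a → y ∈ F a → z ∈ F a → ((x ⊕ y) ⊕ z) ∈ F a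
  triple-sum {a} {x} {y} {z} x∈ y∈ z∈ with x ≟ᵥ y | x ≟ᵥ z | y ≟ᵥ z | ((x ⊕ y) ⊕ z) ∈? F a
  ... | _ | _ | _ | yes p = p
  ... | yes refl | _ | _ | no ¬p = subst (_∈ F a) (sym (trans (⊕-assoc x x z) (⊕-cancelˡ x z))) z∈
  ... | no _ | yes refl | _ | no ¬p = subst (_∈ F a) (solveᵥ 2 (λ x y → y ⊜ (x :⊕ y) :⊕ x) refl x y) y∈
  ... | no _ | no _ | yes refl | no ¬p = subst (_∈ F a) (sym (⊕-cancelʳ x y)) x∈
  ... | no x≢y | no x≢z | no y≢z | no ¬p = ⊥-elim (clawFree x∈ y∈ z∈ (empty _) (empty _) (empty _)
    (subst (λ b → ((x ⊕ y) ⊕ z) ∉ F b) (sym (trans (⊕-assoc a a a) (⊕-cancelˡ a a))) ¬p)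
    (x≢y ∘ proj₂) (x≢z ∘ proj₂) (y≢z ∘ proj₂))
    where
    empty : ∀ x → x ∉ F (a ⊕ a)
    empty x = subst (λ b → x ∉ F b) (sym (⊕-self a)) (F-0 x)

  -- F a is the coset point a ⊕ D a.
  D : V r → Subset m
  D a x = F a (point a ⊕ x)

  -- With `D-translate` this frees `D a` from the chosen point: it consists of the differences
  -- within `F a` and acts on all of `F a`.
  ∈D : ∀ {a x y} → x ∈ F a → y ∈ F a → (x ⊕ y) ∈ D a
  ∈D {a} {x} {y} x∈ y∈ = subst (_∈ F a) (solveᵥ 3 (λ x y p → (x :⊕ y) :⊕ p ⊜ p :⊕ (x :⊕ y)) refl x y (point a))
    (triple-sum x∈ y∈ (point∈ (∈F⇒≢0 x∈)))

  D-translate : ∀ {a x w} → x ∈ F a → w ∈ D a → (x ⊕ w) ∈ F a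
  D-translate {a} {x} {w} x∈ w∈ = subst (_∈ F a) (solveᵥ 3 (λ x w p → (x :⊕ (p :⊕ w)) :⊕ p ⊜ x :⊕ w) refl x w (point a))
    (triple-sum x∈ w∈ (point∈ (∈F⇒≢0 x∈)))

  D-subgroup : ∀ {a} → a ≢ 0v r → Subgroup (D a)
  D-subgroup {a} a≢0 = subgroup (subst (_∈ F a) (sym (⊕-idʳ (point a))) p) λ {x} {y} x∈ y∈ →
    subst (_∈ F a) (solveᵥ 3 (λ x y p → ((p :⊕ x) :⊕ (p :⊕ y)) :⊕ p ⊜ p :⊕ (x :⊕ y)) refl x y (point a)) (triple-sum x∈ y∈ p)
    where p = point∈ a≢0

  -- Apply claw-freeness to x and x ⊕ w over a and z over b. The first two add up to a vector over
  -- zero, and the sum of all three is z ⊕ w over b, which is not in `F b` because w is not in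
  -- `D b`. Only the two sums over c remain.
  clawRule : ∀ {a b c w x z} → Triple a b c → w ∈ D a → w ∉ D b → x ∈ F a → z ∈ F b →
    (x ⊕ z) ∈ F c ⊎ ((x ⊕ z) ⊕ w) ∈ F c
  clawRule {a} {b} {c} {w} {x} {z} t@(triple a≢0 b≢0 c≢0 refl) w∈ w∉ x∈ z∈
    with (x ⊕ z) ∈? F c | ((x ⊕ z) ⊕ w) ∈? F c
  ... | yes p | _ = inj₁ p
  ... | no _ | yes p = inj₂ p
  ... | no ¬p | no ¬q = ⊥-elim (clawFree x∈ (D-translate x∈ w∈) z∈
    (subst (λ b → (x ⊕ (x ⊕ w)) ∉ F b) (sym (⊕-self a)) (F-0 _)) ¬p
    (subst (_∉ F c) (solveᵥ 3 (λ x w z → (x :⊕ z) :⊕ w ⊜ (x :⊕ w) :⊕ z) refl x w z) ¬q)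
    (λ s∈ → w∉ (subst (_∈ D b) (solveᵥ 3 (λ x w z → ((x :⊕ (x :⊕ w)) :⊕ z) :⊕ z ⊜ w) refl x w z)
      (∈D (subst (λ b → ((x ⊕ (x ⊕ w)) ⊕ z) ∈ F b) (trans (⊕-assoc a a b) (⊕-cancelˡ a b)) s∈) z∈)))
    (λ { (_ , e) → w∉ (subst (_∈ D b) (trans (sym (⊕-self x)) (trans (cong (x ⊕_) e) (⊕-cancelˡ x w))) (Subgroup.0∈ (D-subgroup b≢0))) })
    (Triple.a≢b t ∘ proj₁) (Triple.a≢b t ∘ proj₁))

  -- `clawRule` is used for the two chosen points and once more after one of them is moved by s; the
  -- two points found over c differ by s or by s ⊕ w.
  rule : ∀ {a b c} → Triple a b c → Rule (D a) (D b) (D c)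
  rule {a} {b} {c} t {w} {s} w∈ w∉ s∈ = difference (clawRule t w∈ w∉ pa pb) (shifted s∈)
    where
    p = point a ⊕ point b
    pa = point∈ (Triple.a≢0 t)
    pb = point∈ (Triple.b≢0 t)
    shifted : s ∈ D a ⊎ s ∈ D b → (p ⊕ s) ∈ F c ⊎ ((p ⊕ s) ⊕ w) ∈ F c
    shifted (inj₁ s∈) = subst (λ q → q ∈ F c ⊎ (q ⊕ w) ∈ F c)
      (solveᵥ 3 (λ x z s → (x :⊕ s) :⊕ z ⊜ (x :⊕ z) :⊕ s) refl (point a) (point b) s)
      (clawRule t w∈ w∉ (D-translate pa s∈) pb)
    shifted (inj₂ s∈) = subst (λ q → q ∈ F c ⊎ (q ⊕ w) ∈ F c) (sym (⊕-assoc (point a) (point b) s))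
      (clawRule t w∈ w∉ pa (D-translate pb s∈))
    difference : p ∈ F c ⊎ (p ⊕ w) ∈ F c → (p ⊕ s) ∈ F c ⊎ ((p ⊕ s) ⊕ w) ∈ F c → s ∈ D c ⊎ (s ⊕ w) ∈ D c
    difference (inj₁ u) (inj₁ v) = inj₁ (subst (_∈ D c) (⊕-cancelˡ p s) (∈D u v))
    difference (inj₁ u) (inj₂ v) = inj₂ (subst (_∈ D c) (solveᵥ 3 (λ p s w → p :⊕ ((p :⊕ s) :⊕ w) ⊜ s :⊕ w) refl p s w) (∈D u v))
    difference (inj₂ u) (inj₁ v) = inj₂ (subst (_∈ D c) (solveᵥ 3 (λ p s w → (p :⊕ w) :⊕ (p :⊕ s) ⊜ s :⊕ w) refl p s w) (∈D u v))
    difference (inj₂ u) (inj₂ v) = inj₁ (subst (_∈ D c) (solveᵥ 3 (λ p s w → (p :⊕ w) :⊕ ((p :⊕ s) :⊕ w) ⊜ s) refl p s w) (∈D u v))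

  D-line : ∀ {a b c} → Triple a b c → Line (D a) (D b) (D c)
  D-line t = line (D-subgroup (Triple.a≢0 t)) (D-subgroup (Triple.b≢0 t)) (D-subgroup (Triple.c≢0 t))
    (rule t) (rule (swap (rotate (rotate t)))) (rule (swap t)) (rule (swap (rotate t)))

  Meet : V r → V r → V r → Set
  Meet a b c = ∃ λ x → ∃ λ y → x ∈ F a × y ∈ F b × (x ⊕ y) ∈ F c

  -- If the directions differ, `clawRule` yields the points. If all equal `D a`, the fibres are
  -- cosets of it. Were the sum s of their chosen points outside `D a`, a form killing `D a` but not
  -- s would be constant on each fibre and separate them.
  meet : ∀ {a b c} → Triple a b c → Meet a b c
  meet {a} {b} {c} t@(triple a≢0 b≢0 c≢0 eq) = byComparison (compare (D a) (D b) (D c))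
    where
    x₀ = point a
    y₀ = point b
    z₀ = point c
    x₀∈ = point∈ a≢0
    y₀∈ = point∈ b≢0
    z₀∈ = point∈ c≢0

    viaAB : ∀ {w} → w ∈ D a → (x₀ ⊕ y₀) ∈ F c ⊎ ((x₀ ⊕ y₀) ⊕ w) ∈ F c → Meet a b c
    viaAB _ (inj₁ p) = x₀ , y₀ , x₀∈ , y₀∈ , p
    viaAB {w} w∈ (inj₂ p) = x₀ ⊕ w , y₀ , D-translate x₀∈ w∈ , y₀∈ ,
      subst (_∈ F c) (solveᵥ 3 (λ x z w → (x :⊕ z) :⊕ w ⊜ (x :⊕ w) :⊕ z) refl x₀ y₀ w) p

    viaBA : ∀ {w} → w ∈ D b → (y₀ ⊕ x₀) ∈ F c ⊎ ((y₀ ⊕ x₀) ⊕ w) ∈ F c → Meet a b c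
    viaBA _ (inj₁ p) = x₀ , y₀ , x₀∈ , y₀∈ , subst (_∈ F c) (⊕-comm y₀ x₀) p
    viaBA {w} w∈ (inj₂ p) = x₀ , y₀ ⊕ w , x₀∈ , D-translate y₀∈ w∈ ,
      subst (_∈ F c) (solveᵥ 3 (λ x z w → (z :⊕ x) :⊕ w ⊜ x :⊕ (z :⊕ w)) refl x₀ y₀ w) p

    viaAC : ∀ {w} → w ∈ D a → (x₀ ⊕ z₀) ∈ F b ⊎ ((x₀ ⊕ z₀) ⊕ w) ∈ F b → Meet a b c
    viaAC _ (inj₁ p) = x₀ , x₀ ⊕ z₀ , x₀∈ , p , subst (_∈ F c) (sym (⊕-cancelˡ x₀ z₀)) z₀∈
    viaAC {w} w∈ (inj₂ p) = x₀ ⊕ w , (x₀ ⊕ z₀) ⊕ w , D-translate x₀∈ w∈ , p ,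
      subst (_∈ F c) (solveᵥ 3 (λ x z w → z ⊜ (x :⊕ w) :⊕ ((x :⊕ z) :⊕ w)) refl x₀ z₀ w) z₀∈

    viaCA : ∀ {w} → w ∈ D c → (z₀ ⊕ x₀) ∈ F b ⊎ ((z₀ ⊕ x₀) ⊕ w) ∈ F b → Meet a b c
    viaCA _ (inj₁ p) = x₀ , z₀ ⊕ x₀ , x₀∈ , p , subst (_∈ F c) (solveᵥ 2 (λ x z → z ⊜ x :⊕ (z :⊕ x)) refl x₀ z₀) z₀∈
    viaCA {w} w∈ (inj₂ p) = x₀ , (z₀ ⊕ x₀) ⊕ w , x₀∈ , p ,
      subst (_∈ F c) (solveᵥ 3 (λ x z w → z :⊕ w ⊜ x :⊕ ((z :⊕ x) :⊕ w)) refl x₀ z₀ w) (D-translate z₀∈ w∈)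

    s : V m
    s = (x₀ ⊕ y₀) ⊕ z₀

    module _ {l} (kill : ∀ x → x ∈ D a → dot l x ≡ false) where

      constant-dot : ∀ {b} → D b ⊆ D a → b ≢ 0v r → ∀ x → x ∈ F b → dot l x ≡ dot l (point b)
      constant-dot {b} h b≢0 x x∈ = xor-cancel (trans (sym (dot-⊕ l x (point b))) (kill _ (h (∈D x∈ (point∈ b≢0)))))
        where
        xor-cancel : ∀ {a b} → a xor b ≡ false → a ≡ b
        xor-cancel {false} {false} _ = refl
        xor-cancel {true} {true} _ = refl

      unseparated : D b ⊆ D a → D c ⊆ D a → dot l s ≢ true
      unseparated b⊆a c⊆a hit = inseparable a≢0 b≢0 c≢0 eq l (dot l x₀) (dot l y₀)
          (constant-dot {a} (λ x∈ → x∈) a≢0) (constant-dot b⊆a b≢0) (λ x x∈ → trans (constant-dot c⊆a c≢0 x x∈) sum≡1)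
        where
        xor-not : ∀ {a b} → a xor b ≡ true → b ≡ not a
        xor-not {false} p = p
        xor-not {true} {false} _ = refl
        sum≡1 : dot l z₀ ≡ not (dot l x₀ xor dot l y₀)
        sum≡1 = xor-not (trans (sym (trans (dot-⊕ l (x₀ ⊕ y₀) z₀) (cong (_xor dot l z₀) (dot-⊕ l x₀ y₀)))) hit)

    whenEqual : D b ⊆ D a → D c ⊆ D a → D a ⊆ D c → Dec (s ∈ D a) → Meet a b c
    whenEqual _ _ a⊆c (yes s∈) = x₀ , y₀ , x₀∈ , y₀∈ ,
      subst (_∈ F c) (solveᵥ 3 (λ x y z → z :⊕ ((x :⊕ y) :⊕ z) ⊜ x :⊕ y) refl x₀ y₀ z₀) (D-translate z₀∈ (a⊆c s∈))
    whenEqual b⊆a c⊆a _ (no s∉) = let l , kill , hit = separation (_∈? D a) (Subgroup.isSg (D-subgroup a≢0)) s s∉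
      in ⊥-elim (unseparated {l} kill b⊆a c⊆a hit)

    byComparison : Comparison (D a) (D b) (D c) → Meet a b c
    byComparison (A⊈B w∈ w∉) = viaAB w∈ (clawRule t w∈ w∉ x₀∈ y₀∈)
    byComparison (B⊈A w∈ w∉) = viaBA w∈ (clawRule (swap t) w∈ w∉ y₀∈ x₀∈)
    byComparison (A⊈C w∈ w∉) = viaAC w∈ (clawRule (swap (rotate (rotate t))) w∈ w∉ x₀∈ z₀∈)
    byComparison (C⊈A w∈ w∉) = viaCA w∈ (clawRule (rotate (rotate t)) w∈ w∉ z₀∈ x₀∈)
    byComparison (A≗B≗C a⊆b b⊆a a⊆c c⊆a) = whenEqual b⊆a c⊆a a⊆c (s ∈? D a)

  -- The points given by `meet` can be moved to any x and y, since `D c` absorbs both differences.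
  meet-⊆ : ∀ {a b c x y} → Triple a b c → D a ⊆ D c → D b ⊆ D c → x ∈ F a → y ∈ F b → (x ⊕ y) ∈ F c
  meet-⊆ {c = c} {x} {y} t a⊆c b⊆c x∈ y∈ with meet t
  ... | x₀ , y₀ , x₀∈ , y₀∈ , s∈ = subst (_∈ F c)
    (solveᵥ 4 (λ x y x₀ y₀ → ((x₀ :⊕ y₀) :⊕ (x₀ :⊕ x)) :⊕ (y₀ :⊕ y) ⊜ x :⊕ y) refl x y x₀ y₀)
    (D-translate (D-translate s∈ (a⊆c (∈D x₀∈ x∈))) (b⊆c (∈D y₀∈ y∈)))

  -- A flat of the matroid inside its ground set, in coordinates of quotient and W. It meets W
  -- trivially because the fibre over zero is empty, so `as` is independent.
  IsClique : ∀ {k} → Vec (V r) k → Vec (V m) k → Set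
  IsClique as xs = ∀ v → v ≢ 0v _ → lin xs v ∈ F (lin as v)

  CliquesAtMost : ℕ → Set
  CliquesAtMost k = ∀ j (as : Vec (V r) j) (xs : Vec (V m) j) → IsClique as xs → j ≤ k

  -- Modulo a subgroup containing all directions over the flat, each fibre is a single class, and by
  -- `meet` these classes add up along lines. So choosing points on a basis determines every class.
  section : ∀ {k} {P : Subset m} → Subgroup P → (as : Vec (V r) k) → Independent as →
    (∀ v → v ≢ 0v k → D (lin as v) ⊆ P) → ∀ v → v ≢ 0v k → ∀ {x} → x ∈ F (lin as v) → (x ⊕ lin (map point as) v) ∈ P
  section sg [] ind h [] v≢0 = ⊥-elim (v≢0 refl)
  section {P = P} sg (a ∷ as) ind h (false ∷ v) v≢0 {x} x∈ = subst (λ y → (x ⊕ y) ∈ P) (sym (lin-0∷ (point a) (map point as) v))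
    (section sg as (tail-Independent a as ind) (λ u u≢0 → subst (λ b → D b ⊆ P) (lin-0∷ a as u) (h (false ∷ u) λ { refl → u≢0 refl }))
      v (λ { refl → v≢0 refl }) (subst (λ b → x ∈ F b) (lin-0∷ a as v) x∈))
  section {k = suc k} {P = P} sg (a ∷ as) ind h (true ∷ v) v≢0 {x} x∈ with v ≟ᵥ 0v _
  ... | yes refl = subst (λ y → (x ⊕ y) ∈ P) (sym (lin-1∷0 (point a) (map point as)))
      (a⊆P (∈D x∈′ (point∈ (∈F⇒≢0 x∈′))))
    where
    x∈′ = subst (λ b → x ∈ F b) (lin-1∷0 a as) x∈
    a⊆P : D a ⊆ P
    a⊆P = subst (λ b → D b ⊆ P) (lin-1∷0 a as) (h (true ∷ 0v _) v≢0)
  ... | no u≢0 with meet t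
    where
    a≢0 : a ≢ 0v r
    a≢0 p = ind (true ∷ 0v _) (λ ()) (trans (lin-1∷0 a as) p)
    t : Triple a (lin as v) (lin (a ∷ as) (true ∷ v))
    t = triple a≢0 (tail-Independent a as ind v u≢0) (ind (true ∷ v) (λ ())) refl
  ...   | x₁ , x₂ , x₁∈ , x₂∈ , s∈ = subst (_∈ P)
      (solveᵥ 5 (λ x x₁ x₂ p q → (x :⊕ (x₁ :⊕ x₂)) :⊕ ((x₁ :⊕ p) :⊕ (x₂ :⊕ q)) ⊜ x :⊕ (p :⊕ q)) refl x x₁ x₂ (point a) (lin (map point as) v))
      (⊕∈ (h (true ∷ v) (λ ()) (∈D x∈ s∈)) (⊕∈ (a⊆P (∈D x₁∈ (point∈ (∈F⇒≢0 x₁∈)))) tail∈))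
    where
    open Subgroup sg
    a⊆P : D a ⊆ P
    a⊆P = subst (λ b → D b ⊆ P) (lin-1∷0 a as) (h (true ∷ 0v _) λ ())
    tail∈ : (x₂ ⊕ lin (map point as) v) ∈ P
    tail∈ = section sg as (tail-Independent a as ind) (λ u u≢0 → subst (λ b → D b ⊆ P) (lin-0∷ a as u) (h (false ∷ u) λ { refl → u≢0 refl })) v u≢0 x₂∈

  -- When all directions equal `P`, lying in the right class modulo `P` is lying in the fibre.
  constant⇒clique : ∀ {k} {P : Subset m} → Subgroup P → (as : Vec (V r) k) → Independent as →
    (∀ v → v ≢ 0v k → D (lin as v) ⊆ P) → (∀ v → v ≢ 0v k → P ⊆ D (lin as v)) → IsClique as (map point as)
  constant⇒clique sg as ind h h′ v v≢0 = subst (_∈ F (lin as v)) (⊕-cancelˡ (point (lin as v)) _)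
    (D-translate p∈ (h′ v v≢0 (section sg as ind h v v≢0 p∈)))
    where p∈ = point∈ (ind v v≢0)

  count-D : V r → ℕ
  count-D a = count (D a)

-- Restriction to a flat of the quotient

restrict : ∀ {r m k} → Config r m → (cs : Vec (V r) k) → Independent cs → Config k m
restrict {r} {m} {k} C cs ind = record
  { F = λ a → F (lin cs a)
  ; F-0 = λ x → subst (λ a → x ∉ F a) (sym (lin-0 cs)) (F-0 x)
  ; inhabited = λ a a≢0 → inhabited (lin cs a) (ind a a≢0)
  ; clawFree = λ {a} {b} {c} x∈ y∈ z∈ h₁ h₂ h₃ h₄ n₁ n₂ n₃ → clawFree x∈ y∈ z∈
      (subst (λ d → _ ∉ F d) (lin-⊕ cs a b) h₁) (subst (λ d → _ ∉ F d) (lin-⊕ cs a c) h₂)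
      (subst (λ d → _ ∉ F d) (lin-⊕ cs b c) h₃)
      (subst (λ d → _ ∉ F d) (trans (lin-⊕ cs (a ⊕ b) c) (cong (_⊕ lin cs c) (lin-⊕ cs a b))) h₄)
      (λ { (p , q) → n₁ (inj p , q) }) (λ { (p , q) → n₂ (inj p , q) }) (λ { (p , q) → n₃ (inj p , q) })
  ; inseparable = λ {a} {b} a≢0 b≢0 c≢0 e → inseparable (ind _ a≢0) (ind _ b≢0) (ind _ c≢0)
      (trans (sym (lin-⊕ cs a b)) (cong (lin cs) e)) }
  where
  open Config C
  inj : ∀ {x y} → lin cs x ≡ lin cs y → x ≡ y
  inj = Independent⇒Injective cs ind _ _

module _ {r m k} (C : Config r m) (cs : Vec (V r) k) (ind : Independent cs) where
  private
    module C = Fibres C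
    module R = Fibres (restrict C cs ind)

  restrict-clique : ∀ {j} (as : Vec (V k) j) (xs : Vec (V m) j) → R.IsClique as xs → C.IsClique (map (lin cs) as) xs
  restrict-clique as xs h v v≢0 = subst (λ a → lin xs v ∈ C.F a) (sym (lin-map cs as v)) (h v v≢0)

  -- The two configurations may choose different points in the same fibre, but the directions are
  -- the same.
  restrict-count : ∀ a → a ≢ 0v k → R.count-D a ≡ C.count-D (lin cs a)
  restrict-count a a≢0 = ℕₚ.≤-antisym (count-mono (R.D a) (C.D (lin cs a)) there) (count-mono (C.D (lin cs a)) (R.D a) back)
    where
    p∈ = C.point∈ (ind a a≢0)
    q∈ = R.point∈ a≢0
    there : R.D a ⊆ C.D (lin cs a)
    there {x} x∈ = subst (_∈ C.D (lin cs a)) (⊕-cancelˡ (R.point a) x) (C.∈D q∈ x∈)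
    back : C.D (lin cs a) ⊆ R.D a
    back {x} x∈ = subst (_∈ R.D a) (⊕-cancelˡ (C.point (lin cs a)) x) (R.∈D {a} p∈ x∈)

module _ {r m} (C : Config r m) where
  open Fibres C

  -- Of the three line types, `upper` would make `D f` no larger than `D a`, and `pencil` would give
  -- `D e` and `D a` equal sizes.
  larger⇒⊆ : ∀ {a e f} → Triple e a f → count-D a < count-D e → count-D a < count-D f → D e ⊆ D f × D a ⊆ D f
  larger⇒⊆ {a} {e} {f} t a<e a<f = let _ , w∈ , w∉ = smaller⇒witness (D a) (D e) a<e in byType (lineType (D-line t) w∈ w∉)
    where
    byType : LineType (D e) (D a) (D f) → D e ⊆ D f × D a ⊆ D f
    byType (lower e⊆f f⊆e a⊆e) = e⊆f , λ x∈ → e⊆f (a⊆e x∈)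
    byType (upper _ f⊆a _ _) = ⊥-elim (ℕₚ.<⇒≱ a<f (count-mono (D f) (D a) f⊆a))
    byType (pencil p) = ⊥-elim (ℕₚ.<⇒≢ a<e (sym (Pencil.countXY p)))

  double-bound : ∀ {a e f} → Triple a e f → count-D e ≤ 2 * count-D a → count-D f ≤ 2 * count-D a
  double-bound {a} {e} {f} t le = bySize (⊆-or-witness (D f) (D a))
    where
    byType : LineType (D f) (D a) (D e) → count-D f ≤ 2 * count-D a
    byType (lower f⊆e _ _) = ℕₚ.≤-trans (count-mono (D f) (D e) f⊆e) le
    byType (upper _ _ _ two) = atMostTwo⇒count≤ (D a) (D f) (D-subgroup (Triple.a≢0 t)) two
    byType (pencil p) = ℕₚ.≤-trans (ℕₚ.≤-reflexive (Pencil.countXY p)) (ℕₚ.m≤m+n (count-D a) _)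
    bySize : D f ⊆ D a ⊎ (∃ λ w → w ∈ D f × w ∉ D a) → count-D f ≤ 2 * count-D a
    bySize (inj₁ f⊆a) = ℕₚ.≤-trans (count-mono (D f) (D a) f⊆a) (ℕₚ.m≤m+n (count-D a) _)
    bySize (inj₂ (_ , w∈ , w∉)) = byType (lineType (D-line (rotate (rotate t))) w∈ w∉)

  -- Adding basis vectors one at a time does not accumulate factors: each step compares with the
  -- newly added vector, whose direction has size s.
  span-double-bound : ∀ {s k} (vs : Vec (V r) k) → Independent vs → All (λ v → count-D v ≡ s) vs →
    ∀ v → v ≢ 0v k → count-D (lin vs v) ≤ 2 * s
  span-double-bound [] ind All.[] [] v≢0 = ⊥-elim (v≢0 refl)
  span-double-bound {s} (a ∷ vs) ind (p All.∷ ps) (false ∷ v) v≢0 = subst (λ b → count-D b ≤ 2 * s) (sym (lin-0∷ a vs v))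
    (span-double-bound vs (tail-Independent a vs ind) ps v λ { refl → v≢0 refl })
  span-double-bound {s} (a ∷ vs) ind (refl All.∷ ps) (true ∷ v) v≢0 with v ≟ᵥ 0v _
  ... | yes refl = subst (λ b → count-D b ≤ 2 * s) (sym (lin-1∷0 a vs)) (ℕₚ.m≤m+n s _)
  ... | no u≢0 = double-bound (triple a≢0 (tail-Independent a vs ind v u≢0) (ind (true ∷ v) λ ()) refl)
      (span-double-bound vs (tail-Independent a vs ind) ps v u≢0)
    where
    a≢0 : a ≢ 0v r
    a≢0 q = ind (true ∷ 0v _) (λ ()) (trans (lin-1∷0 a vs) q)

0v-++ : ∀ i j → 0v i ++ 0v j ≡ 0v (i + j)
0v-++ zero j = refl
0v-++ (suc i) j = cong (false ∷_) (0v-++ i j)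

++≡0⇒ : ∀ {i j} (u : V i) (v : V j) → u ++ v ≡ 0v (i + j) → u ≡ 0v i × v ≡ 0v j
++≡0⇒ {i} {j} u v p = Vecₚ.++-injective u (0v i) (trans p (sym (0v-++ i j)))

Independent-++ˡ : ∀ {i j n} (us : Vec (V n) i) (vs : Vec (V n) j) → Independent (us ++ vs) → Independent us
Independent-++ˡ us vs ind u u≢0 p = ind (u ++ 0v _) (λ q → u≢0 (proj₁ (++≡0⇒ u (0v _) q)))
  (trans (lin-++ us vs u (0v _)) (trans (cong₂ _⊕_ p (lin-0 vs)) (⊕-self _)))

grow-independent : ∀ {n j} (vs : Vec (V n) j) → Independent vs →
  ∃ λ i → Σ (Vec (V n) i) λ us → Independent (us ++ vs) × Spans (us ++ vs)
grow-independent {n} {j} vs ind with grow (λ us → Independent (us ++ vs)) (λ us → independent? (us ++ vs)) ind (suc n)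
... | inj₁ (us , ind′) = ⊥-elim (ℕₚ.1+n≰n (ℕₚ.≤-trans (ℕₚ.m≤m+n (suc n) j) (independent⇒≤ (us ++ vs) ind′)))
... | inj₂ (i , _ , us , ind′ , max) = i , us , ind′ , λ x → dependent⇒∈span x (us ++ vs) ind′ (max x)

-- Splitting off the points of smallest direction

module _ {r m} (C : Config r m) where
  open Fibres C

  -- The vectors of vs have minimal D, and us completes their span: there every clique extends by such a vector.
  record Splitting (k : ℕ) : Set where
    field
      {i j} : ℕ
      us : Vec (V r) i
      vs : Vec (V r) j
      ind-us : Independent us
      ind-vs : Independent vs
      r≤i+j : r ≤ i + j
      fewer : Fibres.CliquesAtMost (restrict C us ind-us) k
      doubles : ∀ a b → a ≢ 0v j → b ≢ 0v j → Fibres.count-D (restrict C vs ind-vs) a ≤ 2 * Fibres.count-D (restrict C vs ind-vs) b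

  splitting : ∀ {k} → (∃ λ a → a ≢ 0v r) → CliquesAtMost (suc k) → Splitting k
  splitting {k} nontrivial atMost with minimiser (λ a → ¬? (a ≟ᵥ 0v r)) count-D nontrivial
  ... | a₀ , a₀≢0 , min with grow {r} (λ vs → Independent vs × All Minimal vs)
        (λ vs → independent? vs ×-dec All.all? (λ a → count-D a ℕₚ.≟ count-D a₀) vs) ((λ { [] v≢0 → ⊥-elim (v≢0 refl) }) , All.[]) (suc r)
    where
    Minimal : V r → Set
    Minimal a = count-D a ≡ count-D a₀
  ...   | inj₁ (vs , ind , _) = ⊥-elim (ℕₚ.1+n≰n (independent⇒≤ vs ind))
  ...   | inj₂ (j , _ , vs , (ind , allMin) , max) with grow-independent vs ind
  ...     | i , us , ind++ , spans = record
    { us = us ; vs = vs ; ind-us = ind-us ; ind-vs = ind ; r≤i+j = spans⇒≤ (us ++ vs) spans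
    ; fewer = fewer ; doubles = doubles }
    where
    ind-us : Independent us
    ind-us = Independent-++ˡ us vs ind++

    min∈span : ∀ {c} → c ≢ 0v r → count-D c ≤ count-D a₀ → ∃ λ v → lin vs v ≡ c
    min∈span {c} c≢0 le = dependent⇒∈span c vs ind λ ind′ → max c (ind′ , ℕₚ.≤-antisym le (min c c≢0) All.∷ allMin)

    outside : ∀ u → u ≢ 0v i → ¬ ∃ λ v → lin vs v ≡ lin us u
    outside u u≢0 (v , p) = ind++ (u ++ v) (λ q → u≢0 (proj₁ (++≡0⇒ u v q)))
      (trans (lin-++ us vs u v) (trans (cong (lin us u ⊕_) p) (⊕-self _)))

    outside-large : ∀ {e} → e ≢ 0v r → (¬ ∃ λ v → lin vs v ≡ e) → count-D a₀ < count-D e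
    outside-large e≢0 out = ℕₚ.≰⇒> λ le → out (min∈span e≢0 le)

    a₀∈span : ∃ λ v → lin vs v ≡ a₀
    a₀∈span = min∈span a₀≢0 ℕₚ.≤-refl

    fewer : Fibres.CliquesAtMost (restrict C us ind-us) k
    fewer l as xs clique = ℕₚ.≤-pred (atMost (suc l) (a₀ ∷ map (lin us) as) (point a₀ ∷ xs) extended)
      where
      extended : IsClique (a₀ ∷ map (lin us) as) (point a₀ ∷ xs)
      extended (false ∷ v) v≢0 = subst₂ (λ a x → x ∈ F a) (sym (lin-0∷ a₀ (map (lin us) as) v)) (sym (lin-0∷ (point a₀) xs v))
        (restrict-clique C us ind-us as xs clique v λ { refl → v≢0 refl })
      extended (true ∷ v) v≢0 with v ≟ᵥ 0v l
      ... | yes refl = subst₂ (λ a x → x ∈ F a) (sym (lin-1∷0 a₀ (map (lin us) as))) (sym (lin-1∷0 (point a₀) xs)) (point∈ a₀≢0)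
      ... | no u≢0 = meet-⊆ t (proj₂ sub) (proj₁ sub) (point∈ a₀≢0) (restrict-clique C us ind-us as xs clique v u≢0)
        where
        e = lin (map (lin us) as) v
        e≢0 : e ≢ 0v r
        e≢0 = ∈F⇒≢0 (restrict-clique C us ind-us as xs clique v u≢0)
        q = lin as v
        e≡ : e ≡ lin us q
        e≡ = lin-map us as v
        q≢0 : q ≢ 0v i
        q≢0 p = e≢0 (trans e≡ (trans (cong (lin us) p) (lin-0 us)))
        out : ¬ ∃ λ v → lin vs v ≡ e
        out (v , p) = outside q q≢0 (v , trans p e≡)
        out′ : ¬ ∃ λ v → lin vs v ≡ a₀ ⊕ e
        out′ (v , p) = out (v ⊕ proj₁ a₀∈span , trans (lin-⊕ vs v _) (trans (cong₂ _⊕_ p (proj₂ a₀∈span))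
          (solveᵥ 2 (λ a e → (a :⊕ e) :⊕ a ⊜ e) refl a₀ e)))
        a₀⊕e≢0 : a₀ ⊕ e ≢ 0v r
        a₀⊕e≢0 p = out (proj₁ a₀∈span , trans (proj₂ a₀∈span) (⊕≡0⇒≡ p))
        t : Triple a₀ e (a₀ ⊕ e)
        t = triple a₀≢0 e≢0 a₀⊕e≢0 refl
        sub : D e ⊆ D (a₀ ⊕ e) × D a₀ ⊆ D (a₀ ⊕ e)
        -- Both e and a₀ ⊕ e lie outside the span of `vs`, which contains every point of smallest
        -- direction.
        sub = larger⇒⊆ C (swap t) (outside-large e≢0 out) (outside-large a₀⊕e≢0 out′)

    doubles : ∀ a b → a ≢ 0v j → b ≢ 0v j → Fibres.count-D (restrict C vs ind) a ≤ 2 * Fibres.count-D (restrict C vs ind) b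
    doubles a b a≢0 b≢0 = subst₂ (λ x y → x ≤ 2 * y) (sym (restrict-count C vs ind a a≢0)) (sym (restrict-count C vs ind b b≢0))
      (ℕₚ.≤-trans (span-double-bound C vs ind allMin a a≢0) (ℕₚ.*-monoʳ-≤ 2 (min (lin vs b) (ind b b≢0))))

-- A common subgroup or a common overgroup

module _ {r m} (C : Config r m) where
  open Fibres C

  record LowerBound : Set where
    field
      base : Subset m
      sg : Subgroup base
      base⊆ : ∀ {c} → c ≢ 0v r → base ⊆ D c
      two : ∀ {c} → c ≢ 0v r → AtMostTwoCosets base (D c)

  record UpperBound : Set where
    field
      top : Subset m
      sg : Subgroup top
      ⊆top : ∀ {c} → c ≢ 0v r → D c ⊆ top
      two : ∀ {c} → c ≢ 0v r → AtMostTwoCosets (D c) top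

  -- Let A be a direction of smallest size. If no other subgroup of that size occurs, A lies in
  -- every direction. If another one occurs, either some direction is strictly larger and contains
  -- all the others, or all sizes agree.
  classify : (∃ λ a → a ≢ 0v r) → (∀ a b → a ≢ 0v r → b ≢ 0v r → count-D a ≤ 2 * count-D b) → LowerBound ⊎ UpperBound
  classify nontrivial doubles with minimiser (λ a → ¬? (a ≟ᵥ 0v r)) count-D nontrivial
  ... | a₀ , a₀≢0 , min = byMinimal (any? λ c → ¬? (c ≟ᵥ 0v r) ×-dec ((count-D c ℕₚ.≤? count-D a₀) ×-dec any? λ w → (w ∈? D c) ×-dec ¬? (w ∈? D a₀)))
    where
    s = count-D a₀
    A = D a₀
    sgA = D-subgroup a₀≢0

    min⊆larger : ∀ {a c} → a ≢ 0v r → c ≢ 0v r → count-D a ≤ s → s < count-D c → D a ⊆ D c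
    min⊆larger {a} {c} a≢0 c≢0 a≤ s< = let _ , w∈ , w∉ = smaller⇒witness (D a) (D c) (ℕₚ.≤-<-trans a≤ s<)
      in byType (lineType (D-line (toTriple c≢0 a≢0 (λ { refl → w∉ w∈ }))) w∈ w∉)
      where
      byType : ∀ {Z} → LineType (D c) (D a) Z → D a ⊆ D c
      byType (lower _ _ h) = h
      byType (upper _ _ h _) = h
      byType (pencil p) = ⊥-elim (ℕₚ.<⇒≢ (ℕₚ.≤-<-trans a≤ s<) (sym (Pencil.countXY p)))

    min-pencil : ∀ {a b w} → a ≢ 0v r → b ≢ 0v r → count-D a ≤ s → w ∈ D a → w ∉ D b → Pencil (D a) (D b) (D (a ⊕ b))
    min-pencil {a} {b} {w} a≢0 b≢0 a≤ w∈ w∉ = byType (lineType (D-line (toTriple a≢0 b≢0 (λ { refl → w∉ w∈ }))) w∈ w∉)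
      where
      ⊉ : ¬ D b ⊆ D a
      ⊉ h = ℕₚ.<⇒≱ (count-strict (D b) (D a) h w w∈ w∉) (ℕₚ.≤-trans a≤ (min b b≢0))
      byType : LineType (D a) (D b) (D (a ⊕ b)) → Pencil (D a) (D b) (D (a ⊕ b))
      byType (pencil p) = p
      byType (lower _ _ h) = ⊥-elim (⊉ h)
      byType (upper _ _ h _) = ⊥-elim (⊉ h)

    -- Distinct directions now meet in index two, so they form a clique in a Grassmann graph. Such a
    -- clique either lies inside A + B or has A ∩ B as common subgroup.
    module AllMinimal (all≤ : ∀ {c} → c ≢ 0v r → count-D c ≤ s) {c₁ w₁} (c₁≢0 : c₁ ≢ 0v r) (w₁∈ : w₁ ∈ D c₁) (w₁∉ : w₁ ∉ A) where
      B = D c₁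
      sgB = D-subgroup c₁≢0
      P = A ⊹ w₁
      sgP : Subgroup P
      sgP = ⊹-subgroup w₁ sgA

      two-D : ∀ {a b} → a ≢ 0v r → b ≢ 0v r → AtMostTwoCosets (D b) (D a)
      two-D a≢0 b≢0 x∈ x∉ = Pencil.twoXY (min-pencil a≢0 b≢0 (all≤ a≢0) x∈ x∉) x∈ x∉

      B⊆P : B ⊆ P
      B⊆P = ⊆-⊹ A B w₁ (two-D c₁≢0 a₀≢0) w₁∈ w₁∉

      module Outside {e v} (e≢0 : e ≢ 0v r) (v∈ : v ∈ D e) (v∉ : v ∉ P) where

        w₀ : ∃ λ w → w ∈ A × w ∉ B
        w₀ with ⊆-or-witness A B
        ... | inj₁ h = ⊥-elim (w₁∉ (⊆∧≥⇒⊇ A B h (all≤ c₁≢0) w₁∈))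
        ... | inj₂ w = w

        -- An element x of A and `D g` outside B would put x ⊕ v into B, hence v into `P`. So A ∩
        -- `D g` lies in B; having index at most two in A, it must contain A ∩ B.
        base⊆outside : ∀ {g v} → g ≢ 0v r → v ∈ D g → v ∉ P → (A ∩ B) ⊆ D g
        base⊆outside {g} {v} g≢0 v∈ v∉ {z} z∈ with z ∈? D g
        ... | yes p = p
        ... | no z∉ = ⊥-elim (w₀∉B (Subgroup.cancelˡ sgB
            (g∩A⊆B (two-D a₀≢0 g≢0 z∈A z∉ w₀∈A (λ p → w₀∉B (g∩A⊆B p w₀∈A))) (Subgroup.⊕∈ sgA z∈A w₀∈A)) (∩-right A B z∈)))
          where
          w₀∈A = proj₁ (proj₂ w₀)
          w₀∉B = proj₂ (proj₂ w₀)
          z∈A = ∩-left A B z∈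
          g∩A⊆B : ∀ {x} → x ∈ D g → x ∈ A → x ∈ B
          g∩A⊆B {x} x∈g x∈A with x ∈? B
          ... | yes p = p
          ... | no x∉B = ⊥-elim (v∉ (Subgroup.cancelˡ sgP
              (B⊆P (two-D g≢0 c₁≢0 x∈g x∉B v∈ (λ p → v∉ (B⊆P p)))) (⊆⊹ {A = A} w₁ x∈A)))

        -- A direction inside `P` is compared with `D e`: if z in A ∩ B were missing from it, then z
        -- ⊕ v would belong to it, and v to `P`.
        base⊆all : ∀ {g} → g ≢ 0v r → (A ∩ B) ⊆ D g
        base⊆all {g} g≢0 {z} z∈ with ⊆-or-witness (D g) P
        ... | inj₂ (v′ , v′∈ , v′∉) = base⊆outside g≢0 v′∈ v′∉ z∈
        ... | inj₁ h with z ∈? D g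
        ...   | yes p = p
        ...   | no z∉ = ⊥-elim (v∉ (Subgroup.cancelˡ sgP (h (two-D e≢0 g≢0 (base⊆outside e≢0 v∈ v∉ z∈) z∉ v∈ (λ p → v∉ (h p))))
              (⊆⊹ {A = A} w₁ (∩-left A B z∈))))

        lowerBound : LowerBound
        lowerBound = record
          { base = A ∩ B ; sg = sg ; base⊆ = base⊆all
          ; two = λ {c} c≢0 → count≤⇒atMostTwo (A ∩ B) (D c) sg (D-subgroup c≢0) (base⊆all c≢0)
              (ℕₚ.≤-trans (all≤ c≢0) (ℕₚ.≤-reflexive
                (count-half B A (proj₁ w₀) sgB sgA (proj₁ (proj₂ w₀)) (proj₂ (proj₂ w₀)) (two-D a₀≢0 c₁≢0)))) }
          where
          sg = ∩-subgroup sgA sgB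

      classified : LowerBound ⊎ UpperBound
      classified with any? (λ e → ¬? (e ≟ᵥ 0v r) ×-dec any? λ v → (v ∈? D e) ×-dec ¬? (v ∈? P))
      ... | yes (e , e≢0 , v , v∈ , v∉) = inj₁ (Outside.lowerBound e≢0 v∈ v∉)
      ... | no none = inj₂ record
        { top = P ; sg = sgP ; ⊆top = ⊆P
        ; two = λ {c} c≢0 → count≤⇒atMostTwo (D c) P (D-subgroup c≢0) sgP (⊆P c≢0)
            (ℕₚ.≤-trans (ℕₚ.≤-reflexive (count-⊹ w₁ sgA w₁∉)) (ℕₚ.*-monoʳ-≤ 2 (min c c≢0))) }
        where
        ⊆P : ∀ {c} → c ≢ 0v r → D c ⊆ P
        ⊆P {c} c≢0 {x} x∈ with x ∈? P
        ... | yes p = p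
        ... | no x∉ = ⊥-elim (none (c , c≢0 , x , x∈ , x∉))

    byMinimal : Dec (∃ λ c → c ≢ 0v r × count-D c ≤ s × ∃ λ w → w ∈ D c × w ∉ A) → LowerBound ⊎ UpperBound
    byMinimal (no none) = inj₁ record
      { base = A ; sg = sgA ; base⊆ = base⊆
      ; two = λ {c} c≢0 → count≤⇒atMostTwo A (D c) sgA (D-subgroup c≢0) (base⊆ c≢0) (doubles c a₀ c≢0 a₀≢0) }
      where
      base⊆ : ∀ {c} → c ≢ 0v r → A ⊆ D c
      base⊆ {c} c≢0 with ℕₚ.<-≤-connex s (count-D c)
      ... | inj₁ s< = min⊆larger a₀≢0 c≢0 ℕₚ.≤-refl s<
      ... | inj₂ c≤ with ⊆-or-witness (D c) A
      ...   | inj₁ h = ⊆∧≥⇒⊇ (D c) A h (min c c≢0)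
      ...   | inj₂ w = ⊥-elim (none (c , c≢0 , c≤ , w))
    byMinimal (yes (c₁ , c₁≢0 , c₁≤ , w₁ , w₁∈ , w₁∉)) with any? (λ c → ¬? (c ≟ᵥ 0v r) ×-dec (suc s ℕₚ.≤? count-D c))
    ... | no none = AllMinimal.classified (λ {c} c≢0 → ℕₚ.≮⇒≥ λ s< → none (c , c≢0 , s<)) c₁≢0 w₁∈ w₁∉
    ... | yes (c , c≢0 , s<) = inj₂ record
      { top = D c ; sg = sgc ; ⊆top = ⊆top
      ; two = λ {e} e≢0 → count≤⇒atMostTwo (D e) (D c) (D-subgroup e≢0) sgc (⊆top e≢0) (doubles c e c≢0 e≢0) }
      where
      sgc = D-subgroup c≢0
      A⊆c : A ⊆ D c
      A⊆c = min⊆larger a₀≢0 c≢0 ℕₚ.≤-refl s<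
      ⊆top : ∀ {e} → e ≢ 0v r → D e ⊆ D c
      ⊆top {e} e≢0 {x} x∈ with ℕₚ.<-≤-connex s (count-D e)
      ... | inj₂ e≤ = min⊆larger e≢0 c≢0 e≤ s< x∈
      ... | inj₁ s<e with x ∈? A
      ...   | yes p = A⊆c p
      -- A has index at most two in `D e`, which also contains `w₁`. So x ⊕ w₁ is in A, and both A
      -- and `w₁` lie in `D c`.
      ...   | no x∉ = Subgroup.cancelʳ sgc (A⊆c (count≤⇒atMostTwo A (D e) sgA (D-subgroup e≢0)
                (min⊆larger a₀≢0 e≢0 ℕₚ.≤-refl s<e) (doubles e a₀ e≢0 a₀≢0) x∈ x∉
                (min⊆larger c₁≢0 e≢0 c₁≤ s<e w₁∈) w₁∉))
              (min⊆larger c₁≢0 c≢0 c₁≤ s< w₁∈)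

-- The labels will be vectors modulo a subgroup, or linear forms on a subgroup.
record Labels : Set₁ where
  infix 4 _≈_ _≉_
  infixl 6 _∔_
  field
    Label : Set
    _≈_ : Label → Label → Set
    _≈?_ : ∀ x y → Dec (x ≈ y)
    ≈-refl : ∀ {x} → x ≈ x
    ≈-sym : ∀ {x y} → x ≈ y → y ≈ x
    ≈-trans : ∀ {x y z} → x ≈ y → y ≈ z → x ≈ z
    _∔_ : Label → Label → Label
    0# : Label
    ∔-cong : ∀ {x y x′ y′} → x ≈ x′ → y ≈ y′ → x ∔ y ≈ x′ ∔ y′
    ∔-comm : ∀ x y → x ∔ y ≈ y ∔ x
    ∔-assoc : ∀ x y z → (x ∔ y) ∔ z ≈ x ∔ (y ∔ z)
    ∔-identityʳ : ∀ x → x ∔ 0# ≈ x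
    ∔-self : ∀ x → x ∔ x ≈ 0#

  _≉_ : Label → Label → Set
  x ≉ y = ¬ x ≈ y

  ∔-cancelʳ : ∀ x y → (x ∔ y) ∔ y ≈ x
  ∔-cancelʳ x y = ≈-trans (∔-assoc x y y) (≈-trans (∔-cong ≈-refl (∔-self y)) (∔-identityʳ x))

  ∔-cancelˡ : ∀ x y → (x ∔ y) ∔ x ≈ y
  ∔-cancelˡ x y = ≈-trans (∔-cong (∔-comm x y) ≈-refl) (∔-cancelʳ y x)

  ∔-identityˡ : ∀ x → 0# ∔ x ≈ x
  ∔-identityˡ x = ≈-trans (∔-comm 0# x) (∔-identityʳ x)

  ∔≈0⇒≈ : ∀ {x y} → x ∔ y ≈ 0# → x ≈ y
  ∔≈0⇒≈ {x} {y} p = ≈-trans (≈-sym (∔-cancelʳ x y)) (≈-trans (∔-cong p ≈-refl) (∔-identityˡ y))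

  ∔≈ʳ⇒≈0 : ∀ {x y} → x ∔ y ≈ y → x ≈ 0#
  ∔≈ʳ⇒≈0 {x} {y} p = ≈-trans (≈-sym (∔-cancelʳ x y)) (≈-trans (∔-cong p ≈-refl) (∔-self y))

  ∔≈ˡ⇒≈0 : ∀ {x y} → x ∔ y ≈ x → y ≈ 0#
  ∔≈ˡ⇒≈0 p = ∔≈ʳ⇒≈0 (≈-trans (∔-comm _ _) p)

-- Labels on the points of a projective space

module LabelledSpace (L : Labels) {r} (u : V r → Labels.Label L) where
  open Labels L

  -- The patterns that the line types leave. The last three name the only position whose label may
  -- be nonzero.
  data LineLabels (x y z : Label) : Set where
    additive : x ∔ y ≈ z → LineLabels x y z
    constant : x ≈ y → y ≈ z → LineLabels x y z
    onlyz : x ≈ 0# → y ≈ 0# → LineLabels x y z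
    onlyy : x ≈ 0# → z ≈ 0# → LineLabels x y z
    onlyx : y ≈ 0# → z ≈ 0# → LineLabels x y z

  LineLabels-swap : ∀ {x y z} → LineLabels x y z → LineLabels y x z
  LineLabels-swap (additive p) = additive (≈-trans (∔-comm _ _) p)
  LineLabels-swap (constant p q) = constant (≈-sym p) (≈-trans p q)
  LineLabels-swap (onlyz p q) = onlyz q p
  LineLabels-swap (onlyy p q) = onlyx p q
  LineLabels-swap (onlyx p q) = onlyy p q

  LineLabels-rotate : ∀ {x y z} → LineLabels x y z → LineLabels y z x
  LineLabels-rotate {x} {y} (additive p) = additive (≈-trans (∔-comm _ _) (≈-trans (∔-cong (≈-sym p) ≈-refl) (∔-cancelʳ x y)))
  LineLabels-rotate (constant p q) = constant q (≈-sym (≈-trans p q))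
  LineLabels-rotate (onlyz p q) = onlyy q p
  LineLabels-rotate (onlyy p q) = onlyx q p
  LineLabels-rotate (onlyx p q) = onlyz p q

  module _ (u-0 : u (0v r) ≈ 0#) (lines : ∀ {a b c} → Triple a b c → LineLabels (u a) (u b) (u c)) where

    reflexive : ∀ {a b} → a ≡ b → u a ≈ u b
    reflexive refl = ≈-refl

    line-labels : ∀ a b → LineLabels (u a) (u b) (u (a ⊕ b))
    line-labels a b with a ≟ᵥ 0v r | b ≟ᵥ 0v r | a ≟ᵥ b
    ... | yes refl | _ | _ = additive (≈-trans (∔-cong u-0 ≈-refl) (≈-trans (∔-identityˡ _) (reflexive (sym (⊕-idˡ b)))))
    ... | no _ | yes refl | _ = additive (≈-trans (∔-cong ≈-refl u-0) (≈-trans (∔-identityʳ _) (reflexive (sym (⊕-idʳ a)))))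
    ... | no _ | no _ | yes refl = additive (≈-trans (∔-self _) (≈-trans (≈-sym u-0) (reflexive (sym (⊕-self a)))))
    ... | no a≢0 | no b≢0 | no a≢b = lines (toTriple a≢0 b≢0 a≢b)

    module _ {y₁ y₂} (y₁≉0 : u y₁ ≉ 0#) (y₂≉0 : u y₂ ≉ 0#) (y₁≉y₂ : u y₁ ≉ u y₂) where

      other : ∀ x → ∃ λ y → u y ≉ 0# × u y ≉ x
      other x with u y₁ ≈? x
      ... | no p = y₁ , y₁≉0 , p
      ... | yes p = y₂ , y₂≉0 , λ q → y₁≉y₂ (≈-trans p (≈-sym q))

      additive-≉ : ∀ {a b} → u a ≉ 0# → u b ≉ 0# → u a ≉ u b → u (a ⊕ b) ≈ u a ∔ u b
      additive-≉ {a} {b} a≉0 b≉0 a≉b with line-labels a b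
      ... | additive p = ≈-sym p
      ... | constant p _ = ⊥-elim (a≉b p)
      ... | onlyz p _ = ⊥-elim (a≉0 p)
      ... | onlyy p _ = ⊥-elim (a≉0 p)
      ... | onlyx p _ = ⊥-elim (b≉0 p)

      -- Only a line with three equal labels stands in the way. With y of a further nonzero label,
      -- the label of a ⊕ b ⊕ y would then be both u a ∔ u y and u y, depending on the order of
      -- addition.
      additive-≈ : ∀ {a b} → u a ≉ 0# → u a ≈ u b → u (a ⊕ b) ≈ 0#
      additive-≈ {a} {b} a≉0 a≈b with line-labels a b
      ... | additive p = ≈-trans (≈-sym p) (≈-trans (∔-cong a≈b ≈-refl) (∔-self _))
      ... | onlyz p _ = ⊥-elim (a≉0 p)
      ... | onlyy p _ = ⊥-elim (a≉0 p)
      ... | onlyx p _ = ⊥-elim (a≉0 (≈-trans a≈b p))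
      ... | constant _ b≈ab with other (u a)
      ...   | y , y≉0 , y≉a = ⊥-elim (a≉0 (∔≈ʳ⇒≈0 (≈-trans (≈-sym viaSum) (≈-trans (reflexive (swap-last a b y)) viaY))))
        where
        swap-last : ∀ {n} (a b y : V n) → (a ⊕ b) ⊕ y ≡ (a ⊕ y) ⊕ b
        swap-last = solveᵥ 3 (λ a b y → (a :⊕ b) :⊕ y ⊜ (a :⊕ y) :⊕ b) refl
        ab≈a = ≈-sym (≈-trans a≈b b≈ab)
        ay = additive-≉ a≉0 y≉0 (λ p → y≉a (≈-sym p))
        viaSum : u ((a ⊕ b) ⊕ y) ≈ u a ∔ u y
        viaSum = ≈-trans (additive-≉ (λ p → a≉0 (≈-trans (≈-sym ab≈a) p)) y≉0 (λ p → y≉a (≈-trans (≈-sym p) ab≈a))) (∔-cong ab≈a ≈-refl)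
        viaY : u ((a ⊕ y) ⊕ b) ≈ u y
        viaY = ≈-trans (additive-≉ (λ p → y≉a (≈-sym (∔≈0⇒≈ (≈-trans (≈-sym ay) p)))) (λ p → a≉0 (≈-trans a≈b p))
            (λ p → y≉0 (∔≈ˡ⇒≈0 (≈-trans (≈-sym ay) (≈-trans p (≈-sym a≈b))))))
          (≈-trans (∔-cong ay (≈-sym a≈b)) (∔-cancelˡ (u a) (u y)))

      additive-≉0 : ∀ {a b} → u a ≉ 0# → u b ≉ 0# → u (a ⊕ b) ≈ u a ∔ u b
      additive-≉0 {a} {b} a≉0 b≉0 with u a ≈? u b
      ... | no p = additive-≉ a≉0 b≉0 p
      ... | yes p = ≈-trans (additive-≈ a≉0 p) (≈-sym (≈-trans (∔-cong p ≈-refl) (∔-self _)))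

      private
        -- The alternative is that a ⊕ y keeps the label of y. Then b ⊕ (a ⊕ y) has the nonzero
        -- label u b ∔ u y, and adding y gives a ⊕ b the label u b instead of zero.
        absorb : ∀ {a b y} → u a ≈ 0# → u b ≉ 0# → u (a ⊕ b) ≈ 0# → u y ≉ 0# → u b ≉ u y → u (a ⊕ y) ≈ 0#
        absorb {a} {b} {y} a≈0 b≉0 ab≈0 y≉0 b≉y with line-labels a y
        ... | constant p _ = ⊥-elim (y≉0 (≈-trans (≈-sym p) a≈0))
        ... | onlyz _ p = ⊥-elim (y≉0 p)
        ... | onlyy _ p = p
        ... | onlyx p _ = ⊥-elim (y≉0 p)
        ... | additive p = ⊥-elim (b≉0 (≈-trans (≈-sym (∔-cancelʳ (u b) (u y)))
            (≈-trans (∔-cong (≈-sym bay) ≈-refl) (≈-trans (≈-sym (additive-≉0 bay≉0 y≉0)) (≈-trans (reflexive (cancel a b y)) ab≈0)))))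
          where
          cancel : ∀ {n} (a b y : V n) → (b ⊕ (a ⊕ y)) ⊕ y ≡ a ⊕ b
          cancel = solveᵥ 3 (λ a b y → (b :⊕ (a :⊕ y)) :⊕ y ⊜ a :⊕ b) refl
          ay≈y : u (a ⊕ y) ≈ u y
          ay≈y = ≈-trans (≈-sym p) (≈-trans (∔-cong a≈0 ≈-refl) (∔-identityˡ _))
          bay : u (b ⊕ (a ⊕ y)) ≈ u b ∔ u y
          bay = ≈-trans (additive-≉0 b≉0 (λ q → y≉0 (≈-trans (≈-sym ay≈y) q))) (∔-cong ≈-refl ay≈y)
          bay≉0 : u (b ⊕ (a ⊕ y)) ≉ 0#
          bay≉0 q = b≉y (∔≈0⇒≈ (≈-trans (≈-sym bay) q))

      -- Whether adding a to a vector of nonzero label makes the label zero depends on a alone. If b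
      -- and y share their label, a vector z with another one mediates.
      stabiliser : ∀ {a b y} → u a ≈ 0# → u b ≉ 0# → u (a ⊕ b) ≈ 0# → u y ≉ 0# → u (a ⊕ y) ≈ 0#
      stabiliser {a} {b} {y} a≈0 b≉0 ab≈0 y≉0 with u b ≈? u y
      ... | no p = absorb a≈0 b≉0 ab≈0 y≉0 p
      ... | yes p with other (u b)
      ...   | z , z≉0 , z≉b = absorb a≈0 z≉0 (absorb a≈0 b≉0 ab≈0 z≉0 (λ q → z≉b (≈-sym q))) y≉0 (λ q → z≉b (≈-trans q (≈-sym p)))

    Vanishing NonVanishing : ∀ {k} → Vec (V r) k → Set
    Vanishing {k} cs = ∀ v → v ≢ 0v k → lin cs v ≢ 0v r × u (lin cs v) ≈ 0#
    NonVanishing {k} cs = ∀ v → v ≢ 0v k → u (lin cs v) ≉ 0#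

    vanishing? : ∀ {k} (cs : Vec (V r) k) → Dec (Vanishing cs)
    vanishing? cs = all? λ v → ¬? (v ≟ᵥ 0v _) →-dec (¬? (lin cs v ≟ᵥ 0v r) ×-dec (u (lin cs v) ≈? 0#))

    nonVanishing? : ∀ {k} (cs : Vec (V r) k) → Dec (NonVanishing cs)
    nonVanishing? cs = all? λ v → ¬? (v ≟ᵥ 0v _) →-dec ¬? (u (lin cs v) ≈? 0#)

    vanishing-hit : ∀ {k} (cs : Vec (V r) k) c → Vanishing cs → ¬ Vanishing (c ∷ cs) →
      ∃ λ v → c ≡ lin cs v ⊎ u (c ⊕ lin cs v) ≉ 0#
    vanishing-hit cs c van ¬van with ¬all⇒any¬ (λ v → ¬? (v ≟ᵥ 0v _) →-dec (¬? (lin (c ∷ cs) v ≟ᵥ 0v r) ×-dec (u (lin (c ∷ cs) v) ≈? 0#))) ¬van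
    ... | false ∷ v , h = ⊥-elim (h λ v≢0 → subst (λ a → a ≢ 0v r × u a ≈ 0#) (sym (lin-0∷ c cs v)) (van v λ { refl → v≢0 refl }))
    ... | true ∷ v , h with (c ⊕ lin cs v) ≟ᵥ 0v r
    ...   | yes p = v , inj₁ (⊕≡0⇒≡ p)
    ...   | no p = v , inj₂ λ q → h λ _ → p , q

    nonVanishing-hit : ∀ {k} (cs : Vec (V r) k) c → NonVanishing cs → ¬ NonVanishing (c ∷ cs) → ∃ λ v → u (c ⊕ lin cs v) ≈ 0#
    nonVanishing-hit cs c non ¬non with ¬all⇒any¬ (λ v → ¬? (v ≟ᵥ 0v _) →-dec ¬? (u (lin (c ∷ cs) v) ≈? 0#)) ¬non
    ... | false ∷ v , h = ⊥-elim (h λ v≢0 → subst (λ a → u a ≉ 0#) (sym (lin-0∷ c cs v)) (non v λ { refl → v≢0 refl }))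
    ... | true ∷ v , h with u (c ⊕ lin cs v) ≈? 0#
    ...   | yes p = v , p
    ...   | no p = ⊥-elim (h λ _ → p)

    -- If u takes two distinct nonzero values, a maximal vanishing and a maximal nonvanishing flat together span.
    vanishing-or-nonVanishing : ∀ y₁ y₂ → u y₁ ≉ 0# → u y₂ ≉ 0# → u y₁ ≉ u y₂ → ∀ k l →
      (Σ (Vec (V r) k) Vanishing) ⊎ (Σ (Vec (V r) l) NonVanishing) ⊎ (∃ λ i → ∃ λ j → i < k × j < l × r ≤ i + j)
    vanishing-or-nonVanishing y₁ y₂ y₁≉0 y₂≉0 y₁≉y₂ k l
      with grow Vanishing vanishing? (λ { [] v≢0 → ⊥-elim (v≢0 refl) }) k | grow NonVanishing nonVanishing? (λ { [] v≢0 → ⊥-elim (v≢0 refl) }) l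
    ... | inj₁ r | _ = inj₁ r
    ... | inj₂ _ | inj₁ r = inj₂ (inj₁ r)
    ... | inj₂ (i , i<k , ns , van , maxN) | inj₂ (j , j<l , ys , non , maxY) =
      inj₂ (inj₂ (i , j , i<k , j<l , spans⇒≤ (ns ++ ys) spans))
      where
      u-ns : ∀ v → u (lin ns v) ≈ 0#
      u-ns v with v ≟ᵥ 0v i
      ... | yes refl = ≈-trans (reflexive (lin-0 ns)) u-0
      ... | no p = proj₂ (van v p)

      sum-form : ∀ (n n′ : V i) (y : V j) {c} → c ≡ lin ns n ⊕ (lin ys y ⊕ lin ns n′) → ∃ λ v → lin (ns ++ ys) v ≡ c
      sum-form n n′ y refl = (n ⊕ n′) ++ y , trans (lin-++ ns ys (n ⊕ n′) y) (trans (cong (_⊕ lin ys y) (lin-⊕ ns n n′))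
        (solveᵥ 3 (λ a b c → (a :⊕ b) :⊕ c ⊜ a :⊕ (c :⊕ b)) refl (lin ns n) (lin ns n′) (lin ys y)))

      -- Move c along `ns` to a nonzero label, then along `ys` to some c₂ of label zero, then along
      -- `ns` again. If c₂ is not yet in the span of `ns`, the last move reaches a nonzero label
      -- which c₂ turns into zero. By `stabiliser` c₂ does the same to the vector used from `ys`,
      -- but their sum is the result of the first move.
      spans : Spans (ns ++ ys)
      spans c with vanishing-hit ns c van (maxN c)
      ... | n , inj₁ p = sum-form n (0v i) (0v j) (trans p (sym (trans (cong₂ (λ a b → lin ns n ⊕ (a ⊕ b)) (lin-0 ys) (lin-0 ns))
              (solveᵥ 1 (λ a → a :⊕ (:0 :⊕ :0) ⊜ a) refl (lin ns n)))))
      ... | n , inj₂ c₁≉0 with nonVanishing-hit ys (c ⊕ lin ns n) non (maxY (c ⊕ lin ns n))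
      ...   | y , c₂≈0 with vanishing-hit ns ((c ⊕ lin ns n) ⊕ lin ys y) van (maxN _)
      ...     | n′ , inj₁ p = sum-form n n′ y (trans (solveᵥ 3 (λ c a b → c ⊜ a :⊕ (b :⊕ ((c :⊕ a) :⊕ b))) refl c (lin ns n) (lin ys y))
                (cong (λ z → lin ns n ⊕ (lin ys y ⊕ z)) p))
      ...     | n′ , inj₂ z≉0 = ⊥-elim (c₁≉0 (≈-trans (reflexive (sym (⊕-cancelʳ (c ⊕ lin ns n) (lin ys y))))
                (stabiliser y₁≉0 y₂≉0 y₁≉y₂ c₂≈0 z≉0 (≈-trans (reflexive (⊕-cancelˡ ((c ⊕ lin ns n) ⊕ lin ys y) (lin ns n′))) (u-ns n′)) ŷ≉0)))
        where
        ŷ≉0 : u (lin ys y) ≉ 0#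
        ŷ≉0 with y ≟ᵥ 0v j
        ... | no p = non y p
        ... | yes refl = λ _ → c₁≉0 (≈-trans (reflexive (sym (trans (cong (_ ⊕_) (lin-0 ys)) (⊕-idʳ _)))) c₂≈0)

    nonVanishing-additive : ∀ y₁ y₂ → u y₁ ≉ 0# → u y₂ ≉ 0# → u y₁ ≉ u y₂ → ∀ {k} (ys : Vec (V r) k) → NonVanishing ys →
      ∀ v w → u (lin ys (v ⊕ w)) ≈ u (lin ys v) ∔ u (lin ys w)
    nonVanishing-additive y₁ y₂ p q s {k} ys non v w with v ≟ᵥ 0v k | w ≟ᵥ 0v k
    ... | yes refl | _ = ≈-trans (reflexive (cong (lin ys) (⊕-idˡ w))) (≈-sym (≈-trans (∔-cong (≈-trans (reflexive (lin-0 ys)) u-0) ≈-refl) (∔-identityˡ _)))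
    ... | no _ | yes refl = ≈-trans (reflexive (cong (lin ys) (⊕-idʳ v))) (≈-sym (≈-trans (∔-cong ≈-refl (≈-trans (reflexive (lin-0 ys)) u-0)) (∔-identityʳ _)))
    ... | no v≢0 | no w≢0 = ≈-trans (reflexive (lin-⊕ ys v w)) (additive-≉0 p q s (non v v≢0) (non w w≢0))

    nonVanishing⇒independent : ∀ {k} (cs : Vec (V r) k) → NonVanishing cs → Independent cs
    nonVanishing⇒independent cs non v v≢0 p = non v v≢0 (≈-trans (reflexive p) u-0)

-- Directions over a common subgroup

modulo : ∀ {m} {A : Subset m} → Subgroup A → Labels
modulo {m} {A} sg = record
  { Label = V m
  ; _≈_ = λ x y → (x ⊕ y) ∈ A
  ; _≈?_ = λ x y → (x ⊕ y) ∈? A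
  ; ≈-refl = λ {x} → subst (_∈ A) (sym (⊕-self x)) 0∈
  ; ≈-sym = λ {x} {y} p → subst (_∈ A) (⊕-comm x y) p
  ; ≈-trans = λ {x} {y} {z} p q → subst (_∈ A) (solveᵥ 3 (λ x y z → (x :⊕ y) :⊕ (y :⊕ z) ⊜ x :⊕ z) refl x y z) (⊕∈ p q)
  ; _∔_ = _⊕_
  ; 0# = 0v m
  ; ∔-cong = λ {x} {y} {x′} {y′} p q → subst (_∈ A) (⊕-interchange x x′ y y′) (⊕∈ p q)
  ; ∔-comm = λ x y → equal (⊕-comm x y)
  ; ∔-assoc = λ x y z → equal (⊕-assoc x y z)
  ; ∔-identityʳ = λ x → equal (⊕-idʳ x)
  ; ∔-self = λ x → equal (⊕-self x) }
  where
  open Subgroup sg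
  equal : ∀ {x y} → x ≡ y → (x ⊕ y) ∈ A
  equal {x} refl = subst (_∈ A) (sym (⊕-self x)) 0∈

module _ {r m} (C : Config r m) (lb : LowerBound C) where
  open Fibres C
  open LowerBound lb
  open Subgroup sg
  private
    L = modulo sg
    module L = Labels L
  open L using (_≈_; _≉_; _∔_; 0#)

  ∈⇒≈0 : ∀ {x} → x ∈ base → x ≈ 0#
  ∈⇒≈0 {x} = subst (_∈ base) (sym (⊕-idʳ x))

  ≈0⇒∈ : ∀ {x} → x ≈ 0# → x ∈ base
  ≈0⇒∈ {x} = subst (_∈ base) (⊕-idʳ x)

  private
    Representative : V r → Set
    Representative c = Σ (V m) λ w → (c ≡ 0v r → w ≡ 0v m) × (c ≢ 0v r → w ∈ D c) × (c ≢ 0v r → w ∈ base → D c ⊆ base)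

    representative : ∀ c → Dec (c ≡ 0v r) → Dec (∃ λ w → w ∈ D c × w ∉ base) → Representative c
    representative c (yes p) _ = 0v m , (λ _ → refl) , (λ q → ⊥-elim (q p)) , λ q → ⊥-elim (q p)
    representative c (no q) (yes (w , w∈ , w∉)) = w , (λ p → ⊥-elim (q p)) , (λ _ → w∈) , λ _ w∈base → ⊥-elim (w∉ w∈base)
    representative c (no q) (no none) = 0v m , (λ _ → refl) , (λ c≢0 → Subgroup.0∈ (D-subgroup c≢0)) ,
      λ _ _ {x} x∈ → case x ∈? base of λ { (yes p) → p ; (no ¬p) → ⊥-elim (none (x , x∈ , ¬p)) }

    representative! : ∀ c → Representative c
    representative! c = representative c (c ≟ᵥ 0v r) (any? λ w → (w ∈? D c) ×-dec ¬? (w ∈? base))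

  opaque
    -- For c ≢ 0v, D c is generated by base and u c.
    u : V r → V m
    u c = proj₁ (representative! c)

    u-0 : u (0v r) ≈ 0#
    u-0 = subst (_≈ 0#) (sym (proj₁ (proj₂ (representative! (0v r))) refl)) (L.≈-refl {0v m})

    u∈D : ∀ {c} → c ≢ 0v r → u c ∈ D c
    u∈D {c} = proj₁ (proj₂ (proj₂ (representative! c)))

    u∈base⇒ : ∀ {c} → c ≢ 0v r → u c ∈ base → D c ⊆ base
    u∈base⇒ {c} = proj₂ (proj₂ (proj₂ (representative! c)))

  D⊆ : ∀ {c} → c ≢ 0v r → D c ⊆ base ⊹ u c
  D⊆ {c} c≢0 x∈ with u c ∈? base
  ... | yes p = ∨-introˡ (u∈base⇒ c≢0 p x∈)
  ... | no p = ⊆-⊹ base (D c) (u c) (two c≢0) (u∈D c≢0) p x∈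

  open LabelledSpace L u

  private
    -- There is room for one step only above `base`: a direction properly inside `D a` equals `base`
    -- and has label zero. In a pencil, u a ⊕ u b lies in `D c` but not in `base`.
    lines-⊈ : ∀ {a b c w} → Triple a b c → w ∈ D a → w ∉ D b → LineLabels (u a) (u b) (u c)
    lines-⊈ {a} {b} {c} {w} t@(triple a≢0 b≢0 c≢0 _) w∈ w∉ = byType (lineType (D-line t) w∈ w∉)
      where
      w∉base : w ∉ base
      w∉base p = w∉ (base⊆ b≢0 p)
      ua∉ : u a ∉ base
      ua∉ p = w∉base (u∈base⇒ a≢0 p w∈)
      D-b⊆base : D b ⊆ D a → D b ⊆ base
      D-b⊆base b⊆a {x} x∈ with x ∈? base
      ... | yes p = p
      ... | no x∉ = ⊥-elim (w∉ (Subgroup.cancelʳ (D-subgroup b≢0) (base⊆ b≢0 (two a≢0 w∈ w∉base (b⊆a x∈) x∉)) x∈))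

      module _ (p : Pencil (D a) (D b) (D c)) where
        open Pencil p
        ua∉b : u a ∉ D b
        ua∉b q = w∉ (⊹-⊆ (u a) (D-subgroup b≢0) (base⊆ b≢0) q (D⊆ a≢0 w∈))
        ub∉a : u b ∉ D a
        ub∉a q = w∉ (⊆∧≥⇒⊇ (D b) (D a) (λ x∈ → ⊹-⊆ (u b) (D-subgroup a≢0) (base⊆ a≢0) q (D⊆ b≢0 x∈)) (ℕₚ.≤-reflexive countXY) w∈)
        ua⊕ub∈ : (u a ⊕ u b) ∈ D c
        ua⊕ub∈ = sum (u∈D a≢0) ua∉b (u∈D b≢0) ub∉a
        ua⊕ub∉ : (u a ⊕ u b) ∉ base
        ua⊕ub∉ q = ua∉b (Subgroup.cancelʳ (D-subgroup b≢0) (base⊆ b≢0 q) (u∈D b≢0))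

      byType : LineType (D a) (D b) (D c) → LineLabels (u a) (u b) (u c)
      byType (lower a⊆c c⊆a b⊆a) = additive (L.≈-trans (L.∔-cong {u a} {u b} {u a} {0v m} L.≈-refl (∈⇒≈0 (D-b⊆base b⊆a (u∈D b≢0))))
        (L.≈-trans (L.∔-identityʳ (u a)) (two c≢0 (a⊆c (u∈D a≢0)) ua∉ (u∈D c≢0) (λ p → ua∉ (u∈base⇒ c≢0 p (a⊆c (u∈D a≢0)))))))
      byType (upper b⊆c c⊆b b⊆a _) = onlyx (∈⇒≈0 (D-b⊆base b⊆a (u∈D b≢0))) (∈⇒≈0 (D-b⊆base b⊆a (c⊆b (u∈D c≢0))))
      byType (pencil p) = additive (two c≢0 (ua⊕ub∈ p) (ua⊕ub∉ p) (u∈D c≢0) λ q → ua⊕ub∉ p (u∈base⇒ c≢0 q (ua⊕ub∈ p)))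

  lines : ∀ {a b c} → Triple a b c → LineLabels (u a) (u b) (u c)
  lines {a} {b} {c} t@(triple a≢0 b≢0 c≢0 _) = byComparison (compare (D a) (D b) (D c))
    where
    whenEqual : D a ⊆ D b → D b ⊆ D a → D a ⊆ D c → Dec (u a ∈ base) → LineLabels (u a) (u b) (u c)
    whenEqual a⊆b b⊆a a⊆c (yes p) = onlyz (∈⇒≈0 p) (∈⇒≈0 (u∈base⇒ a≢0 p (b⊆a (u∈D b≢0))))
    whenEqual a⊆b b⊆a a⊆c (no ua∉) = constant ua≈ub (L.≈-trans (L.≈-sym {u a} {u b} ua≈ub)
        (two c≢0 (a⊆c (u∈D a≢0)) ua∉ (u∈D c≢0) λ q → ua∉ (u∈base⇒ c≢0 q (a⊆c (u∈D a≢0)))))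
      where
      ua≈ub : u a ≈ u b
      ua≈ub = two b≢0 (a⊆b (u∈D a≢0)) ua∉ (u∈D b≢0) λ q → ua∉ (u∈base⇒ b≢0 q (a⊆b (u∈D a≢0)))
    byComparison : Comparison (D a) (D b) (D c) → LineLabels (u a) (u b) (u c)
    byComparison (A⊈B w∈ w∉) = lines-⊈ t w∈ w∉
    byComparison (B⊈A w∈ w∉) = LineLabels-swap (lines-⊈ (swap t) w∈ w∉)
    byComparison (A⊈C w∈ w∉) = LineLabels-rotate (LineLabels-swap (lines-⊈ (swap (rotate (rotate t))) w∈ w∉))
    byComparison (C⊈A w∈ w∉) = LineLabels-rotate (lines-⊈ (rotate (rotate t)) w∈ w∉)
    byComparison (A≗B≗C a⊆b b⊆a a⊆c c⊆a) = whenEqual a⊆b b⊆a a⊆c (u a ∈? base)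

  vanishing⇒clique : ∀ {k} (cs : Vec (V r) k) → Independent cs → (∀ v → v ≢ 0v k → u (lin cs v) ∈ base) → IsClique cs (map point cs)
  vanishing⇒clique cs ind van = constant⇒clique sg cs ind (λ v v≢0 → u∈base⇒ (ind v v≢0) (van v v≢0)) (λ v v≢0 → base⊆ (ind v v≢0))

  -- Inductive step for a flat on which the labels are linear and injective modulo `base`. `F b`
  -- consists of two classes modulo `base`, and one of them must fit all of the given clique.
  module Extend {k} (b : V r) (ys : Vec (V r) k) (ind : Independent (b ∷ ys))
    (∉base : ∀ v → v ≢ 0v (suc k) → u (lin (b ∷ ys) v) ∉ base)
    (add : ∀ v w → u (lin (b ∷ ys) (v ⊕ w)) ≈ u (lin (b ∷ ys) v) ∔ u (lin (b ∷ ys) w))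
    (xs : Vec (V m) k) (clique : IsClique ys xs) where

    ℓ : V (suc k) → V m
    ℓ v = u (lin (b ∷ ys) v)

    b≢0 : b ≢ 0v r
    b≢0 p = ind (true ∷ 0v k) (λ ()) (trans (lin-1∷0 b ys) p)

    e y : V k → _
    e v = lin ys v
    y v = lin xs v

    ub≡ : u b ≡ ℓ (true ∷ 0v k)
    ub≡ = cong u (sym (lin-1∷0 b ys))
    ue≡ : ∀ v → u (e v) ≡ ℓ (false ∷ v)
    ue≡ v = cong u (sym (lin-0∷ b ys v))

    ℓ-split : ∀ v → (ℓ (true ∷ v) ⊕ (u b ⊕ u (e v))) ∈ base
    ℓ-split v = subst₂ (λ p q → (ℓ (true ∷ v) ⊕ (p ⊕ q)) ∈ base) (sym ub≡) (sym (ue≡ v))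
      (subst (λ z → (ℓ (true ∷ z) ⊕ (ℓ (true ∷ 0v k) ⊕ ℓ (false ∷ v))) ∈ base) (⊕-idˡ v) (add (true ∷ 0v k) (false ∷ v)))

    Compatible : V m → V k → Set
    Compatible x v = (x ⊕ y v) ∈ F (b ⊕ e v)

    x₀ x₁ : V m
    x₀ = point b
    x₁ = x₀ ⊕ u b

    x₀∈ : x₀ ∈ F b
    x₀∈ = point∈ b≢0
    x₁∈ : x₁ ∈ F b
    x₁∈ = D-translate x₀∈ (u∈D b≢0)

    v≢0⇒ : ∀ {v : V k} → v ≢ 0v k → _≢_ {A = V (suc k)} (false ∷ v) (0v (suc k))
    v≢0⇒ v≢0 refl = v≢0 refl

    e≢0 : ∀ {v} → v ≢ 0v k → e v ≢ 0v r
    e≢0 {v} v≢0 = tail-Independent b ys ind v v≢0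

    b⊕e≢0 : ∀ {v} → b ⊕ e v ≢ 0v r
    b⊕e≢0 {v} = ind (true ∷ v) λ ()

    -- The points from `meet` differ from `x₀` and `y v` by elements of `base`, up to u b and u (e
    -- v). Since u b ⊕ u (e v) is a direction over b ⊕ e v, the second error can be traded for the
    -- first.
    compatible : ∀ {v} → v ≢ 0v k → Compatible x₀ v ⊎ Compatible x₁ v
    compatible {v} v≢0 with meet (triple b≢0 (e≢0 v≢0) (b⊕e≢0 {v}) refl)
    ... | p , q , p∈ , q∈ , s∈ = split (⊹-elim base (u b) (D⊆ b≢0 (∈D p∈ x₀∈))) (⊹-elim base (u (e v)) (D⊆ (e≢0 v≢0) (∈D q∈ (clique v v≢0))))
      where
      Dc = D-subgroup (b⊕e≢0 {v})
      ub⊕ue∈ : (u b ⊕ u (e v)) ∈ D (b ⊕ e v)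
      ub⊕ue∈ = Subgroup.cancelˡ Dc (base⊆ b⊕e≢0 (ℓ-split v)) (u∈D b⊕e≢0)
      via : ∀ {d z} → d ∈ D (b ⊕ e v) → (p ⊕ q) ⊕ d ≡ z → z ∈ F (b ⊕ e v)
      via d∈ refl = D-translate s∈ d∈
      split : (p ⊕ x₀) ∈ base ⊎ ((p ⊕ x₀) ⊕ u b) ∈ base → (q ⊕ y v) ∈ base ⊎ ((q ⊕ y v) ⊕ u (e v)) ∈ base → Compatible x₀ v ⊎ Compatible x₁ v
      split (inj₁ g) (inj₁ h) = inj₁ (via (base⊆ b⊕e≢0 (⊕∈ g h))
        (solveᵥ 4 (λ p q x y → (p :⊕ q) :⊕ ((p :⊕ x) :⊕ (q :⊕ y)) ⊜ x :⊕ y) refl p q x₀ (y v)))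
      split (inj₂ g) (inj₁ h) = inj₂ (via (base⊆ b⊕e≢0 (⊕∈ g h))
        (solveᵥ 5 (λ p q x y u → (p :⊕ q) :⊕ (((p :⊕ x) :⊕ u) :⊕ (q :⊕ y)) ⊜ (x :⊕ u) :⊕ y) refl p q x₀ (y v) (u b)))
      split (inj₁ g) (inj₂ h) = inj₂ (via (Subgroup.⊕∈ Dc (base⊆ b⊕e≢0 (⊕∈ g h)) ub⊕ue∈)
        (solveᵥ 6 (λ p q x y u w → (p :⊕ q) :⊕ (((p :⊕ x) :⊕ ((q :⊕ y) :⊕ w)) :⊕ (u :⊕ w)) ⊜ (x :⊕ u) :⊕ y) refl p q x₀ (y v) (u b) (u (e v))))
      split (inj₂ g) (inj₂ h) = inj₁ (via (Subgroup.⊕∈ Dc (base⊆ b⊕e≢0 (⊕∈ g h)) ub⊕ue∈)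
        (solveᵥ 6 (λ p q x y u w → (p :⊕ q) :⊕ ((((p :⊕ x) :⊕ u) :⊕ ((q :⊕ y) :⊕ w)) :⊕ (u :⊕ w)) ⊜ x :⊕ y) refl p q x₀ (y v) (u b) (u (e v))))

    -- If x and x ⊕ u b served different v and v ⊕ v′, then u b would be a combination of ℓ (1 , v) and u (e v′) modulo base.
    consistent : ∀ {x v v′} → v ≢ 0v k → v′ ≢ 0v k → v ≢ v′ → Compatible x v → ¬ Compatible (x ⊕ u b) (v ⊕ v′)
    consistent {x} {v} {v′} v≢0 v′≢0 v≢v′ cv cw with meet {b ⊕ e v} {e v′} {b ⊕ e (v ⊕ v′)}
        (triple b⊕e≢0 (e≢0 v′≢0) b⊕e≢0 (trans (⊕-assoc b (e v) (e v′)) (cong (b ⊕_) (sym (lin-⊕ ys v v′)))))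
    ... | p , q , p∈ , q∈ , s∈ = case ⊹-elim (base ⊹ A) B ub∈ of λ
        { (inj₁ g) → case ⊹-elim base A g of λ
          { (inj₁ h) → ∉base (true ∷ 0v k) (λ ()) (subst (_∈ base) ub≡ h)
          ; (inj₂ h) → ∉base (false ∷ v) (v≢0⇒ v≢0) (subst (_∈ base) (ue≡ v)
              (subst (_∈ base) (solveᵥ 3 (λ u a e → (u :⊕ a) :⊕ (a :⊕ (u :⊕ e)) ⊜ e) refl (u b) A (u (e v))) (⊕∈ h (ℓ-split v)))) }
        ; (inj₂ g) → case ⊹-elim base A g of λ
          { (inj₁ h) → ∉base (true ∷ v′) (λ ()) (cancelʳ (ℓ-split v′) h)
          ; (inj₂ h) → ∉base (false ∷ (v ⊕ v′)) (v≢0⇒ w≢0) (cancelʳ ee≈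
              (subst (_∈ base) (solveᵥ 4 (λ u a e B → ((u :⊕ B) :⊕ a) :⊕ (a :⊕ (u :⊕ e)) ⊜ e :⊕ B) refl (u b) A (u (e v)) B) (⊕∈ h (ℓ-split v)))) } }
      where
      A = u (b ⊕ e v)
      B = u (e v′)
      w≢0 : v ⊕ v′ ≢ 0v k
      w≢0 p = v≢v′ (⊕≡0⇒≡ p)
      sgAB : Subgroup ((base ⊹ A) ⊹ B)
      sgAB = ⊹-subgroup B (⊹-subgroup A sg)
      base⊆AB : base ⊆ (base ⊹ A) ⊹ B
      base⊆AB h = ∨-introˡ (⊆⊹ {A = base} A h)
      A∈ : A ∈ ((base ⊹ A) ⊹ B)
      A∈ = ∨-introˡ (∈⊹ A sg)
      B∈ : B ∈ ((base ⊹ A) ⊹ B)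
      B∈ = ∈⊹ B (⊹-subgroup A sg)
      ee≈ : (ℓ (false ∷ (v ⊕ v′)) ⊕ (u (e v) ⊕ B)) ∈ base
      ee≈ = subst₂ (λ p q → (ℓ (false ∷ (v ⊕ v′)) ⊕ (p ⊕ q)) ∈ base) (sym (ue≡ v)) (sym (ue≡ v′)) (add (false ∷ v) (false ∷ v′))
      C≈ : (u (b ⊕ e (v ⊕ v′)) ⊕ (A ⊕ B)) ∈ base
      C≈ = subst (λ q → (u (b ⊕ e (v ⊕ v′)) ⊕ (A ⊕ q)) ∈ base) (sym (ue≡ v′)) (add (true ∷ v) (false ∷ v′))
      C∈ : u (b ⊕ e (v ⊕ v′)) ∈ ((base ⊹ A) ⊹ B)
      C∈ = Subgroup.cancelʳ sgAB (base⊆AB C≈) (Subgroup.⊕∈ sgAB A∈ B∈)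
      ub∈ : u b ∈ ((base ⊹ A) ⊹ B)
      ub∈ = subst (_∈ ((base ⊹ A) ⊹ B)) (trans (cong (λ z → ((p ⊕ (x ⊕ y v)) ⊕ (q ⊕ y v′)) ⊕ ((p ⊕ q) ⊕ ((x ⊕ u b) ⊕ z))) (lin-⊕ xs v v′))
          (solveᵥ 6 (λ p q x y z u → ((p :⊕ (x :⊕ y)) :⊕ (q :⊕ z)) :⊕ ((p :⊕ q) :⊕ ((x :⊕ u) :⊕ (y :⊕ z))) ⊜ u) refl p q x (y v) (y v′) (u b)))
        (Subgroup.⊕∈ sgAB (Subgroup.⊕∈ sgAB
          (⊹-⊆ A sgAB base⊆AB A∈ (D⊆ b⊕e≢0 (∈D p∈ cv)))
          (⊹-⊆ B sgAB base⊆AB B∈ (D⊆ (e≢0 v′≢0) (∈D q∈ (clique v′ v′≢0)))))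
          (⊹-⊆ (u (b ⊕ e (v ⊕ v′))) sgAB base⊆AB C∈ (D⊆ b⊕e≢0 (∈D s∈ cw))))

    -- If `x₀` fails at v₁ but serves v, then whichever of `x₀` and `x₁` serves v ⊕ v₁ contradicts
    -- `consistent`, at v or at v₁.
    all-x₁ : ∀ {v₁} → v₁ ≢ 0v k → ¬ Compatible x₀ v₁ → ∀ v → v ≢ 0v k → Compatible x₁ v
    all-x₁ {v₁} v₁≢0 ¬c₁ v v≢0 = first (compatible v≢0) (v ≟ᵥ v₁)
      where
      at-v₁ : Compatible x₀ v₁ ⊎ Compatible x₁ v₁ → Compatible x₁ v₁
      at-v₁ (inj₁ p) = ⊥-elim (¬c₁ p)
      at-v₁ (inj₂ p) = p
      c₁ = at-v₁ (compatible v₁≢0)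
      second : Compatible x₀ v → v ≢ v₁ → Compatible x₀ (v ⊕ v₁) ⊎ Compatible x₁ (v ⊕ v₁) → ⊥
      second p v≢v₁ (inj₂ q) = consistent v≢0 v₁≢0 v≢v₁ p q
      second p v≢v₁ (inj₁ q) = consistent v₁≢0 v≢0 (λ z → v≢v₁ (sym z)) c₁
        (subst₂ Compatible (sym (⊕-cancelʳ x₀ (u b))) (⊕-comm v v₁) q)
      first : Compatible x₀ v ⊎ Compatible x₁ v → Dec (v ≡ v₁) → Compatible x₁ v
      first (inj₂ p) _ = p
      first (inj₁ p) (yes refl) = c₁
      first (inj₁ p) (no v≢v₁) = ⊥-elim (second p v≢v₁ (compatible (λ q → v≢v₁ (⊕≡0⇒≡ q))))

    chosen : ∃ λ x → x ∈ F b × (∀ v → v ≢ 0v k → Compatible x v)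
    chosen = byCases (any? λ v → ¬? (v ≟ᵥ 0v k) ×-dec ¬? ((x₀ ⊕ y v) ∈? F (b ⊕ e v)))
      where
      byCases : Dec (∃ λ v → v ≢ 0v k × ¬ Compatible x₀ v) → ∃ λ x → x ∈ F b × (∀ v → v ≢ 0v k → Compatible x v)
      byCases (no none) = x₀ , x₀∈ , λ v v≢0 → case (x₀ ⊕ y v) ∈? F (b ⊕ e v) of λ { (yes p) → p ; (no ¬p) → ⊥-elim (none (v , v≢0 , ¬p)) }
      byCases (yes (v₁ , v₁≢0 , ¬c₁)) = x₁ , x₁∈ , all-x₁ v₁≢0 ¬c₁

    extended : ∃ λ x → IsClique (b ∷ ys) (x ∷ xs)
    extended with chosen
    ... | x , x∈ , all = x , λ
      { (false ∷ v) v≢0 → subst₂ (λ a z → z ∈ F a) (sym (lin-0∷ b ys v)) (sym (lin-0∷ x xs v)) (clique v λ { refl → v≢0 refl })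
      ; (true ∷ v) _ → withTrue v (v ≟ᵥ 0v k) }
      where
      withTrue : ∀ v → Dec (v ≡ 0v k) → (x ⊕ lin xs v) ∈ F (b ⊕ lin ys v)
      withTrue v (yes refl) = subst₂ (λ a z → z ∈ F a) (sym (lin-1∷0 b ys)) (sym (lin-1∷0 x xs)) x∈
      withTrue v (no v≢0) = all v v≢0

  nonVanishing⇒clique : ∀ {k} (ys : Vec (V r) k) → Independent ys → (∀ v → v ≢ 0v k → u (lin ys v) ∉ base) →
    (∀ v w → u (lin ys (v ⊕ w)) ≈ u (lin ys v) ∔ u (lin ys w)) → Σ (Vec (V m) k) (IsClique ys)
  nonVanishing⇒clique [] ind ∉base add = [] , λ { [] v≢0 → ⊥-elim (v≢0 refl) }
  nonVanishing⇒clique {suc k} (b ∷ ys) ind ∉base add with nonVanishing⇒clique ys (tail-Independent b ys ind)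
      (λ v v≢0 → subst (λ a → u a ∉ base) (lin-0∷ b ys v) (∉base (false ∷ v) λ { refl → v≢0 refl }))
      (λ v w → subst₂ (λ p q → (p ⊕ q) ∈ base) (cong u (lin-0∷ b ys (v ⊕ w)))
        (cong₂ (λ p q → u p ⊕ u q) (lin-0∷ b ys v) (lin-0∷ b ys w)) (add (false ∷ v) (false ∷ w)))
  ... | xs , clique with Extend.extended b ys ind ∉base add xs clique
  ...   | x , clique′ = x ∷ xs , clique′

  module OneLabel {k} (atMost : CliquesAtMost k) {t} (t∉ : t ∉ base) (one : ∀ c → u c ∈ base ⊎ (u c ⊕ t) ∈ base) where
    P = base ⊹ t
    sgP : Subgroup P
    sgP = ⊹-subgroup t sg

    u∈P : ∀ c → u c ∈ P
    u∈P c with one c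
    ... | inj₁ p = ∨-introˡ p
    ... | inj₂ p = ∨-introʳ p

    D⊆P : ∀ {c} → c ≢ 0v r → D c ⊆ P
    D⊆P {c} c≢0 x∈ = ⊹-⊆ (u c) sgP (⊆⊹ {A = base} t) (u∈P c) (D⊆ c≢0 x∈)

    σ : V r → V m
    σ = lin (map point (basis r))

    ind-basis : Independent (basis r)
    ind-basis v v≢0 p = v≢0 (trans (sym (lin-basis v)) p)

    ∈σ : ∀ {c x} → x ∈ F c → (x ⊕ σ c) ∈ P
    ∈σ {c} {x} x∈ = section sgP (basis r) ind-basis (λ v v≢0 → D⊆P (ind-basis v v≢0)) c (∈F⇒≢0 x∈)
      (subst (λ a → x ∈ F a) (sym (lin-basis c)) x∈)

    T : Subset r
    T c = nonzero? c ∧ not (F c (σ c))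

    T⇒≢0 : ∀ {c} → c ∈ T → c ≢ 0v r
    T⇒≢0 {c} p = nonzero?⇒≢0 c (proj₁ (∩-elim p))

    T⇒∉ : ∀ {c} → c ∈ T → σ c ∉ F c
    T⇒∉ {c} p q = true≢false (trans (sym (proj₂ (∩-elim {nonzero? c} p))) (cong not q))

    ∉T⇒ : ∀ {c} → c ≢ 0v r → c ∉ T → σ c ∈ F c
    ∉T⇒ {c} c≢0 p with σ c ∈? F c
    ... | yes q = q
    ... | no q = ⊥-elim (p (∩-intro (≢0⇒nonzero? c c≢0) (cong not (∉⇒false q))))

    -- The fibre lies in σ c ⊕ P, which is two classes modulo `base`. Missing σ c, it lies in the
    -- other one.
    far : ∀ {c x} → c ∈ T → x ∈ F c → ((x ⊕ σ c) ⊕ t) ∈ base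
    far {c} {x} c∈ x∈ with ⊹-elim base t (∈σ x∈)
    ... | inj₂ p = p
    ... | inj₁ p = ⊥-elim (T⇒∉ c∈ (subst (_∈ F c) (⊕-cancelˡ x (σ c)) (D-translate x∈ (base⊆ (T⇒≢0 c∈) p))))

    -- On the points given by `meet` each of the three fibres is off by t, and three times t is t,
    -- which is not in `base`.
    triangleFree : TriangleFree T
    triangleFree {a} {b} a∈ b∈ c∈ with meet (triple (T⇒≢0 a∈) (T⇒≢0 b∈) (T⇒≢0 c∈) refl)
    ... | x , y , x∈ , y∈ , s∈ = t∉ (subst (_∈ base)
        (trans (cong (λ z → (((x ⊕ σ a) ⊕ t) ⊕ ((y ⊕ σ b) ⊕ t)) ⊕ (((x ⊕ y) ⊕ z) ⊕ t)) (lin-⊕ (map point (basis r)) a b))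
          (solveᵥ 5 (λ x y a b t → (((x :⊕ a) :⊕ t) :⊕ ((y :⊕ b) :⊕ t)) :⊕ (((x :⊕ y) :⊕ (a :⊕ b)) :⊕ t) ⊜ t) refl x y (σ a) (σ b) t))
        (⊕∈ (⊕∈ (far a∈ x∈) (far b∈ y∈)) (far c∈ s∈)))

    -- Over a flat that misses `T` the linear map σ itself is a clique.
    meets : MeetsFlats T (suc k)
    meets cs ind with any? (λ v → lin cs v ∈? T)
    ... | yes r = r
    ... | no none = ⊥-elim (ℕₚ.1+n≰n (atMost (suc k) cs (map σ cs) λ v v≢0 →
        subst (_∈ F (lin cs v)) (sym (lin-map (map point (basis r)) cs v)) (∉T⇒ (ind v v≢0) λ p → none (v , p))))

    bound : r ≤ 2 ^ suc k + k
    bound = triangleFree-bound k T triangleFree meets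

  lowerBound⇒≤ : ∀ {k} → CliquesAtMost k → r ≤ 2 ^ suc k + k
  lowerBound⇒≤ {k} atMost with any? (λ a → any? λ b → ¬? (u a L.≈? 0#) ×-dec (¬? (u b L.≈? 0#) ×-dec ¬? (u a L.≈? u b)))
  ... | yes (a , b , a≉0 , b≉0 , a≉b) with vanishing-or-nonVanishing u-0 lines a b a≉0 b≉0 a≉b (suc k) (suc k)
  ...   | inj₁ (cs , van) = ⊥-elim (ℕₚ.1+n≰n (atMost (suc k) cs (map point cs)
          (vanishing⇒clique cs (λ v v≢0 → proj₁ (van v v≢0)) λ v v≢0 → ≈0⇒∈ (proj₂ (van v v≢0)))))
  ...   | inj₂ (inj₁ (ys , non)) with nonVanishing⇒clique ys (nonVanishing⇒independent u-0 lines ys non)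
          (λ v v≢0 p → non v v≢0 (∈⇒≈0 p)) (nonVanishing-additive u-0 lines a b a≉0 b≉0 a≉b ys non)
  ...     | xs , clique = ⊥-elim (ℕₚ.1+n≰n (atMost (suc k) ys xs clique))
  lowerBound⇒≤ {k} atMost | yes (a , b , a≉0 , b≉0 , a≉b) | inj₂ (inj₂ (i , j , s≤s i≤k , s≤s j≤k , r≤)) =
      ℕₚ.≤-trans r≤ (ℕₚ.+-mono-≤ (ℕₚ.≤-trans i≤k k≤) j≤k)
    where
    k≤ : k ≤ 2 ^ suc k
    k≤ = ℕₚ.<⇒≤ (ℕₚ.<-trans (ℕₚ.n<1+n k) (n<2^n (suc k)))
  lowerBound⇒≤ {k} atMost | no none with any? (λ a → ¬? (u a L.≈? 0#))
  ... | yes (a , a≉0) = OneLabel.bound atMost {u a} (λ p → a≉0 (∈⇒≈0 p)) one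
    where
    one : ∀ c → u c ∈ base ⊎ (u c ⊕ u a) ∈ base
    one c with u c L.≈? 0# | u c L.≈? u a
    ... | yes p | _ = inj₁ (≈0⇒∈ p)
    ... | no _ | yes p = inj₂ p
    ... | no p | no q = ⊥-elim (none (c , a , p , a≉0 , q))
  ... | no allZero = ℕₚ.≤-trans (atMost r (basis r) (map point (basis r)) (vanishing⇒clique (basis r) ind-basis λ v v≢0 → zero∈ (lin (basis r) v))) (ℕₚ.m≤n+m k _)
    where
    ind-basis : Independent (basis r)
    ind-basis v v≢0 p = v≢0 (trans (sym (lin-basis v)) p)
    zero∈ : ∀ c → u c ∈ base
    zero∈ c with u c L.≈? 0#
    ... | yes p = ≈0⇒∈ p
    ... | no p = ⊥-elim (allZero (c , p))

-- Proof by truth table: the implicit argument is solved by evaluating both sides on all of `V n`.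
boolIdentity : ∀ {n} (g h : V n → Bool) → {True (all? λ v → g v Boolₚ.≟ h v)} → ∀ v → g v ≡ h v
boolIdentity g h {t} = toWitness t

-- Quadratic forms

sum₇ : Bool → Bool → Bool → Bool → Bool → Bool → Bool → Bool
sum₇ a b c d e f g = a xor (b xor (c xor (d xor (e xor (f xor g)))))

sum₇-xor : ∀ a b c d e f g a′ b′ c′ d′ e′ f′ g′ →
  sum₇ (a xor a′) (b xor b′) (c xor c′) (d xor d′) (e xor e′) (f xor f′) (g xor g′) ≡ sum₇ a b c d e f g xor sum₇ a′ b′ c′ d′ e′ f′ g′
sum₇-xor a b c d e f g a′ b′ c′ d′ e′ f′ g′ = step a a′ (step b b′ (step c c′ (step d d′ (step e e′ (xor-interchange f f′ g g′)))))
  where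
  step : ∀ a a′ {x y z} → x ≡ y xor z → (a xor a′) xor x ≡ (a xor y) xor (a′ xor z)
  step a a′ {y = y} {z} refl = xor-interchange a a′ y z

planeSum : ∀ {k} → (V k → Bool) → V k → V k → V k → Bool
planeSum h a b c = sum₇ (h a) (h b) (h c) (h (a ⊕ b)) (h (a ⊕ c)) (h (b ⊕ c)) (h ((a ⊕ b) ⊕ c))

-- For h (0v k) ≡ false this says that h is a quadratic form.
Quadratic : ∀ {k} → (V k → Bool) → Set
Quadratic h = ∀ a b c → planeSum h a b c ≡ false

independent₃ : ∀ {k} {a b c : V k} → a ≢ 0v k → b ≢ 0v k → c ≢ 0v k → a ≢ b → a ≢ c → b ≢ c → a ⊕ b ≢ c →
  Independent (a ∷ b ∷ c ∷ [])
independent₃ {k} {a} {b} {c} a≢0 b≢0 c≢0 a≢b a≢c b≢c ab≢c = λ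
  { (true ∷ true ∷ true ∷ []) _ p → ab≢c (⊕≡0⇒≡ (trans (solveᵥ 3 (λ a b c → (a :⊕ b) :⊕ c ⊜ a :⊕ (b :⊕ (c :⊕ :0))) refl a b c) p))
  ; (true ∷ true ∷ false ∷ []) _ p → a≢b (⊕≡0⇒≡ (trans (solveᵥ 3 (λ a b c → a :⊕ b ⊜ a :⊕ (b :⊕ (:0 :⊕ :0))) refl a b c) p))
  ; (true ∷ false ∷ true ∷ []) _ p → a≢c (⊕≡0⇒≡ (trans (solveᵥ 3 (λ a b c → a :⊕ c ⊜ a :⊕ (:0 :⊕ (c :⊕ :0))) refl a b c) p))
  ; (true ∷ false ∷ false ∷ []) _ p → a≢0 (trans (solveᵥ 3 (λ a b c → a ⊜ a :⊕ (:0 :⊕ (:0 :⊕ :0))) refl a b c) p)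
  ; (false ∷ true ∷ true ∷ []) _ p → b≢c (⊕≡0⇒≡ (trans (solveᵥ 3 (λ a b c → b :⊕ c ⊜ :0 :⊕ (b :⊕ (c :⊕ :0))) refl a b c) p))
  ; (false ∷ true ∷ false ∷ []) _ p → b≢0 (trans (solveᵥ 3 (λ a b c → b ⊜ :0 :⊕ (b :⊕ (:0 :⊕ :0))) refl a b c) p)
  ; (false ∷ false ∷ true ∷ []) _ p → c≢0 (trans (solveᵥ 3 (λ a b c → c ⊜ :0 :⊕ (:0 :⊕ (c :⊕ :0))) refl a b c) p)
  ; (false ∷ false ∷ false ∷ []) v≢0 _ → v≢0 refl }

-- On a dependent triple the seven vectors, apart from zero, occur in equal pairs.
independent⇒quadratic : ∀ {k} (h : V k → Bool) → h (0v k) ≡ false →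
  (∀ a b c → Independent (a ∷ b ∷ c ∷ []) → planeSum h a b c ≡ false) → Quadratic h
independent⇒quadratic {k} h h0 onIndependent a b c with a ≟ᵥ 0v k | b ≟ᵥ 0v k | c ≟ᵥ 0v k | a ≟ᵥ b | a ≟ᵥ c | b ≟ᵥ c | (a ⊕ b) ≟ᵥ c
... | no p₁ | no p₂ | no p₃ | no p₄ | no p₅ | no p₆ | no p₇ = onIndependent a b c (independent₃ p₁ p₂ p₃ p₄ p₅ p₆ p₇)
... | yes refl | _ | _ | _ | _ | _ | _ rewrite h0 | ⊕-idˡ b | ⊕-idˡ c = pairs (h b) (h c) (h (b ⊕ c))
  where
  pairs : ∀ x y z → sum₇ false x y x y z z ≡ false
  pairs x y z = boolIdentity {3} (λ { (x ∷ y ∷ z ∷ []) → sum₇ false x y x y z z }) (λ { (x ∷ y ∷ z ∷ []) → false }) (x ∷ y ∷ z ∷ [])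
... | no _ | yes refl | _ | _ | _ | _ | _ rewrite h0 | ⊕-idˡ c | ⊕-idʳ a = pairs (h a) (h c) (h (a ⊕ c))
  where
  pairs : ∀ x y z → sum₇ x false y x z y z ≡ false
  pairs x y z = boolIdentity {3} (λ { (x ∷ y ∷ z ∷ []) → sum₇ x false y x z y z }) (λ { (x ∷ y ∷ z ∷ []) → false }) (x ∷ y ∷ z ∷ [])
... | no _ | no _ | yes refl | _ | _ | _ | _ rewrite h0 | ⊕-idʳ a | ⊕-idʳ b | ⊕-idʳ (a ⊕ b) = pairs (h a) (h b) (h (a ⊕ b))
  where
  pairs : ∀ x y z → sum₇ x y false z x y z ≡ false
  pairs x y z = boolIdentity {3} (λ { (x ∷ y ∷ z ∷ []) → sum₇ x y false z x y z }) (λ { (x ∷ y ∷ z ∷ []) → false }) (x ∷ y ∷ z ∷ [])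
... | no _ | no _ | no _ | yes refl | _ | _ | _ rewrite ⊕-self a | h0 | ⊕-idˡ c = pairs (h a) (h c) (h (a ⊕ c))
  where
  pairs : ∀ x y z → sum₇ x x y false z z y ≡ false
  pairs x y z = boolIdentity {3} (λ { (x ∷ y ∷ z ∷ []) → sum₇ x x y false z z y }) (λ { (x ∷ y ∷ z ∷ []) → false }) (x ∷ y ∷ z ∷ [])
... | no _ | no _ | no _ | no _ | yes refl | _ | _
  rewrite ⊕-self a | h0 | solveᵥ 2 (λ a b → (a :⊕ b) :⊕ a ⊜ b) refl a b | ⊕-comm b a = pairs (h a) (h b) (h (a ⊕ b))
  where
  pairs : ∀ x y z → sum₇ x y x z false z y ≡ false
  pairs x y z = boolIdentity {3} (λ { (x ∷ y ∷ z ∷ []) → sum₇ x y x z false z y }) (λ { (x ∷ y ∷ z ∷ []) → false }) (x ∷ y ∷ z ∷ [])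
... | no _ | no _ | no _ | no _ | no _ | yes refl | _ rewrite ⊕-self b | h0 | ⊕-cancelʳ a b = pairs (h a) (h b) (h (a ⊕ b))
  where
  pairs : ∀ x y z → sum₇ x y y z z false x ≡ false
  pairs x y z = boolIdentity {3} (λ { (x ∷ y ∷ z ∷ []) → sum₇ x y y z z false x }) (λ { (x ∷ y ∷ z ∷ []) → false }) (x ∷ y ∷ z ∷ [])
... | no _ | no _ | no _ | no _ | no _ | no _ | yes refl
  rewrite ⊕-self (a ⊕ b) | h0 | ⊕-cancelˡ a b | solveᵥ 2 (λ a b → b :⊕ (a :⊕ b) ⊜ a) refl a b = pairs (h a) (h b) (h (a ⊕ b))
  where
  pairs : ∀ x y z → sum₇ x y z z y x false ≡ false
  pairs x y z = boolIdentity {3} (λ { (x ∷ y ∷ z ∷ []) → sum₇ x y z z y x false }) (λ { (x ∷ y ∷ z ∷ []) → false }) (x ∷ y ∷ z ∷ [])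

-- Pairings and quadratic forms

record Pairing {m} (k : ℕ) (P : Subset m) : Set where
  field
    ϕ : V k → V m → Bool
    additiveˡ : ∀ v w {p} → p ∈ P → ϕ (v ⊕ w) p ≡ ϕ v p xor ϕ w p
    additiveʳ : ∀ v {p q} → p ∈ P → q ∈ P → ϕ v (p ⊕ q) ≡ ϕ v p xor ϕ v q
    nondegenerate : ∀ v → v ≢ 0v k → ∃ λ p → p ∈ P × ϕ v p ≡ true

pullback : ∀ {m j k} {P : Subset m} → Pairing k P → (cs : Vec (V k) j) → Independent cs → Pairing j P
pullback π cs ind = record
  { ϕ = λ v → ϕ (lin cs v)
  ; additiveˡ = λ v w {p} p∈ → trans (cong (λ z → ϕ z p) (lin-⊕ cs v w)) (additiveˡ (lin cs v) (lin cs w) p∈)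
  ; additiveʳ = λ v → additiveʳ (lin cs v)
  ; nondegenerate = λ v v≢0 → nondegenerate (lin cs v) (ind v v≢0) }
  where open Pairing π

module _ {m k} {P : Subset m} (sg : Subgroup P) (π : Pairing k P) where
  open Pairing π

  private
    Image : V k → Set
    Image t = ∃ λ p → p ∈ P × (∀ v → ϕ v p ≡ dot t v)

    image? : ∀ t → Dec (Image t)
    image? t = any? λ p → (p ∈? P) ×-dec all? λ v → ϕ v p Boolₚ.≟ dot t v

    dot-⊕ˡ : ∀ (s t v : V k) → dot (s ⊕ t) v ≡ dot s v xor dot t v
    dot-⊕ˡ s t v = trans (dot-comm (s ⊕ t) v) (trans (dot-⊕ v s t) (cong₂ _xor_ (dot-comm v s) (dot-comm v t)))

    image-subgroup : IsSubgroup Image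
    image-subgroup = isSubgroup
      (0v m , Subgroup.0∈ sg , λ v → trans (cong (ϕ v) (sym (⊕-self (0v m)))) (trans (additiveʳ v (Subgroup.0∈ sg) (Subgroup.0∈ sg))
        (trans (Boolₚ.xor-same (ϕ v (0v m))) (sym (dot-0ˡ v)))))
      λ { {s} {t} (p , p∈ , f) (q , q∈ , g) → p ⊕ q , Subgroup.⊕∈ sg p∈ q∈ ,
          λ v → trans (additiveʳ v p∈ q∈) (trans (cong₂ _xor_ (f v) (g v)) (sym (dot-⊕ˡ s t v))) }

    unseparated : ∀ {t} l → (∀ s → Image s → dot l s ≡ false) → dot l t ≢ true
    unseparated {t} l kill hit = contradict (nondegenerate l λ { refl → true≢false (trans (sym hit) (dot-0ˡ t)) })
      where
      contradict : (∃ λ p → p ∈ P × ϕ l p ≡ true) → ⊥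
      contradict (p , p∈ , ϕ≡true) = let s , f = additive⇒dot (λ v → ϕ v p) (λ v w → additiveˡ v w p∈)
        in true≢false (trans (sym ϕ≡true) (trans (f l) (trans (dot-comm s l) (kill s (p , p∈ , f)))))

  opaque
    -- A form on `V k` outside the image of `P` would be separated from it by some l; then ϕ l
    -- vanishes on `P`, against nondegeneracy.
    represent : ∀ t → ∃ λ p → p ∈ P × (∀ v → ϕ v p ≡ dot t v)
    represent t with image? t
    ... | yes r = r
    ... | no t∉ = let l , kill , hit = separation image? image-subgroup t t∉ in ⊥-elim (unseparated l kill hit)

module QuadraticStep {m k} {P : Subset m} (sg : Subgroup P) (π : Pairing (suc k) P) (h : V (suc k) → Bool) (quad : Quadratic h)
  (ps : Vec (V m) k) (rep : ∀ v → lin ps v ∈ P × Pairing.ϕ π (false ∷ v) (lin ps v) ≡ h (false ∷ v)) where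
  open Pairing π

  e₀ : V (suc k)
  e₀ = true ∷ 0v k

  -- The polar form of h against e₀, corrected by what ϕ e₀ contributes along `ps`. A new vector
  -- that pairs with `false ∷ v` to this value makes h come out right at `true ∷ v`.
  g : V k → Bool
  g v = (h e₀ xor (h (false ∷ v) xor h (true ∷ v))) xor ϕ e₀ (lin ps v)

  rearrange : ∀ a b c d e f g → sum₇ a b c d e f g ≡ false → a xor (f xor g) ≡ (a xor (b xor d)) xor (a xor (c xor e))
  rearrange a b c d e f g p = trans (boolIdentity {7}
    (λ { (a ∷ b ∷ c ∷ d ∷ e ∷ f ∷ g ∷ []) → a xor (f xor g) })
    (λ { (a ∷ b ∷ c ∷ d ∷ e ∷ f ∷ g ∷ []) → sum₇ a b c d e f g xor ((a xor (b xor d)) xor (a xor (c xor e))) }) (a ∷ b ∷ c ∷ d ∷ e ∷ f ∷ g ∷ []))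
    (cong (_xor ((a xor (b xor d)) xor (a xor (c xor e)))) p)

  h-part : ∀ x y → h e₀ xor (h (false ∷ (x ⊕ y)) xor h (true ∷ (x ⊕ y))) ≡
    (h e₀ xor (h (false ∷ x) xor h (true ∷ x))) xor (h e₀ xor (h (false ∷ y) xor h (true ∷ y)))
  h-part x y = rearrange (h e₀) (h (false ∷ x)) (h (false ∷ y)) (h (true ∷ x)) (h (true ∷ y)) (h (false ∷ (x ⊕ y))) (h (true ∷ (x ⊕ y)))
    (subst₂ (λ a b → sum₇ (h e₀) (h (false ∷ x)) (h (false ∷ y)) (h (true ∷ a)) (h (true ∷ b)) (h (false ∷ (x ⊕ y))) (h (true ∷ (a ⊕ y))) ≡ false)
      (⊕-idˡ x) (⊕-idˡ y) (quad e₀ (false ∷ x) (false ∷ y)))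

  g-additive : ∀ x y → g (x ⊕ y) ≡ g x xor g y
  g-additive x y = trans (cong₂ _xor_ (h-part x y) (trans (cong (ϕ e₀) (lin-⊕ ps x y)) (additiveʳ e₀ (proj₁ (rep x)) (proj₁ (rep y)))))
    (xor-interchange (h e₀ xor (h (false ∷ x) xor h (true ∷ x))) (h e₀ xor (h (false ∷ y) xor h (true ∷ y))) (ϕ e₀ (lin ps x)) (ϕ e₀ (lin ps y)))

  cancel : ∀ a b c d → (a xor ((a xor (b xor c)) xor d)) xor (d xor b) ≡ c
  cancel a b c d = boolIdentity {4} (λ { (a ∷ b ∷ c ∷ d ∷ []) → (a xor ((a xor (b xor c)) xor d)) xor (d xor b) }) (λ { (a ∷ b ∷ c ∷ d ∷ []) → c }) (a ∷ b ∷ c ∷ d ∷ [])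

  extend : ∀ {s p₀} → (∀ v → g v ≡ dot s v) → p₀ ∈ P → (∀ v → ϕ v p₀ ≡ dot (h e₀ ∷ s) v) →
    ∀ v → lin (p₀ ∷ ps) v ∈ P × ϕ v (lin (p₀ ∷ ps) v) ≡ h v
  extend {s} {p₀} g≡ p₀∈ represents (false ∷ v) = subst (λ q → q ∈ P × ϕ (false ∷ v) q ≡ h (false ∷ v)) (sym (lin-0∷ p₀ ps v)) (rep v)
  extend {s} {p₀} g≡ p₀∈ represents (true ∷ v) = Subgroup.⊕∈ sg p₀∈ (proj₁ (rep v)) ,
      trans (additiveʳ (true ∷ v) p₀∈ (proj₁ (rep v))) (trans (cong₂ _xor_ new old) (cancel (h e₀) (h (false ∷ v)) (h (true ∷ v)) (ϕ e₀ (lin ps v))))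
    where
    new : ϕ (true ∷ v) p₀ ≡ h e₀ xor g v
    new = trans (represents (true ∷ v)) (cong₂ _xor_ (Boolₚ.∧-identityʳ (h e₀)) (sym (g≡ v)))
    old : ϕ (true ∷ v) (lin ps v) ≡ ϕ e₀ (lin ps v) xor h (false ∷ v)
    old = trans (cong (λ z → ϕ (true ∷ z) (lin ps v)) (sym (⊕-idˡ v)))
      (trans (additiveˡ e₀ (false ∷ v) (proj₁ (rep v))) (cong (ϕ e₀ (lin ps v) xor_) (proj₂ (rep v))))

  extended : ∃ λ (qs : Vec (V m) (suc k)) → ∀ v → lin qs v ∈ P × ϕ v (lin qs v) ≡ h v
  extended = let s , g≡ = additive⇒dot g g-additive
                 p₀ , p₀∈ , represents = represent sg π (h e₀ ∷ s)
             in (p₀ ∷ ps) , extend g≡ p₀∈ represents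

-- A quadratic form is the diagonal of some bilinear form, and by nondegeneracy every bilinear form
-- arises from a linear map into `P`. The basis vectors are treated one by one, as for a triangular
-- matrix.
quadratic-represent : ∀ {m k} {P : Subset m} → Subgroup P → (π : Pairing k P) → (h : V k → Bool) → h (0v k) ≡ false → Quadratic h →
  ∃ λ (ps : Vec (V m) k) → ∀ v → lin ps v ∈ P × Pairing.ϕ π v (lin ps v) ≡ h v
quadratic-represent {m} {zero} sg π h h0 quad = [] , λ { [] → Subgroup.0∈ sg ,
    trans (trans (additiveˡ [] [] (Subgroup.0∈ sg)) (Boolₚ.xor-same (ϕ [] (0v m)))) (sym h0) }
  where open Pairing π
quadratic-represent {m} {suc k} {P} sg π h h0 quad =
  let ps , rep = quadratic-represent sg π′ (h ∘ (false ∷_)) h0 (λ a b c → quad (false ∷ a) (false ∷ b) (false ∷ c))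
  in QuadraticStep.extended sg π h quad ps rep
  where
  open Pairing π
  π′ : Pairing k P
  π′ = record
    { ϕ = λ v → ϕ (false ∷ v) ; additiveˡ = λ v w → additiveˡ (false ∷ v) (false ∷ w)
    ; additiveʳ = λ v → additiveʳ (false ∷ v) ; nondegenerate = λ v v≢0 → nondegenerate (false ∷ v) λ { refl → v≢0 refl } }

-- Even-plane matroids as quadratic forms

parity : ℕ → Bool
parity zero = false
parity (suc n) = not (parity n)

parity-+ : ∀ m n → parity (m + n) ≡ parity m xor parity n
parity-+ zero n = refl
parity-+ (suc m) n = trans (cong not (parity-+ m n)) (Boolₚ.not-distribˡ-xor (parity m) (parity n))

even⇒parity : ∀ {n} → 2 ∣ n → parity n ≡ false
even⇒parity (divides q refl) = double q
  where
  double : ∀ q → parity (q * 2) ≡ false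
  double zero = refl
  double (suc q) = trans (Boolₚ.not-involutive _) (double q)

-- Fixes the value at the zero vector, about which the matroid says nothing, as a quadratic form
-- requires.
supported : ∀ {k} → Matroid k → V k → Bool
supported N v = nonzero? v ∧ Matroid.E N v

supported-0 : ∀ {k} (N : Matroid k) → supported N (0v k) ≡ false
supported-0 {k} N = cong (_∧ Matroid.E N (0v k)) (nonzero?-0 k)

supported-≢0 : ∀ {k} (N : Matroid k) {v} → v ≢ 0v k → supported N v ≡ Matroid.E N v
supported-≢0 N {v} v≢0 = cong (_∧ Matroid.E N v) (≢0⇒nonzero? v v≢0)

evenPlane⇒quadratic : ∀ {k} (N : Matroid k) → EvenPlane N → Quadratic (supported N)
evenPlane⇒quadratic {k} N even = independent⇒quadratic (supported N) (supported-0 N) λ a b c ind →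
  let E = Matroid.E N
      φ = a ∷ b ∷ c ∷ []
      at : ∀ v {x} → v ≢ 0v 3 → lin φ v ≡ x → E (lin φ v) ≡ supported N x
      at v v≢0 p = trans (sym (supported-≢0 N (ind v v≢0))) (cong (supported N) p)
      s = solveᵥ {k}
  in trans (reorder (supported N a) (supported N b) (supported N c) (supported N (a ⊕ b)) (supported N (a ⊕ c)) (supported N (b ⊕ c)) (supported N ((a ⊕ b) ⊕ c)))
     (trans (cong parity (sym (cong₇
       (at (true ∷ true ∷ true ∷ []) (λ ()) (s 3 (λ a b c → a :⊕ (b :⊕ (c :⊕ :0)) ⊜ (a :⊕ b) :⊕ c) refl a b c))
       (at (true ∷ true ∷ false ∷ []) (λ ()) (s 2 (λ a b → a :⊕ (b :⊕ (:0 :⊕ :0)) ⊜ a :⊕ b) refl a b))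
       (at (true ∷ false ∷ true ∷ []) (λ ()) (s 2 (λ a c → a :⊕ (:0 :⊕ (c :⊕ :0)) ⊜ a :⊕ c) refl a c))
       (at (true ∷ false ∷ false ∷ []) (λ ()) (s 1 (λ a → a :⊕ (:0 :⊕ (:0 :⊕ :0)) ⊜ a) refl a))
       (at (false ∷ true ∷ true ∷ []) (λ ()) (s 2 (λ b c → :0 :⊕ (b :⊕ (c :⊕ :0)) ⊜ b :⊕ c) refl b c))
       (at (false ∷ true ∷ false ∷ []) (λ ()) (s 1 (λ b → :0 :⊕ (b :⊕ (:0 :⊕ :0)) ⊜ b) refl b))
       (at (false ∷ false ∷ true ∷ []) (λ ()) (s 1 (λ c → :0 :⊕ (:0 :⊕ (c :⊕ :0)) ⊜ c) refl c)))))
     (even⇒parity (even φ (Independent⇒Injective φ ind))))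
  where
  -- The sum to which `planeCount` unfolds; `reorder` follows the enumeration of `allVecs 3`.
  total₇ : Bool → Bool → Bool → Bool → Bool → Bool → Bool → ℕ
  total₇ a b c d e f g = i a + (i b + (i c + (i d + (i e + (i f + (i g + 0))))))
    where i = indicator
  cong₇ : ∀ {a b c d e f g a′ b′ c′ d′ e′ f′ g′} → a ≡ a′ → b ≡ b′ → c ≡ c′ → d ≡ d′ → e ≡ e′ → f ≡ f′ → g ≡ g′ →
    total₇ a b c d e f g ≡ total₇ a′ b′ c′ d′ e′ f′ g′
  cong₇ refl refl refl refl refl refl refl = refl
  reorder : ∀ a b c ab ac bc abc → sum₇ a b c ab ac bc abc ≡ parity (total₇ abc ab ac a bc b c)
  reorder a b c d e f g = boolIdentity {7} (λ { (a ∷ b ∷ c ∷ d ∷ e ∷ f ∷ g ∷ []) → sum₇ a b c d e f g }) (λ { (a ∷ b ∷ c ∷ d ∷ e ∷ f ∷ g ∷ []) → parity (total₇ g d e a f b c) })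
    (a ∷ b ∷ c ∷ d ∷ e ∷ f ∷ g ∷ [])

lin-zipWith : ∀ {k n} (cs ds : Vec (V n) k) v → lin (zipWith _⊕_ cs ds) v ≡ lin cs v ⊕ lin ds v
lin-zipWith [] [] [] = sym (⊕-self _)
lin-zipWith (c ∷ cs) (d ∷ ds) (true ∷ v) = trans (cong ((c ⊕ d) ⊕_) (lin-zipWith cs ds v)) (⊕-interchange c d _ _)
lin-zipWith (c ∷ cs) (d ∷ ds) (false ∷ v) = trans (lin-0∷ (c ⊕ d) (zipWith _⊕_ cs ds) v)
  (trans (lin-zipWith cs ds v) (sym (cong₂ _⊕_ (lin-0∷ c cs v) (lin-0∷ d ds v))))

-- Directions inside a common overgroup

functionsOn : ∀ {m} → Subset m → Labels
functionsOn {m} P = record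
  { Label = V m → Bool
  ; _≈_ = λ f g → ∀ p → p ∈ P → f p ≡ g p
  ; _≈?_ = λ f g → all? λ p → (p ∈? P) →-dec (f p Boolₚ.≟ g p)
  ; ≈-refl = λ p _ → refl
  ; ≈-sym = λ h p p∈ → sym (h p p∈)
  ; ≈-trans = λ h h′ p p∈ → trans (h p p∈) (h′ p p∈)
  ; _∔_ = λ f g p → f p xor g p
  ; 0# = λ _ → false
  ; ∔-cong = λ h h′ p p∈ → cong₂ _xor_ (h p p∈) (h′ p p∈)
  ; ∔-comm = λ f g p _ → Boolₚ.xor-comm (f p) (g p)
  ; ∔-assoc = λ f g h p _ → Boolₚ.xor-assoc (f p) (g p) (h p)
  ; ∔-identityʳ = λ f p _ → Boolₚ.xor-identityʳ (f p)
  ; ∔-self = λ f p _ → Boolₚ.xor-same (f p) }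

-- Concerns only the copies of N that meet W trivially, that is, those which project injectively to
-- the quotient.
Avoids : ∀ {r m d} → Config r m → Matroid d → Set
Avoids {r} {m} {d} C N = ∀ (as : Vec (V r) d) (xs : Vec (V m) d) → Independent as →
  (∀ v → v ≢ 0v d → Config.F C (lin as v) (lin xs v) ≡ Matroid.E N v) → ⊥

module _ {r m} (C : Config r m) (ub : UpperBound C) where
  open Fibres C
  open UpperBound ub
  private
    L = functionsOn top
    module L = Labels L
  open L using (_≈_; _≉_; _∔_; 0#)

  -- For c ≢ 0v, D c is the kernel of form c in top.
  form : V r → V m → Bool
  form c p = nonzero? c ∧ not (D c p)

  form-0 : form (0v r) ≈ 0#
  form-0 p _ = cong (_∧ not (D (0v r) p)) (nonzero?-0 r)

  form≡ : ∀ {c} p → c ≢ 0v r → form c p ≡ not (D c p)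
  form≡ {c} p c≢0 = cong (_∧ not (D c p)) (≢0⇒nonzero? c c≢0)

  ∈⇒form : ∀ {c p} → c ≢ 0v r → p ∈ D c → form c p ≡ false
  ∈⇒form {c} {p} c≢0 p∈ = trans (form≡ p c≢0) (cong not p∈)

  ∉⇒form : ∀ {c p} → c ≢ 0v r → p ∉ D c → form c p ≡ true
  ∉⇒form {c} {p} c≢0 p∉ = trans (form≡ p c≢0) (cong not (∉⇒false p∉))

  form⇒∈ : ∀ {c p} → c ≢ 0v r → form c p ≡ false → p ∈ D c
  form⇒∈ {c} {p} c≢0 f with p ∈? D c
  ... | yes p∈ = p∈
  ... | no p∉ = ⊥-elim (true≢false (trans (sym (∉⇒form c≢0 p∉)) f))

  top⊆⇒form≈0 : ∀ {c} → c ≢ 0v r → top ⊆ D c → form c ≈ 0#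
  top⊆⇒form≈0 c≢0 h p p∈ = ∈⇒form c≢0 (h p∈)

  ≗⇒form≈ : ∀ {a b} → a ≢ 0v r → b ≢ 0v r → D a ⊆ D b → D b ⊆ D a → form a ≈ form b
  ≗⇒form≈ {a} {b} a≢0 b≢0 h h′ p _ with p ∈? D a
  ... | yes q = trans (∈⇒form a≢0 q) (sym (∈⇒form b≢0 (h q)))
  ... | no q = trans (∉⇒form a≢0 q) (sym (∉⇒form b≢0 λ z → q (h′ z)))

  form-⊕ : ∀ c {p q} → p ∈ top → q ∈ top → form c (p ⊕ q) ≡ form c p xor form c q
  form-⊕ c {p} {q} p∈ q∈ with c ≟ᵥ 0v r
  ... | yes refl = trans (form-0 (p ⊕ q) (Subgroup.⊕∈ sg p∈ q∈)) (sym (cong₂ _xor_ (form-0 p p∈) (form-0 q q∈)))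
  ... | no c≢0 with p ∈? D c | q ∈? D c
  ...   | yes a | yes b = trans (∈⇒form c≢0 (Subgroup.⊕∈ (D-subgroup c≢0) a b)) (sym (cong₂ _xor_ (∈⇒form c≢0 a) (∈⇒form c≢0 b)))
  ...   | yes a | no b = trans (∉⇒form c≢0 λ z → b (Subgroup.cancelˡ (D-subgroup c≢0) z a)) (sym (cong₂ _xor_ (∈⇒form c≢0 a) (∉⇒form c≢0 b)))
  ...   | no a | yes b = trans (∉⇒form c≢0 λ z → a (Subgroup.cancelʳ (D-subgroup c≢0) z b)) (sym (cong₂ _xor_ (∉⇒form c≢0 a) (∈⇒form c≢0 b)))
  ...   | no a | no b = trans (∈⇒form c≢0 (two c≢0 p∈ a q∈ b)) (sym (cong₂ _xor_ (∉⇒form c≢0 a) (∉⇒form c≢0 b)))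

  open LabelledSpace L form

  private
    -- Dual to the case of a common subgroup: a direction that properly contains another one is
    -- `top` and has form zero, and in a pencil the forms add up.
    forms-⊈ : ∀ {a b c w} → Triple a b c → w ∈ D a → w ∉ D b → LineLabels (form a) (form b) (form c)
    forms-⊈ {a} {b} {c} {w} t@(triple a≢0 b≢0 c≢0 _) w∈ w∉ = byType (lineType (D-line t) w∈ w∉)
      where
      top⊆a : D b ⊆ D a → top ⊆ D a
      top⊆a b⊆a {p} p∈ with p ∈? D b
      ... | yes q = b⊆a q
      ... | no q = Subgroup.cancelʳ (D-subgroup a≢0) (b⊆a (two b≢0 p∈ q (⊆top a≢0 w∈) w∉)) w∈

      module _ (pc : Pencil (D a) (D b) (D c)) where
        open Pencil pc
        sums : ∀ {p} → p ∈ top → Dec (p ∈ D a) → Dec (p ∈ D b) → form a p xor form b p ≡ form c p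
        sums p∈ (yes x) (yes y) = trans (cong₂ _xor_ (∈⇒form a≢0 x) (∈⇒form b≢0 y)) (sym (∈⇒form c≢0 (XY⊆Z x y)))
        sums p∈ (yes x) (no y) = trans (cong₂ _xor_ (∈⇒form a≢0 x) (∉⇒form b≢0 y)) (sym (∉⇒form c≢0 λ z → y (XZ⊆Y x z)))
        sums p∈ (no x) (yes y) = trans (cong₂ _xor_ (∉⇒form a≢0 x) (∈⇒form b≢0 y)) (sym (∉⇒form c≢0 λ z → x (YZ⊆X y z)))
        sums {p} p∈ (no x) (no y) = trans (cong₂ _xor_ (∉⇒form a≢0 x) (∉⇒form b≢0 y)) (sym (∈⇒form c≢0
          (subst (_∈ D c) (solveᵥ 2 (λ w p → w :⊕ (p :⊕ w) ⊜ p) refl w p)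
            (sum w∈ w∉ (two b≢0 p∈ y (⊆top a≢0 w∈) w∉) λ z → x (Subgroup.cancelʳ (D-subgroup a≢0) z w∈)))))

      byType : LineType (D a) (D b) (D c) → LineLabels (form a) (form b) (form c)
      byType (lower a⊆c c⊆a b⊆a) = onlyy (top⊆⇒form≈0 a≢0 (top⊆a b⊆a)) (top⊆⇒form≈0 c≢0 λ p∈ → a⊆c (top⊆a b⊆a p∈))
      byType (upper b⊆c c⊆b b⊆a _) = additive λ p p∈ → trans (cong (_xor form b p) (top⊆⇒form≈0 a≢0 (top⊆a b⊆a) p p∈)) (≗⇒form≈ b≢0 c≢0 b⊆c c⊆b p p∈)
      byType (pencil pc) = additive λ p p∈ → sums pc p∈ (p ∈? D a) (p ∈? D b)

  forms : ∀ {a b c} → Triple a b c → LineLabels (form a) (form b) (form c)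
  forms {a} {b} {c} t@(triple a≢0 b≢0 c≢0 _) = byComparison (compare (D a) (D b) (D c))
    where
    byComparison : Comparison (D a) (D b) (D c) → LineLabels (form a) (form b) (form c)
    byComparison (A⊈B w∈ w∉) = forms-⊈ t w∈ w∉
    byComparison (B⊈A w∈ w∉) = LineLabels-swap (forms-⊈ (swap t) w∈ w∉)
    byComparison (A⊈C w∈ w∉) = LineLabels-rotate (LineLabels-swap (forms-⊈ (swap (rotate (rotate t))) w∈ w∉))
    byComparison (C⊈A w∈ w∉) = LineLabels-rotate (forms-⊈ (rotate (rotate t)) w∈ w∉)
    byComparison (A≗B≗C a⊆b b⊆a a⊆c c⊆a) = constant (≗⇒form≈ a≢0 b≢0 a⊆b b⊆a)
      (≗⇒form≈ b≢0 c≢0 (λ x∈ → a⊆c (b⊆a x∈)) (λ x∈ → a⊆b (c⊆a x∈)))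

  module Embed {d} (ys : Vec (V r) d) (ind : Independent ys) (π : Pairing d top) (π≡ : ∀ v p → Pairing.ϕ π v p ≡ form (lin ys v) p) where
    open Pairing π

    xs : Vec (V m) d
    xs = map point ys

    e : V d → Bool
    e v = F (lin ys v) (lin xs v)

    e-0 : e (0v d) ≡ false
    e-0 = ∉⇒false (subst (λ a → lin xs (0v d) ∉ F a) (sym (lin-0 ys)) (F-0 _))

    -- The fibre is one of the at most two classes of `D c` in lin xs v ⊕ top, and `form c` tells
    -- whether p changes the class.
    value : ∀ v {p} → v ≢ 0v d → p ∈ top → F (lin ys v) (lin xs v ⊕ p) ≡ e v xor ϕ v p
    value v {p} v≢0 p∈ = trans (valueBy (lin xs v ∈? F c) (p ∈? D c)) (cong (e v xor_) (sym (π≡ v p)))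
      where
      c = lin ys v
      c≢0 = ind v v≢0
      near : ∀ {x} → x ∈ F c → (x ⊕ lin xs v) ∈ top
      near = section sg ys ind (λ u u≢0 → ⊆top (ind u u≢0)) v v≢0
      valueBy : Dec (lin xs v ∈ F c) → Dec (p ∈ D c) → F c (lin xs v ⊕ p) ≡ e v xor form c p
      valueBy (yes σ∈) (yes p∈D) = trans (D-translate σ∈ p∈D) (sym (cong₂ _xor_ σ∈ (∈⇒form c≢0 p∈D)))
      valueBy (yes σ∈) (no p∉D) = trans (∉⇒false λ q → p∉D (subst (_∈ D c) (⊕-cancelˡ (lin xs v) p) (∈D σ∈ q)))
        (sym (cong₂ _xor_ σ∈ (∉⇒form c≢0 p∉D)))
      valueBy (no σ∉) (yes p∈D) = trans (∉⇒false λ q → σ∉ (subst (_∈ F c) (⊕-cancelʳ (lin xs v) p) (D-translate q p∈D)))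
        (sym (cong₂ _xor_ (∉⇒false σ∉) (∈⇒form c≢0 p∈D)))
      valueBy (no σ∉) (no p∉D) = trans (subst (_∈ F c) (solveᵥ 3 (λ x s p → x :⊕ ((x :⊕ s) :⊕ p) ⊜ s :⊕ p) refl (point c) (lin xs v) p)
          (D-translate (point∈ c≢0) (two c≢0 (near (point∈ c≢0)) (λ q → σ∉ (subst (_∈ F c) (⊕-cancelˡ (point c) (lin xs v)) (D-translate (point∈ c≢0) q))) p∈ p∉D)))
        (sym (cong₂ _xor_ (∉⇒false σ∉) (∉⇒form c≢0 p∉D)))

    module OddPlane (a b c : V d) (ind₃ : Independent (a ∷ b ∷ c ∷ [])) where
      inj : ∀ {v w} → lin ys v ≡ lin ys w → v ≡ w
      inj = Independent⇒Injective ys ind _ _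
      one : ∀ x → x xor not x ≡ true
      one true = refl
      one false = refl
      cs : Vec (V d) 3
      cs = a ∷ b ∷ c ∷ []
      at-a : lin cs (true ∷ false ∷ false ∷ []) ≡ a
      at-a = solveᵥ 1 (λ a → a :⊕ (:0 :⊕ (:0 :⊕ :0)) ⊜ a) refl a
      at-b : lin cs (false ∷ true ∷ false ∷ []) ≡ b
      at-b = solveᵥ 1 (λ b → :0 :⊕ (b :⊕ (:0 :⊕ :0)) ⊜ b) refl b
      at-c : lin cs (false ∷ false ∷ true ∷ []) ≡ c
      at-c = solveᵥ 1 (λ c → :0 :⊕ (:0 :⊕ (c :⊕ :0)) ⊜ c) refl c
      at-ab : lin cs (true ∷ true ∷ false ∷ []) ≡ a ⊕ b
      at-ab = solveᵥ 2 (λ a b → a :⊕ (b :⊕ (:0 :⊕ :0)) ⊜ a :⊕ b) refl a b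
      at-ac : lin cs (true ∷ false ∷ true ∷ []) ≡ a ⊕ c
      at-ac = solveᵥ 2 (λ a c → a :⊕ (:0 :⊕ (c :⊕ :0)) ⊜ a :⊕ c) refl a c
      at-bc : lin cs (false ∷ true ∷ true ∷ []) ≡ b ⊕ c
      at-bc = solveᵥ 2 (λ b c → :0 :⊕ (b :⊕ (c :⊕ :0)) ⊜ b :⊕ c) refl b c
      at-abc : lin cs (true ∷ true ∷ true ∷ []) ≡ (a ⊕ b) ⊕ c
      at-abc = solveᵥ 3 (λ a b c → a :⊕ (b :⊕ (c :⊕ :0)) ⊜ (a :⊕ b) :⊕ c) refl a b c
      a≢0 : a ≢ 0v d
      a≢0 = subst (_≢ 0v d) at-a (ind₃ (true ∷ false ∷ false ∷ []) λ ())
      b≢0 : b ≢ 0v d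
      b≢0 = subst (_≢ 0v d) at-b (ind₃ (false ∷ true ∷ false ∷ []) λ ())
      c≢0 : c ≢ 0v d
      c≢0 = subst (_≢ 0v d) at-c (ind₃ (false ∷ false ∷ true ∷ []) λ ())
      ab≢0 : a ⊕ b ≢ 0v d
      ab≢0 = subst (_≢ 0v d) at-ab (ind₃ (true ∷ true ∷ false ∷ []) λ ())
      ac≢0 : a ⊕ c ≢ 0v d
      ac≢0 = subst (_≢ 0v d) at-ac (ind₃ (true ∷ false ∷ true ∷ []) λ ())
      bc≢0 : b ⊕ c ≢ 0v d
      bc≢0 = subst (_≢ 0v d) at-bc (ind₃ (false ∷ true ∷ true ∷ []) λ ())
      abc≢0 : (a ⊕ b) ⊕ c ≢ 0v d
      abc≢0 = subst (_≢ 0v d) at-abc (ind₃ (true ∷ true ∷ true ∷ []) λ ())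
      a≢b : a ≢ b
      a≢b refl = ab≢0 (⊕-self a)
      a≢c : a ≢ c
      a≢c refl = ac≢0 (⊕-self a)
      b≢c : b ≢ c
      b≢c refl = bc≢0 (⊕-self b)

      choose : ∀ t₁ t₂ t₃ → ∃ λ p → p ∈ top × ϕ a p ≡ t₁ × ϕ b p ≡ t₂ × ϕ c p ≡ t₃
      choose t₁ t₂ t₃ with represent sg (pullback π cs ind₃) (t₁ ∷ t₂ ∷ t₃ ∷ [])
      ... | p , p∈ , f = p , p∈ ,
        trans (cong (λ v → ϕ v p) (sym at-a)) (trans (f (true ∷ false ∷ false ∷ [])) (boolIdentity {3} (λ { t@(_ ∷ _ ∷ _ ∷ []) → dot t (true ∷ false ∷ false ∷ []) }) (λ { (t ∷ _ ∷ _ ∷ []) → t }) (t₁ ∷ t₂ ∷ t₃ ∷ []))) ,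
        trans (cong (λ v → ϕ v p) (sym at-b)) (trans (f (false ∷ true ∷ false ∷ [])) (boolIdentity {3} (λ { t@(_ ∷ _ ∷ _ ∷ []) → dot t (false ∷ true ∷ false ∷ []) }) (λ { (_ ∷ t ∷ _ ∷ []) → t }) (t₁ ∷ t₂ ∷ t₃ ∷ []))) ,
        trans (cong (λ v → ϕ v p) (sym at-c)) (trans (f (false ∷ false ∷ true ∷ [])) (boolIdentity {3} (λ { t@(_ ∷ _ ∷ _ ∷ []) → dot t (false ∷ false ∷ true ∷ []) }) (λ { (_ ∷ _ ∷ t ∷ []) → t }) (t₁ ∷ t₂ ∷ t₃ ∷ [])))

      two-value : ∀ v w {p q s₁ s₂ s₃ s₄} → p ∈ top → q ∈ top → v ⊕ w ≢ 0v d → ϕ v p ≡ s₁ → ϕ v q ≡ s₂ → ϕ w p ≡ s₃ → ϕ w q ≡ s₄ →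
        F (lin ys v ⊕ lin ys w) ((lin xs v ⊕ p) ⊕ (lin xs w ⊕ q)) ≡ e (v ⊕ w) xor ((s₁ xor s₂) xor (s₃ xor s₄))
      two-value v w {p} {q} p∈ q∈ vw≢0 refl refl refl refl = trans
        (cong₂ F (sym (lin-⊕ ys v w)) (trans (⊕-interchange (lin xs v) p (lin xs w) q) (cong (_⊕ (p ⊕ q)) (sym (lin-⊕ xs v w)))))
        (trans (value (v ⊕ w) vw≢0 pq∈) (cong (e (v ⊕ w) xor_)
          (trans (additiveˡ v w pq∈) (cong₂ _xor_ (additiveʳ v p∈ q∈) (additiveʳ w p∈ q∈)))))
        where pq∈ = Subgroup.⊕∈ sg p∈ q∈

      -- The values are chosen triangularly. Those of a on p₁, b on p₂ and c on p₃ put the three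
      -- points into the ground set; those of a on p₂ and of a and b on p₃ keep the pairwise sums
      -- out. The sum of all three points then lies in the ground set exactly if the plane is even.
      module Lifted {p₁ p₂ p₃}
        (p₁∈ : p₁ ∈ top) (aP₁ : ϕ a p₁ ≡ not (e a)) (bP₁ : ϕ b p₁ ≡ false) (cP₁ : ϕ c p₁ ≡ false)
        (p₂∈ : p₂ ∈ top) (aP₂ : ϕ a p₂ ≡ e (a ⊕ b) xor (e a xor e b)) (bP₂ : ϕ b p₂ ≡ not (e b)) (cP₂ : ϕ c p₂ ≡ false)
        (p₃∈ : p₃ ∈ top) (aP₃ : ϕ a p₃ ≡ e (a ⊕ c) xor (e a xor e c)) (bP₃ : ϕ b p₃ ≡ e (b ⊕ c) xor (e b xor e c)) (cP₃ : ϕ c p₃ ≡ not (e c)) where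
        p₁₂∈ = Subgroup.⊕∈ sg p₁∈ p₂∈
        p₁₂₃∈ = Subgroup.⊕∈ sg p₁₂∈ p₃∈

        three-value : F ((lin ys a ⊕ lin ys b) ⊕ lin ys c) (((lin xs a ⊕ p₁) ⊕ (lin xs b ⊕ p₂)) ⊕ (lin xs c ⊕ p₃)) ≡
          e ((a ⊕ b) ⊕ c) xor ((((not (e a) xor (e (a ⊕ b) xor (e a xor e b))) xor (false xor not (e b))) xor ((e (a ⊕ c) xor (e a xor e c)) xor (e (b ⊕ c) xor (e b xor e c)))) xor ((false xor false) xor not (e c)))
        three-value = trans
          (cong₂ F (trans (cong (_⊕ lin ys c) (sym (lin-⊕ ys a b))) (sym (lin-⊕ ys (a ⊕ b) c)))
            (trans (solveᵥ 6 (λ x y z p q s → ((x :⊕ p) :⊕ (y :⊕ q)) :⊕ (z :⊕ s) ⊜ ((x :⊕ y) :⊕ z) :⊕ ((p :⊕ q) :⊕ s)) refl (lin xs a) (lin xs b) (lin xs c) p₁ p₂ p₃)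
              (cong (_⊕ ((p₁ ⊕ p₂) ⊕ p₃)) (trans (cong (_⊕ lin xs c) (sym (lin-⊕ xs a b))) (sym (lin-⊕ xs (a ⊕ b) c))))))
          (trans (value ((a ⊕ b) ⊕ c) abc≢0 p₁₂₃∈) (cong (e ((a ⊕ b) ⊕ c) xor_)
            (trans (additiveˡ (a ⊕ b) c p₁₂₃∈) (cong₂ _xor_
              (trans (additiveʳ (a ⊕ b) p₁₂∈ p₃∈) (cong₂ _xor_
                (trans (additiveˡ a b p₁₂∈) (cong₂ _xor_ (trans (additiveʳ a p₁∈ p₂∈) (cong₂ _xor_ aP₁ aP₂)) (trans (additiveʳ b p₁∈ p₂∈) (cong₂ _xor_ bP₁ bP₂))))
                (trans (additiveˡ a b p₃∈) (cong₂ _xor_ aP₃ bP₃))))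
              (trans (additiveʳ c p₁₂∈ p₃∈) (cong₂ _xor_ (trans (additiveʳ c p₁∈ p₂∈) (cong₂ _xor_ cP₁ cP₂)) cP₃))))))

        claw-found : planeSum e a b c ≡ true → ⊥
        claw-found odd = clawFree
          (trans (value a a≢0 p₁∈) (trans (cong (e a xor_) aP₁) (one (e a))))
          (trans (value b b≢0 p₂∈) (trans (cong (e b xor_) bP₂) (one (e b))))
          (trans (value c c≢0 p₃∈) (trans (cong (e c xor_) cP₃) (one (e c))))
          (false⇒∉ (trans (two-value a b p₁∈ p₂∈ ab≢0 aP₁ aP₂ bP₁ bP₂)
            (boolIdentity {3} (λ { (a ∷ b ∷ ab ∷ []) → ab xor ((not a xor (ab xor (a xor b))) xor (false xor not b)) }) (λ _ → false) (e a ∷ e b ∷ e (a ⊕ b) ∷ []))))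
          (false⇒∉ (trans (two-value a c p₁∈ p₃∈ ac≢0 aP₁ aP₃ cP₁ cP₃)
            (boolIdentity {3} (λ { (a ∷ c ∷ ac ∷ []) → ac xor ((not a xor (ac xor (a xor c))) xor (false xor not c)) }) (λ _ → false) (e a ∷ e c ∷ e (a ⊕ c) ∷ []))))
          (false⇒∉ (trans (two-value b c p₂∈ p₃∈ bc≢0 bP₂ bP₃ cP₂ cP₃)
            (boolIdentity {3} (λ { (b ∷ c ∷ bc ∷ []) → bc xor ((not b xor (bc xor (b xor c))) xor (false xor not c)) }) (λ _ → false) (e b ∷ e c ∷ e (b ⊕ c) ∷ []))))
          (false⇒∉ (trans three-value (trans (boolIdentity {7}
              (λ { (a ∷ b ∷ c ∷ ab ∷ ac ∷ bc ∷ abc ∷ []) → abc xor ((((not a xor (ab xor (a xor b))) xor (false xor not b)) xor ((ac xor (a xor c)) xor (bc xor (b xor c)))) xor ((false xor false) xor not c)) })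
              (λ { (a ∷ b ∷ c ∷ ab ∷ ac ∷ bc ∷ abc ∷ []) → not (sum₇ a b c ab ac bc abc) }) (e a ∷ e b ∷ e c ∷ e (a ⊕ b) ∷ e (a ⊕ c) ∷ e (b ⊕ c) ∷ e ((a ⊕ b) ⊕ c) ∷ []))
            (cong not odd))))
          (λ { (q , _) → a≢b (inj q) }) (λ { (q , _) → a≢c (inj q) }) (λ { (q , _) → b≢c (inj q) })

      impossible : planeSum e a b c ≡ true → ⊥
      impossible = lift (choose (not (e a)) false false) (choose (e (a ⊕ b) xor (e a xor e b)) (not (e b)) false)
          (choose (e (a ⊕ c) xor (e a xor e c)) (e (b ⊕ c) xor (e b xor e c)) (not (e c)))
        where
        Choice : Bool → Bool → Bool → Set
        Choice t₁ t₂ t₃ = ∃ λ p → p ∈ top × ϕ a p ≡ t₁ × ϕ b p ≡ t₂ × ϕ c p ≡ t₃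
        lift : Choice (not (e a)) false false → Choice (e (a ⊕ b) xor (e a xor e b)) (not (e b)) false →
          Choice (e (a ⊕ c) xor (e a xor e c)) (e (b ⊕ c) xor (e b xor e c)) (not (e c)) → planeSum e a b c ≡ true → ⊥
        lift (_ , p₁∈ , aP₁ , bP₁ , cP₁) (_ , p₂∈ , aP₂ , bP₂ , cP₂) (_ , p₃∈ , aP₃ , bP₃ , cP₃) =
          Lifted.claw-found p₁∈ aP₁ bP₁ cP₁ p₂∈ aP₂ bP₂ cP₂ p₃∈ aP₃ bP₃ cP₃

    -- On an odd plane, moving the three basis vectors along top would produce a claw.
    e-even : ∀ a b c → Independent (a ∷ b ∷ c ∷ []) → planeSum e a b c ≡ false
    e-even a b c ind₃ = Boolₚ.¬-not (OddPlane.impossible a b c ind₃)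

    -- Moving the section by a linear map into `top` changes the quadratic form `e` by any
    -- prescribed quadratic form, in particular by the difference between `e` and N.
    contains : (N : Matroid d) → EvenPlane N → ¬ Avoids C N
    contains N even avoids = conclude (quadratic-represent sg π h h-0 h-quadratic)
      where
      h : V d → Bool
      h v = e v xor supported N v
      h-0 : h (0v d) ≡ false
      h-0 = cong₂ _xor_ e-0 (supported-0 N)
      h-quadratic : Quadratic h
      h-quadratic a b c = trans (sum₇-xor (e a) (e b) (e c) (e (a ⊕ b)) (e (a ⊕ c)) (e (b ⊕ c)) (e ((a ⊕ b) ⊕ c))
          (supported N a) (supported N b) (supported N c) (supported N (a ⊕ b)) (supported N (a ⊕ c)) (supported N (b ⊕ c)) (supported N ((a ⊕ b) ⊕ c)))
        (cong₂ _xor_ (independent⇒quadratic e e-0 e-even a b c) (evenPlane⇒quadratic N even a b c))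
      cancel : ∀ x y → x xor (x xor y) ≡ y
      cancel true y = Boolₚ.not-involutive y
      cancel false y = refl
      conclude : (∃ λ (ps : Vec (V m) d) → ∀ v → lin ps v ∈ top × ϕ v (lin ps v) ≡ h v) → ⊥
      conclude (ps , rep) = avoids ys (zipWith _⊕_ xs ps) ind λ v v≢0 →
        trans (cong (F (lin ys v)) (lin-zipWith xs ps v)) (trans (value v v≢0 (proj₁ (rep v)))
          (trans (cong (e v xor_) (proj₂ (rep v))) (trans (cancel (e v) (supported N v)) (supported-≢0 N v≢0))))

  upperBound⇒≤ : ∀ {k d} (N : Matroid d) → EvenPlane N → Avoids C N → CliquesAtMost k → r ≤ 2 ^ suc k + k ⊎ r ≤ k + d
  upperBound⇒≤ {k} {d} N even avoids atMost with any? (λ a → any? λ b → ¬? (form a L.≈? 0#) ×-dec (¬? (form b L.≈? 0#) ×-dec ¬? (form a L.≈? form b)))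
  ... | yes (a , b , a≉0 , b≉0 , a≉b) with vanishing-or-nonVanishing form-0 forms a b a≉0 b≉0 a≉b (suc k) d
  ...   | inj₁ (cs , van) = ⊥-elim (ℕₚ.1+n≰n (atMost (suc k) cs (map point cs) (constant⇒clique sg cs (λ v v≢0 → proj₁ (van v v≢0))
          (λ v v≢0 → ⊆top (proj₁ (van v v≢0))) λ v v≢0 {x} x∈ → form⇒∈ (proj₁ (van v v≢0)) (proj₂ (van v v≢0) x x∈))))
  ...   | inj₂ (inj₂ (i , j , s≤s i≤k , j<d , r≤)) = inj₂ (ℕₚ.≤-trans r≤ (ℕₚ.+-mono-≤ i≤k (ℕₚ.<⇒≤ j<d)))
  ...   | inj₂ (inj₁ (ys , non)) = ⊥-elim (Embed.contains ys (nonVanishing⇒independent form-0 forms ys non) π (λ _ _ → refl) N even avoids)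
    where
    witness : ∀ c → form c ≉ 0# → ∃ λ p → p ∈ top × form c p ≡ true
    witness c c≉0 with any? (λ p → (p ∈? top) ×-dec (form c p Boolₚ.≟ true))
    ... | yes r = r
    ... | no none = ⊥-elim (c≉0 λ p p∈ → ∉⇒false λ q → none (p , p∈ , q))
    π : Pairing d top
    π = record
      { ϕ = λ v → form (lin ys v)
      ; additiveˡ = λ v w {p} p∈ → nonVanishing-additive form-0 forms a b a≉0 b≉0 a≉b ys non v w p p∈
      ; additiveʳ = λ v → form-⊕ (lin ys v)
      ; nondegenerate = λ v v≢0 → witness (lin ys v) (non v v≢0) }
  upperBound⇒≤ {k} {d} N even avoids atMost | no none with any? (λ a → ¬? (form a L.≈? 0#))
  ... | no allZero = inj₁ (lowerBound⇒≤ C (record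
        { base = top ; sg = sg ; base⊆ = λ {c} c≢0 {x} x∈ → form⇒∈ c≢0 (zeroForm c x x∈)
        ; two = λ c≢0 x∈ x∉ _ _ → ⊥-elim (x∉ (⊆top c≢0 x∈)) }) atMost)
    where
    zeroForm : ∀ c → form c ≈ 0#
    zeroForm c with form c L.≈? 0#
    ... | yes p = p
    ... | no p = ⊥-elim (allZero (c , p))
  -- All nonzero forms agree, so every direction is `D a` or `top`, and `D a` serves as the common
  -- subgroup.
  ... | yes (a , a≉0) = inj₁ (lowerBound⇒≤ C (record
        { base = D a ; sg = D-subgroup a≢0 ; base⊆ = base⊆
        ; two = λ c≢0 x∈ x∉ y∈ y∉ → two a≢0 (⊆top c≢0 x∈) x∉ (⊆top c≢0 y∈) y∉ }) atMost)
    where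
    a≢0 : a ≢ 0v r
    a≢0 refl = a≉0 form-0
    base⊆ : ∀ {c} → c ≢ 0v r → D a ⊆ D c
    base⊆ {c} c≢0 {x} x∈ with form c L.≈? 0# | form c L.≈? form a
    ... | yes p | _ = form⇒∈ c≢0 (p x (⊆top a≢0 x∈))
    ... | no _ | yes p = form⇒∈ c≢0 (trans (p x (⊆top a≢0 x∈)) (∈⇒form a≢0 x∈))
    ... | no p | no q = ⊥-elim (none (c , a , p , a≉0 , q))

-- Induction on the clique number

restrict-avoids : ∀ {r m k d} (C : Config r m) (N : Matroid d) (cs : Vec (V r) k) (ind : Independent cs) → Avoids C N → Avoids (restrict C cs ind) N
restrict-avoids C N cs ind avoids as xs ind-as h = avoids (map (lin cs) as) xs
  (λ v v≢0 p → ind (lin as v) (ind-as v v≢0) (trans (sym (lin-map cs as v)) p))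
  λ v v≢0 → trans (cong (λ a → Config.F C a (lin xs v)) (lin-map cs as v)) (h v v≢0)

-- (k + 4) 2ᵏ⁺¹ + d + 4 is the difference of f at k + 1 and at k; the rest compares it with the two
-- bounds for j.
f-step : ∀ d k i j → i ≤ f d k → j ≤ 2 ^ suc (suc k) + suc k ⊎ j ≤ suc k + d → i + j ≤ f d (suc k)
f-step d k i j i≤ j≤ = begin
  i + j ≤⟨ ℕₚ.+-mono-≤ i≤ (increment j≤) ⟩
  f d k + ((k + 4) * K + (d + 4))
    ≡⟨ solve 3 (λ k d K → ((k :+ con 2) :* K :+ k :* (d :+ con 4)) :+ ((k :+ con 4) :* K :+ (d :+ con 4))
         := (con 1 :+ k :+ con 2) :* (con 2 :* K) :+ (con 1 :+ k) :* (d :+ con 4)) refl k d K ⟩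
  f d (suc k) ∎
  where
  open ℕₚ.≤-Reasoning
  open ℕ-Solver
  K = 2 ^ (k + 1)
  k<K : suc k ≤ K
  k<K = ℕₚ.<⇒≤ (subst (_< K) (ℕₚ.+-comm k 1) (n<2^n (k + 1)))
  increment : j ≤ 2 ^ suc (suc k) + suc k ⊎ j ≤ suc k + d → j ≤ (k + 4) * K + (d + 4)
  increment (inj₁ p) = begin
    j ≤⟨ p ⟩
    2 ^ suc (suc k) + suc k ≡⟨ cong (λ e → 2 * 2 ^ e + suc k) (ℕₚ.+-comm 1 k) ⟩
    2 * K + suc k ≤⟨ ℕₚ.+-monoʳ-≤ (2 * K) k<K ⟩
    2 * K + K ≤⟨ ℕₚ.m≤m+n _ ((k + 1) * K + (d + 4)) ⟩
    2 * K + K + ((k + 1) * K + (d + 4)) ≡⟨ solve 3 (λ k d K → con 2 :* K :+ K :+ ((k :+ con 1) :* K :+ (d :+ con 4)) := (k :+ con 4) :* K :+ (d :+ con 4)) refl k d K ⟩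
    (k + 4) * K + (d + 4) ∎
  increment (inj₂ p) = begin
    j ≤⟨ p ⟩
    suc k + d ≤⟨ ℕₚ.+-monoˡ-≤ d k<K ⟩
    K + d ≤⟨ ℕₚ.m≤m+n _ ((k + 3) * K + 4) ⟩
    K + d + ((k + 3) * K + 4) ≡⟨ solve 3 (λ k d K → K :+ d :+ ((k :+ con 3) :* K :+ con 4) := (k :+ con 4) :* K :+ (d :+ con 4)) refl k d K ⟩
    (k + 4) * K + (d + 4) ∎

doubles⇒≤ : ∀ {r m k d} (C : Config r m) (N : Matroid d) → EvenPlane N → Avoids C N → Fibres.CliquesAtMost C k →
  (∀ a b → a ≢ 0v r → b ≢ 0v r → Fibres.count-D C a ≤ 2 * Fibres.count-D C b) → r ≤ 2 ^ suc k + k ⊎ r ≤ k + d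
doubles⇒≤ {zero} C N even avoids atMost doubles = inj₁ z≤n
doubles⇒≤ {suc r} C N even avoids atMost doubles with classify C (true ∷ 0v r , λ ()) doubles
... | inj₁ lb = inj₁ (lowerBound⇒≤ C lb atMost)
... | inj₂ ub = upperBound⇒≤ C ub N even avoids atMost

config-bound : ∀ k {r m d} (C : Config r m) (N : Matroid d) → EvenPlane N → Avoids C N → Fibres.CliquesAtMost C k → r ≤ f d k
config-bound k {zero} C N even avoids atMost = z≤n
-- Any point of any fibre is a clique of dimension one, so the quotient must be trivial.
config-bound zero {suc r} C N even avoids atMost = ⊥-elim (ℕₚ.1+n≰n (atMost 1 (a ∷ []) (point a ∷ []) λ
    { (true ∷ []) _ → subst₂ (λ b x → x ∈ F b) (sym (⊕-idʳ a)) (sym (⊕-idʳ (point a))) (point∈ λ ())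
    ; (false ∷ []) v≢0 → ⊥-elim (v≢0 refl) }))
  where
  open Fibres C
  a : V (suc r)
  a = true ∷ 0v r
config-bound (suc k) {suc r} {d = d} C N even avoids atMost = ℕₚ.≤-trans r≤i+j (f-step d k i j
    (config-bound k (restrict C us ind-us) N even (restrict-avoids C N us ind-us avoids) fewer)
    (doubles⇒≤ (restrict C vs ind-vs) N even (restrict-avoids C N vs ind-vs avoids)
      (λ l as xs clique → atMost l (map (lin vs) as) xs (restrict-clique C vs ind-vs as xs clique)) doubles))
  where open Splitting (splitting C (true ∷ 0v r , λ ()) atMost)

-- The fibres of a matroid over a maximum flat avoiding it

dot-surjective : ∀ {n} (l : V n) → l ≢ 0v n → ∀ b → ∃ λ x → dot l x ≡ b
dot-surjective l l≢0 false = 0v _ , dot-0ʳ l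
dot-surjective [] l≢0 true = ⊥-elim (l≢0 refl)
dot-surjective (true ∷ l) l≢0 true = (true ∷ 0v _) , cong not (dot-0ʳ l)
dot-surjective (false ∷ l) l≢0 true with dot-surjective l (λ { refl → l≢0 refl }) true
... | x , p = (false ∷ x) , p

module Coordinates {n r m} (M : Matroid n) (us : Vec (V n) r) (φ : Vec (V n) m) (ind : Independent (us ++ φ))
  (φ-avoids : ∀ x → x ≢ 0v m → Matroid.E (compl M) (lin φ x) ≡ true)
  (maximum : ∀ k → HasFlat (compl M) k → k ≤ m) (free : ClawFree M) where

  E′ : V n → Bool
  E′ = Matroid.E M

  ι : V r → V m → V n
  ι a x = lin us a ⊕ lin φ x

  ι-⊕ : ∀ a x b y → ι a x ⊕ ι b y ≡ ι (a ⊕ b) (x ⊕ y)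
  ι-⊕ a x b y = trans (⊕-interchange (lin us a) (lin φ x) (lin us b) (lin φ y)) (sym (cong₂ _⊕_ (lin-⊕ us a b) (lin-⊕ φ x y)))

  ι≢0 : ∀ {a x} → ¬ (a ≡ 0v r × x ≡ 0v m) → ι a x ≢ 0v n
  ι≢0 {a} {x} h p = ind (a ++ x) (λ q → h (++≡0⇒ a x q)) (trans (lin-++ us φ a x) p)

  ι-injective : ∀ {a x b y} → ι a x ≡ ι b y → a ≡ b × x ≡ y
  ι-injective {a} {x} {b} {y} p with (a ⊕ b) ≟ᵥ 0v r | (x ⊕ y) ≟ᵥ 0v m
  ... | yes q | yes q′ = ⊕≡0⇒≡ q , ⊕≡0⇒≡ q′
  ... | no q | _ = ⊥-elim (ι≢0 (q ∘ proj₁) (trans (sym (ι-⊕ a x b y)) (trans (cong (_⊕ ι b y) p) (⊕-self _))))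
  ... | yes _ | no q = ⊥-elim (ι≢0 (q ∘ proj₂) (trans (sym (ι-⊕ a x b y)) (trans (cong (_⊕ ι b y) p) (⊕-self _))))

  -- Over zero the ground set is empty except possibly for the value at the zero vector, which the
  -- guard discards.
  fibre : V r → Subset m
  fibre a x = nonzero? a ∧ E′ (ι a x)

  fibre≡ : ∀ {a} x → a ≢ 0v r → fibre a x ≡ E′ (ι a x)
  fibre≡ {a} x a≢0 = cong (_∧ E′ (ι a x)) (≢0⇒nonzero? a a≢0)

  fibre-0 : ∀ x → x ∉ fibre (0v r)
  fibre-0 x = false⇒∉ (cong (_∧ E′ (ι (0v r) x)) (nonzero?-0 r))

  ∈fibre⇒≢0 : ∀ {a x} → x ∈ fibre a → a ≢ 0v r
  ∈fibre⇒≢0 {x = x} x∈ refl = fibre-0 x x∈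

  ∈fibre⇒E : ∀ {a x} → x ∈ fibre a → E′ (ι a x) ≡ true
  ∈fibre⇒E {a} {x} x∈ = trans (sym (fibre≡ x (∈fibre⇒≢0 x∈))) x∈

  not-true : ∀ {b} → not b ≡ true → b ≡ false
  not-true {false} _ = refl

  φ∉E : ∀ x → x ≢ 0v m → E′ (lin φ x) ≡ false
  φ∉E x x≢0 = not-true (φ-avoids x x≢0)

  ∉fibre⇒E : ∀ {a x} → ¬ (a ≡ 0v r × x ≡ 0v m) → x ∉ fibre a → E′ (ι a x) ≡ false
  ∉fibre⇒E {a} {x} ≢0 x∉ with a ≟ᵥ 0v r
  ... | no a≢0 = trans (sym (fibre≡ x a≢0)) (∉⇒false x∉)
  ... | yes refl = trans (cong E′ (trans (cong (_⊕ lin φ x) (lin-0 us)) (⊕-idˡ _))) (φ∉E x λ q → ≢0 (refl , q))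

  φ-independent : Independent φ
  φ-independent x x≢0 p = ι≢0 {0v r} {x} (x≢0 ∘ proj₂) (trans (cong₂ _⊕_ (lin-0 us) p) (⊕-self _))

  -- Over an empty fibre W could be enlarged by `lin us a`.
  inhabited : ∀ a → a ≢ 0v r → ∃ λ x → x ∈ fibre a
  inhabited a a≢0 with any? (λ x → x ∈? fibre a)
  ... | yes p = p
  ... | no none = ⊥-elim (ℕₚ.1+n≰n (maximum (suc m) (lin us a ∷ φ , Independent⇒Injective (lin us a ∷ φ) ind′ , avoid)))
    where
    ind′ : Independent (lin us a ∷ φ)
    ind′ (true ∷ x) _ = ι≢0 {a} {x} (a≢0 ∘ proj₁)
    ind′ (false ∷ x) v≢0 p = φ-independent x (λ { refl → v≢0 refl }) (trans (sym (lin-0∷ (lin us a) φ x)) p)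
    avoid : ∀ v → v ≢ 0v (suc m) → not (E′ (lin (lin us a ∷ φ) v)) ≡ true
    avoid (true ∷ x) _ = cong not (∉fibre⇒E {a} {x} (a≢0 ∘ proj₁) λ p → none (x , p))
    avoid (false ∷ x) v≢0 = trans (cong (not ∘ E′) (lin-0∷ (lin us a) φ x)) (φ-avoids x λ { refl → v≢0 refl })

  -- Distinctness of the three points suffices for independence: none of them is zero, as each lies
  -- over a nonzero point, and the third is not the sum of the others, because that sum is outside
  -- the ground set.
  clawFree : ∀ {a b c x y z} → x ∈ fibre a → y ∈ fibre b → z ∈ fibre c →
    (x ⊕ y) ∉ fibre (a ⊕ b) → (x ⊕ z) ∉ fibre (a ⊕ c) → (y ⊕ z) ∉ fibre (b ⊕ c) → ((x ⊕ y) ⊕ z) ∉ fibre ((a ⊕ b) ⊕ c) →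
    ¬ (a ≡ b × x ≡ y) → ¬ (a ≡ c × x ≡ z) → ¬ (b ≡ c × y ≡ z) → ⊥
  clawFree {a} {b} {c} {x} {y} {z} x∈ y∈ z∈ xy∉ xz∉ yz∉ xyz∉ ab ac bc = free (A ∷ B ∷ C ∷ [] , Independent⇒Injective (A ∷ B ∷ C ∷ []) indABC , values)
    where
    A = ι a x
    B = ι b y
    C = ι c z
    abc : ¬ (a ⊕ b ≡ c × x ⊕ y ≡ z)
    abc (refl , refl) = xy∉ z∈
    sum≢0 : ∀ {k l} {p q : V k} {s t : V l} → ¬ (p ≡ q × s ≡ t) → ¬ (p ⊕ q ≡ 0v k × s ⊕ t ≡ 0v l)
    sum≢0 h (e , e′) = h (⊕≡0⇒≡ e , ⊕≡0⇒≡ e′)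
    AB : E′ (A ⊕ B) ≡ false
    AB = trans (cong E′ (ι-⊕ a x b y)) (∉fibre⇒E (sum≢0 ab) xy∉)
    AC : E′ (A ⊕ C) ≡ false
    AC = trans (cong E′ (ι-⊕ a x c z)) (∉fibre⇒E (sum≢0 ac) xz∉)
    BC : E′ (B ⊕ C) ≡ false
    BC = trans (cong E′ (ι-⊕ b y c z)) (∉fibre⇒E (sum≢0 bc) yz∉)
    ABC : E′ ((A ⊕ B) ⊕ C) ≡ false
    ABC = trans (cong E′ (trans (cong (_⊕ C) (ι-⊕ a x b y)) (ι-⊕ (a ⊕ b) (x ⊕ y) c z))) (∉fibre⇒E (sum≢0 abc) xyz∉)
    indABC : Independent (A ∷ B ∷ C ∷ [])
    indABC = independent₃ (ι≢0 (∈fibre⇒≢0 x∈ ∘ proj₁)) (ι≢0 (∈fibre⇒≢0 y∈ ∘ proj₁)) (ι≢0 (∈fibre⇒≢0 z∈ ∘ proj₁))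
      (ab ∘ ι-injective) (ac ∘ ι-injective) (bc ∘ ι-injective) (λ p → abc (ι-injective (trans (sym (ι-⊕ a x b y)) p)))
    values : ∀ v → v ≢ 0v 3 → E′ (lin (A ∷ B ∷ C ∷ []) v) ≡ Matroid.E claw v
    values (true ∷ true ∷ true ∷ []) _ = trans (cong E′ (solveᵥ 3 (λ a b c → a :⊕ (b :⊕ (c :⊕ :0)) ⊜ (a :⊕ b) :⊕ c) refl A B C)) ABC
    values (true ∷ true ∷ false ∷ []) _ = trans (cong E′ (solveᵥ 2 (λ a b → a :⊕ (b :⊕ (:0 :⊕ :0)) ⊜ a :⊕ b) refl A B)) AB
    values (true ∷ false ∷ true ∷ []) _ = trans (cong E′ (solveᵥ 2 (λ a c → a :⊕ (:0 :⊕ (c :⊕ :0)) ⊜ a :⊕ c) refl A C)) AC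
    values (true ∷ false ∷ false ∷ []) _ = trans (cong E′ (solveᵥ 1 (λ a → a :⊕ (:0 :⊕ (:0 :⊕ :0)) ⊜ a) refl A)) (∈fibre⇒E x∈)
    values (false ∷ true ∷ true ∷ []) _ = trans (cong E′ (solveᵥ 2 (λ b c → :0 :⊕ (b :⊕ (c :⊕ :0)) ⊜ b :⊕ c) refl B C)) BC
    values (false ∷ true ∷ false ∷ []) _ = trans (cong E′ (solveᵥ 1 (λ b → :0 :⊕ (b :⊕ (:0 :⊕ :0)) ⊜ b) refl B)) (∈fibre⇒E y∈)
    values (false ∷ false ∷ true ∷ []) _ = trans (cong E′ (solveᵥ 1 (λ c → :0 :⊕ (:0 :⊕ (c :⊕ :0)) ⊜ c) refl C)) (∈fibre⇒E z∈)
    values (false ∷ false ∷ false ∷ []) v≢0 = ⊥-elim (v≢0 refl)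

  Separated : V r → V r → V m → Bool → Bool → Set
  Separated a b l α β = (∀ x → x ∈ fibre a → dot l x ≡ α) × (∀ x → x ∈ fibre b → dot l x ≡ β) ×
    (∀ x → x ∈ fibre (a ⊕ b) → dot l x ≡ not (α xor β))

  -- The flat spanned by (a , p), (b , q) and 0 × W′.
  module Enlarge {m′} (κ : Vec (V m) m′) (κ-ind : Independent κ) {a b} (a≢0 : a ≢ 0v r) (b≢0 : b ≢ 0v r) (ab≢0 : a ⊕ b ≢ 0v r) {l α β}
    (κ-kernel : ∀ w → dot l (lin κ w) ≡ false) (sep : Separated a b l α β) {p q} (lp : dot l p ≡ not α) (lq : dot l q ≡ not β) where

    cs : Vec (V n) (suc (suc m′))
    cs = ι a p ∷ ι b q ∷ map (lin φ) κ

    shift : ∀ c s w → ι c s ⊕ lin (map (lin φ) κ) w ≡ ι c (s ⊕ lin κ w)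
    shift c s w = trans (cong (ι c s ⊕_) (lin-map φ κ w)) (trans (⊕-assoc (lin us c) (lin φ s) (lin φ (lin κ w))) (cong (lin us c ⊕_) (sym (lin-⊕ φ s (lin κ w)))))

    level : ∀ {s b} w → dot l s ≡ b → dot l (s ⊕ lin κ w) ≡ b
    level {s} w e = trans (dot-⊕ l s (lin κ w)) (trans (cong₂ _xor_ e (κ-kernel w)) (Boolₚ.xor-identityʳ _))

    -- Over a and b the form l takes on the new flat the negation of its value on the fibre. Over a
    -- ⊕ b it takes not α xor not β = α xor β, again the negation of the value there.
    as-ι : ∀ v → v ≢ 0v _ → (∃ λ c → ∃ λ x → lin cs v ≡ ι c x × c ≢ 0v r × x ∉ fibre c) ⊎ (∃ λ x → lin cs v ≡ lin φ x × x ≢ 0v m)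
    as-ι (true ∷ true ∷ w) _ = inj₁ (a ⊕ b , (p ⊕ q) ⊕ lin κ w ,
      trans (sym (⊕-assoc (ι a p) (ι b q) _)) (trans (cong (_⊕ lin (map (lin φ) κ) w) (ι-⊕ a p b q)) (shift (a ⊕ b) (p ⊕ q) w)) , ab≢0 ,
      λ x∈ → Boolₚ.not-¬ (trans (sym (proj₂ (proj₂ sep) _ x∈)) (level w (trans (dot-⊕ l p q) (trans (cong₂ _xor_ lp lq) (Boolₚ.xor-annihilates-not α β))))) refl)
    as-ι (true ∷ false ∷ w) _ = inj₁ (a , p ⊕ lin κ w , trans (cong (ι a p ⊕_) (⊕-idˡ _)) (shift a p w) , a≢0 ,
      λ x∈ → Boolₚ.not-¬ (trans (sym (level w lp)) (proj₁ sep _ x∈)) refl)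
    as-ι (false ∷ true ∷ w) _ = inj₁ (b , q ⊕ lin κ w , trans (⊕-idˡ _) (shift b q w) , b≢0 ,
      λ x∈ → Boolₚ.not-¬ (trans (sym (level w lq)) (proj₁ (proj₂ sep) _ x∈)) refl)
    as-ι (false ∷ false ∷ w) v≢0 = inj₂ (lin κ w , trans (⊕-idˡ _) (trans (⊕-idˡ _) (lin-map φ κ w)) , κ-ind w λ { refl → v≢0 refl })

    larger : suc (suc m′) ≤ m
    larger = maximum _ (cs , Independent⇒Injective cs cs-ind , cs-avoids)
      where
      cs-ind : Independent cs
      cs-ind v v≢0 e with as-ι v v≢0
      ... | inj₁ (c , x , e′ , c≢0 , _) = ι≢0 {c} {x} (c≢0 ∘ proj₁) (trans (sym e′) e)
      ... | inj₂ (x , e′ , x≢0) = φ-independent x x≢0 (trans (sym e′) e)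
      cs-avoids : ∀ v → v ≢ 0v _ → not (E′ (lin cs v)) ≡ true
      cs-avoids v v≢0 with as-ι v v≢0
      ... | inj₁ (c , x , e′ , c≢0 , x∉) = cong not (trans (cong E′ e′) (∉fibre⇒E (c≢0 ∘ proj₁) x∉))
      ... | inj₂ (x , e′ , x≢0) = cong not (trans (cong E′ e′) (φ∉E x x≢0))

-- A nonzero l has a kernel of dimension m - 1, and two more vectors give an avoiding flat of
-- dimension m + 1. For l = 0 all three values are false, whereas α = β = false requires true over a
-- ⊕ b.
inseparable-fibres : ∀ {n r m} (M : Matroid n) (us : Vec (V n) r) (φ : Vec (V n) m) (ind : Independent (us ++ φ))
  (φ-avoids : ∀ x → x ≢ 0v m → Matroid.E (compl M) (lin φ x) ≡ true)
  (maximum : ∀ k → HasFlat (compl M) k → k ≤ m) (free : ClawFree M) → ∀ {a b} → a ≢ 0v r → b ≢ 0v r → a ⊕ b ≢ 0v r →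
  ∀ l α β → ¬ Coordinates.Separated M us φ ind φ-avoids maximum free a b l α β
inseparable-fibres {m = m} M us φ ind φ-avoids maximum free {a} {b} a≢0 b≢0 ab≢0 l α β sep@(sep-a , sep-b , sep-ab) with l ≟ᵥ 0v m
... | yes refl = true≢false (trans (sym (cong₂ (λ α β → not (α xor β)) (value sep-a a≢0) (value sep-b b≢0))) (value sep-ab ab≢0))
  where
  open Coordinates M us φ ind φ-avoids maximum free
  value : ∀ {c γ} → (∀ x → x ∈ fibre c → dot (0v m) x ≡ γ) → c ≢ 0v _ → γ ≡ false
  value {c} h c≢0 = trans (sym (h _ (proj₂ (inhabited c c≢0)))) (dot-0ˡ (proj₁ (inhabited c c≢0)))
inseparable-fibres {m = zero} M us φ ind φ-avoids maximum free a≢0 b≢0 ab≢0 [] α β sep | no l≢0 = l≢0 refl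
inseparable-fibres {m = suc m′} M us φ ind φ-avoids maximum free {a} {b} a≢0 b≢0 ab≢0 l α β sep | no l≢0 =
    ℕₚ.1+n≰n (Enlarge.larger κ κ-ind a≢0 b≢0 ab≢0 {l = l} κ-kernel sep
      (proj₂ (dot-surjective l l≢0 (not α))) (proj₂ (dot-surjective l l≢0 (not β))))
  where
  open Coordinates M us φ ind φ-avoids maximum free
  κ = map (kernel l) (basis m′)
  κ≡ : ∀ w → lin κ w ≡ kernel l w
  κ≡ w = trans (additive⇒lin (kernel-additive l) (basis m′) w) (cong (kernel l) (lin-basis w))
  κ-ind : Independent κ
  κ-ind w w≢0 p = w≢0 (kernel-injective l w (trans (sym (κ≡ w)) p))
  κ-kernel : ∀ w → dot l (lin κ w) ≡ false
  κ-kernel w = trans (cong (dot l) (κ≡ w)) (dot-kernel l w)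

theorem7p5 : ∀ {d : ℕ} (N : Matroid d) → EvenPlane N →
    ∀ {n : ℕ} (M : Matroid n) → ClawFree M → Free N M →
    ∀ (w c : ℕ) → IsOmega M w → IsOmega (compl M) c →
    n ∸ c ≤ f d w
theorem7p5 {d} N even {n} M free freeN w c (_ , ω≤) ((φ , φ-inj , φ-avoids) , maximum) =
  bound (grow-independent φ (Injective⇒Independent φ φ-inj))
  where
  bound : (∃ λ r → Σ (Vec (V n) r) λ us → Independent (us ++ φ) × Spans (us ++ φ)) → n ∸ c ≤ f d w
  bound (r , us , ind , spans) = ℕₚ.≤-trans (ℕₚ.m≤n+o⇒m∸n≤o n c (ℕₚ.≤-trans (spans⇒≤ (us ++ φ) spans) (ℕₚ.≤-reflexive (ℕₚ.+-comm r c))))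
      (config-bound w C N even avoids atMost)
    where
    open Coordinates M us φ ind φ-avoids maximum free
    C : Config r c
    C = record
      { F = fibre ; F-0 = fibre-0 ; inhabited = inhabited ; clawFree = clawFree
      ; inseparable = λ { a≢0 b≢0 c≢0 refl l α β h₁ h₂ h₃ → inseparable-fibres M us φ ind φ-avoids maximum free a≢0 b≢0 c≢0 l α β (h₁ , h₂ , h₃) } }

    lift : ∀ {k} → Vec (V r) k → Vec (V c) k → Vec (V n) k
    lift as xs = zipWith _⊕_ (map (lin us) as) (map (lin φ) xs)

    lin-lift : ∀ {k} (as : Vec (V r) k) xs v → lin (lift as xs) v ≡ ι (lin as v) (lin xs v)
    lin-lift as xs v = trans (lin-zipWith (map (lin us) as) (map (lin φ) xs) v) (cong₂ _⊕_ (lin-map us as v) (lin-map φ xs v))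

    lift-injective : ∀ {k} (as : Vec (V r) k) xs → Independent as → Injective (lift as xs)
    lift-injective as xs ind-as = Independent⇒Injective (lift as xs) λ v v≢0 p →
      ι≢0 {lin as v} {lin xs v} (ind-as v v≢0 ∘ proj₁) (trans (sym (lin-lift as xs v)) p)

    avoids : Avoids C N
    avoids as xs ind-as h = freeN (lift as xs , lift-injective as xs ind-as , λ v v≢0 →
      trans (cong E′ (lin-lift as xs v)) (trans (sym (fibre≡ (lin xs v) (ind-as v v≢0))) (h v v≢0)))

    atMost : Fibres.CliquesAtMost C w
    atMost k as xs clique = ω≤ k (lift as xs , lift-injective as xs (λ v v≢0 → ∈fibre⇒≢0 (clique v v≢0)) , λ v v≢0 →
      trans (cong E′ (lin-lift as xs v)) (∈fibre⇒E (clique v v≢0)))
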